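{- Let $n\ge2$ and let $c=p_1\cdots p_n$ be a product of distinct irregular primes. Then $\Lambda(c)$ has a solution only if there exists a set of strong friendly irregular pairs $S=\{(p_1,l_1),\ldots,(p_n,l_n)\}$. For each such set $S$ there is a unique integer $m_S$ with \[ c\le m_S-1\le \operatorname{lcm}(c,p_1-1,\ldots,p_n-1) \] which simultaneously solves the congruences \[ m_S-1\equiv p_\nu(l_\nu-1)\pmod{p_\nu(p_\nu-1)},\qquad \nu=1,\ldots,n. \] Moreover $\Lambda(c)=\min_S m_S$, where $S$ runs over all such sets of strong friendly irregular pairs.
   Context: $B_n$ denotes the $n$-th Bernoulli number ($\frac{z}{e^z-1}=\sum_{n\ge0}B_n\frac{z^n}{n!}$), $\operatorname{num}(r)$ the numerator of a rational number in lowest terms. For an odd prime $p$, $(p,l)$ is an irregular pair if $l$ is even, $2\le l\le p-3$ and $p\mid B_l$; $p$ is irregular if it has an irregular pair. For a positive integer $c$, $\Lambda(c)$ is the least even integer $m\ge2$ such that $\operatorname{num}(B_m/m)\big/\operatorname{num}(B_m/(m(m-1)))\equiv0\pmod c$, with $\Lambda(c)=\infty$ (no solution) if no such $m$ exists. Irregular pairs $(p_1,l_1),\ldots,(p_n,l_n)$ are friendly if $l_i\equiv l_j\pmod{\gcd(p_i-1,p_j-1)}$ for all $i\neq j$; they are strong friendly if, in addition, for all $i\neq j$ either $p_i\not\equiv1\pmod{p_j}$ or both $p_i\equiv1$ and $l_i\equiv1\pmod{p_j}$. -}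

module Defs where

open import Data.Empty using (⊥)
open import Data.Integer.Base as ℤ using (ℤ; +_; 0ℤ; 1ℤ)
import Data.Integer.Divisibility as ℤ
open import Data.List.Base using (List; []; _∷_)
open import Data.Nat.Base as ℕ using (ℕ; zero; suc; 2+; _≤_; _!; NonZero)
open import Data.Nat.Divisibility using (_∣_)
open import Data.Nat.GCD using (gcd)
open import Data.Nat.LCM using (lcm)
open import Data.Nat.Primality using (Prime)
open import Data.Nat.Properties using (_!≢0)
open import Data.Product.Base using (_×_; ∃-syntax)
open import Data.Rational.Base as ℚ using (ℚ; 0ℚ; 1ℚ; ↥_)
import Data.Rational.Properties as ℚ
import Data.Rational.Unnormalised.Base as ℚᵘ
open import Data.Rational.Unnormalised.Base using (mkℚᵘ)
import Data.Rational.Unnormalised.Properties as ℚᵘ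
open import Data.Sum.Base using (_⊎_)
open import Data.Vec.Functional using (Vector; foldr)
open import Function.Base using (_∘_)
open import Relation.Binary.PropositionalEquality
open import Relation.Nullary.Construct.Add.Supremum using (_⁺; ⊤⁺; [_])
open import Relation.Nullary.Negation.Core using (¬_)

------------------------------------------------------------------------
-- Bernoulli numbers

infixl 7 _÷ℕ_ _⊛_

_÷ℕ_ : ℚ → (n : ℕ) .{{_ : NonZero n}} → ℚ
q ÷ℕ n = q ℚ.* (1ℤ ℚ./ n)

_÷!_ : ℚ → ℕ → ℚ
q ÷! n = _÷ℕ_ q (n !) {{n !≢0}}

-- A power series is its sequence of coefficients.
PowerSeries : Set
PowerSeries = ℕ → ℚ

-- Cauchy product: (f ⊛ g) n = f n * g 0 + f (n - 1) * g 1 + … + f 0 * g n.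
_⊛_ : PowerSeries → PowerSeries → PowerSeries
(f ⊛ g) zero    = f zero ℚ.* g zero
(f ⊛ g) (suc n) = f (suc n) ℚ.* g zero ℚ.+ (f ⊛ (g ∘ suc)) n

egf : (ℕ → ℚ) → PowerSeries
egf a n = a n ÷! n

-- exp z - 1
expm1 : PowerSeries
expm1 zero    = 0ℚ
expm1 (suc n) = 1ℚ ÷! suc n

Z : PowerSeries
Z 1 = 1ℚ
Z _ = 0ℚ

dot : List ℚ → (ℕ → ℚ) → ℚ
dot []       g = 0ℚ
dot (t ∷ ts) g = t ℚ.* g zero ℚ.+ dot ts (g ∘ suc)

-- The coefficients t₀, t₁, … of z / (exp z - 1) satisfy t₀ = 1 and
-- t (n+1) = - (t n / 2! + t (n-1) / 3! + … + t₀ / (n+2)!).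
-- `earlier n` lists t (n-1), …, t₀.
mutual
  earlier : ℕ → List ℚ
  earlier zero    = []
  earlier (suc n) = next n (earlier n) ∷ earlier n

  next : ℕ → List ℚ → ℚ
  next zero    _  = 1ℚ
  next (suc _) ts = ℚ.- dot ts (λ i → expm1 (2+ i))

todd : PowerSeries
todd n = next n (earlier n)

B : ℕ → ℚ
B n = todd n ℚ.* (+ (n !) ℚ./ 1)

n/1*1/n : ∀ n .{{_ : NonZero n}} → (+ n ℚ./ 1) ℚ.* (1ℤ ℚ./ n) ≡ 1ℚ
n/1*1/n n@(suc n-1) = ℚ.toℚᵘ-injective (begin
  ℚ.toℚᵘ ((+ n ℚ./ 1) ℚ.* (1ℤ ℚ./ n))
    ≈⟨ ℚ.toℚᵘ-homo-* (+ n ℚ./ 1) (1ℤ ℚ./ n) ⟩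
  ℚ.toℚᵘ (+ n ℚ./ 1) ℚᵘ.* ℚ.toℚᵘ (1ℤ ℚ./ n)
    ≈⟨ ℚᵘ.*-cong (ℚ.toℚᵘ-fromℚᵘ (mkℚᵘ (+ n) 0)) (ℚ.toℚᵘ-fromℚᵘ (mkℚᵘ 1ℤ n-1)) ⟩
  mkℚᵘ (+ n) 0 ℚᵘ.* mkℚᵘ 1ℤ n-1
    ≈⟨ ℚᵘ.*-inverseʳ (mkℚᵘ (+ n) 0) ⟩
  ℚᵘ.1ℚᵘ ∎)
  where open ℚᵘ.≃-Reasoning

egf-B : ∀ n → egf B n ≡ todd n
egf-B n = begin
  todd n ℚ.* N ℚ.* M    ≡⟨ ℚ.*-assoc (todd n) N M ⟩
  todd n ℚ.* (N ℚ.* M)  ≡⟨ cong (todd n ℚ.*_) (n/1*1/n (n !) {{n !≢0}}) ⟩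
  todd n ℚ.* 1ℚ         ≡⟨ ℚ.*-identityʳ (todd n) ⟩
  todd n                ∎
  where
  open ≡-Reasoning
  N = + (n !) ℚ./ 1
  M = ℚ._/_ 1ℤ (n !) {{n !≢0}}

dot-earlier : ∀ n g → dot (earlier (suc n)) g ≡ (todd ⊛ g) n
dot-earlier zero    g = ℚ.+-identityʳ _
dot-earlier (suc n) g = cong (todd (suc n) ℚ.* g zero ℚ.+_) (dot-earlier n (g ∘ suc))

⊛-congˡ : ∀ {f f′} → f ≗ f′ → ∀ g n → (f ⊛ g) n ≡ (f′ ⊛ g) n
⊛-congˡ eq g zero    = cong (ℚ._* _) (eq zero)
⊛-congˡ eq g (suc n) =
  cong₂ ℚ._+_ (cong (ℚ._* _) (eq (suc n))) (⊛-congˡ eq (g ∘ suc) n)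

todd-⊛ : todd ⊛ expm1 ≗ Z
todd-⊛ 0      = refl
todd-⊛ 1      = refl
todd-⊛ (2+ k) = begin
  todd (2+ k) ℚ.* 0ℚ ℚ.+ (todd (suc k) ℚ.* 1ℚ ℚ.+ rest)
    ≡⟨ cong₂ ℚ._+_ (ℚ.*-zeroʳ (todd (2+ k))) (cong (ℚ._+ rest) (ℚ.*-identityʳ (todd (suc k)))) ⟩
  0ℚ ℚ.+ (todd (suc k) ℚ.+ rest)
    ≡⟨ ℚ.+-identityˡ _ ⟩
  todd (suc k) ℚ.+ rest
    ≡⟨ cong (todd (suc k) ℚ.+_) (dot-earlier k _) ⟨
  todd (suc k) ℚ.+ dot (earlier (suc k)) (λ i → expm1 (2+ i))
    ≡⟨ ℚ.+-inverseˡ (dot (earlier (suc k)) (λ i → expm1 (2+ i))) ⟩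
  0ℚ ∎
  where
  open ≡-Reasoning
  rest = (todd ⊛ (λ i → expm1 (2+ i))) k

-- z / (exp z - 1) = Σ B n zⁿ / n!, multiplied out.
B-generating-function : egf B ⊛ expm1 ≗ Z
B-generating-function n = trans (⊛-congˡ egf-B expm1 n) (todd-⊛ n)

------------------------------------------------------------------------
-- Irregular pairs

infix 4 _≡_[mod_]

_≡_[mod_] : ℤ → ℤ → ℕ → Set
a ≡ b [mod n ] = + n ℤ.∣ a ℤ.- b

record IrregularPair (p l : ℕ) : Set where
  field
    prime : Prime p
    odd   : p ≢ 2
    even  : 2 ∣ l
    2≤l   : 2 ≤ l
    l≤p-3 : l ℕ.+ 3 ≤ p
    p∣B   : + p ℤ.∣ ↥ B l

Irregular : ℕ → Set
Irregular p = ∃[ l ] IrregularPair p l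

Friendly : ∀ {n} → Vector ℕ n → Vector ℕ n → Set
Friendly p l = ∀ i j → i ≢ j →
  + l i ≡ + l j [mod gcd (p i ℕ.∸ 1) (p j ℕ.∸ 1) ]

-- The set of pairs {(p₁ , l₁) , … , (pₙ , lₙ)} is given by the two
-- families p and l.
record StrongFriendly {n} (p l : Vector ℕ n) : Set where
  field
    irregular : ∀ i → IrregularPair (p i) (l i)
    friendly  : Friendly p l
    strong    : ∀ i j → i ≢ j →
      (¬ (+ p i ≡ 1ℤ [mod p j ])) ⊎
      (+ p i ≡ 1ℤ [mod p j ] × + l i ≡ 1ℤ [mod p j ])

------------------------------------------------------------------------
-- Minima in ℕ ∪ {∞}, and Λ

-- IsMin P x: x is the minimum of {m | P m}, where the minimum of the
-- empty set is ∞ (written ⊤⁺).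
IsMin : (ℕ → Set) → ℕ ⁺ → Set
IsMin P [ m ] = P m × (∀ k → P k → m ≤ k)
IsMin P ⊤⁺    = ∀ k → ¬ P k

-- m is even, m ≥ 2, and num (B m / m) / num (B m / (m (m - 1))) is
-- (well defined and) an integer q divisible by c.
Λ-Solution : ℕ → ℕ → Set
Λ-Solution c m@(2+ k) = 2 ∣ m ×
  (∃[ q ] (den ≢ 0ℤ × num ≡ q ℤ.* den × + c ℤ.∣ q))
  where
  num = ↥ (B m ÷ℕ m)
  den = ↥ (B m ÷ℕ (m ℕ.* suc k))
Λ-Solution c _ = ⊥

-- Λ c = x
IsΛ : ℕ → ℕ ⁺ → Set
IsΛ c = IsMin (Λ-Solution c)

------------------------------------------------------------------------
-- The integers m_S

∏ : ∀ {n} → Vector ℕ n → ℕ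
∏ = foldr ℕ._*_ 1

record Is-m_S {n} (p l : Vector ℕ n) (m : ℤ) : Set where
  field
    lower      : + ∏ p ℤ.≤ m ℤ.- 1ℤ
    upper      : m ℤ.- 1ℤ ℤ.≤ + foldr lcm (∏ p) (λ ν → p ν ℕ.∸ 1)
    congruence : ∀ ν →
      m ℤ.- 1ℤ ≡ + p ν ℤ.* (+ l ν ℤ.- 1ℤ) [mod p ν ℕ.* (p ν ℕ.∸ 1) ]

{-# OPTIONS --safe #-}

-- For even m the quotient num (B m / m) / num (B m / (m (m - 1))) is ± gcd (num (B m / m)) (m - 1),
-- so it is divisible by a prime p exactly when m ≡ 1 modulo p and p divides num (B m / m).
-- If p - 1 ∣ m, von Staudt's theorem puts p into the denominator. Otherwise Kummer's congruence
-- reduces the condition to the residue l of m modulo p - 1, which has to form an irregular pair with p.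
-- The solutions are therefore the m ≥ 2 with m ≡ 1 modulo p ν and m ≡ l ν modulo p ν - 1 for
-- irregular pairs (p ν , l ν). Such congruences are solvable precisely when they are pairwise
-- compatible, i.e. when the pairs are strong friendly, and they then determine
-- m - 1 modulo lcm (c, p₁ - 1, …, pₙ - 1).
--
-- Von Staudt and Kummer are derived from S n = 0 ^ n + 1 ^ n + … + (p - 1) ^ n, which is congruent
-- to p B n modulo p, and modulo p² if p ≥ 5 and B (n - 1) is p-integral. Multiplication by a unit a
-- permutes the residues, so S n ≡ 0 modulo p and S (n p) ≡ 0 modulo p² unless p - 1 ∣ n.
-- Writing m = l + t (p - 1) and x = k ^ (p - 1) ≡ 1 modulo p, the first-order expansions of x ^ t and
-- x ^ l give l S m + t S l ≡ l S l + t S (l p) modulo p².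

module Submission where

open import Defs
open import Data.Integer.Base using (+_)
open import Data.Fin.Base using (zero)
open import Data.Nat.Base using (ℕ; suc; _≤_)
open import Data.Product using (_×_; _,_; ∃; ∃-syntax; ∃!)
open import Data.Vec.Functional using (Vector)
open import Function.Definitions using (Injective)
open import Relation.Binary.PropositionalEquality

-- Precision modulo p² is forced: Kummer's congruence concerns B m and B l modulo p, but the power
-- sums only see p B m and p B l, so one factor p is lost. This is also why B (n - 1) has to be
-- controlled: its coefficient in Faulhaber's formula is n p² / 2. No primitive root is used. To
-- annihilate S n, a single unit a with a ^ n ≢ 1 is enough, and its existence comes from the
-- Bernoulli numbers themselves: for 0 < l < p - 1 no denominator in the recurrence for B l is
-- divisible by p. The second half of strong friendliness is the compatibility of m ≡ 1 modulo p_j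
-- with m ≡ l_i modulo p_i - 1: these moduli have a common factor only if p_j divides p_i - 1. The
-- value of Λ has to be found or shown to be infinite. A search up to lcm (c, p₁ - 1, ..., pₙ - 1) +
-- 1 decides this, because the solutions over a fixed family l fill a residue class modulo that lcm.

-- Exponential generating functions and their product

module BinomialConvolution where

  open import Data.Integer.Base as ℤ using (ℤ; +_; 1ℤ)
  import Data.Integer.Properties as ℤ
  open import Data.Nat.Base as ℕ using (ℕ; zero; suc; 2+; _!; NonZero)
  import Data.Nat.Properties as ℕ
  open import Data.Rational.Base using (ℚ; 1ℚ; _+_; _*_; -_; _-_; _/_; toℚᵘ)
  open import Data.Rational.Properties
  open import Data.Rational.Solver using (module +-*-Solver)
  open import Data.Rational.Unnormalised.Base as ℚᵘ using (mkℚᵘ; *≡*)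
  import Data.Rational.Unnormalised.Properties as ℚᵘ
  open import Function.Base using (_∘_)

  ι : ℤ → ℚ
  ι z = z / 1

  toℚᵘ-ι : ∀ z → toℚᵘ (ι z) ℚᵘ.≃ mkℚᵘ z 0
  toℚᵘ-ι z = toℚᵘ-fromℚᵘ (mkℚᵘ z 0)

  ι-+ : ∀ a b → ι (a ℤ.+ b) ≡ ι a + ι b
  ι-+ a b = toℚᵘ-injective (begin
    toℚᵘ (ι (a ℤ.+ b))           ≈⟨ toℚᵘ-ι (a ℤ.+ b) ⟩
    mkℚᵘ (a ℤ.+ b) 0             ≈⟨ *≡* (cong (ℤ._* 1ℤ) (cong₂ ℤ._+_ (sym (ℤ.*-identityʳ a)) (sym (ℤ.*-identityʳ b)))) ⟩
    mkℚᵘ a 0 ℚᵘ.+ mkℚᵘ b 0       ≈⟨ ℚᵘ.+-cong (toℚᵘ-ι a) (toℚᵘ-ι b) ⟨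
    toℚᵘ (ι a) ℚᵘ.+ toℚᵘ (ι b)   ≈⟨ toℚᵘ-homo-+ (ι a) (ι b) ⟨
    toℚᵘ (ι a + ι b)             ∎)
    where open ℚᵘ.≃-Reasoning

  ι-* : ∀ a b → ι (a ℤ.* b) ≡ ι a * ι b
  ι-* a b = toℚᵘ-injective (begin
    toℚᵘ (ι (a ℤ.* b))           ≈⟨ toℚᵘ-ι (a ℤ.* b) ⟩
    mkℚᵘ a 0 ℚᵘ.* mkℚᵘ b 0       ≈⟨ ℚᵘ.*-cong (toℚᵘ-ι a) (toℚᵘ-ι b) ⟨
    toℚᵘ (ι a) ℚᵘ.* toℚᵘ (ι b)   ≈⟨ toℚᵘ-homo-* (ι a) (ι b) ⟨
    toℚᵘ (ι a * ι b)             ∎)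
    where open ℚᵘ.≃-Reasoning

  ι-injective : ∀ {a b} → ι a ≡ ι b → a ≡ b
  ι-injective {a} {b} eq with ℚᵘ.≃-trans (ℚᵘ.≃-sym (toℚᵘ-ι a)) (ℚᵘ.≃-trans (toℚᵘ-cong eq) (toℚᵘ-ι b))
  ... | *≡* e = trans (sym (ℤ.*-identityʳ a)) (trans e (ℤ.*-identityʳ b))

  ι-neg : ∀ a → ι (ℤ.- a) ≡ - ι a
  ι-neg a = +-inverseˡ-unique (ι (ℤ.- a)) (ι a) (trans (sym (ι-+ (ℤ.- a) a)) (cong ι (ℤ.+-inverseˡ a)))
    where open import Algebra.Properties.Group +-0-group renaming (inverseˡ-unique to +-inverseˡ-unique)

  infixl 7 _⋆_

  -- The product of exponential generating functions in terms of their coefficients; the recursion is the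
  -- product rule for the derivative, which acts on coefficients as the shift.
  _⋆_ : PowerSeries → PowerSeries → PowerSeries
  (a ⋆ b) zero    = a 0 * b 0
  (a ⋆ b) (suc n) = (a ∘ suc ⋆ b) n + (a ⋆ b ∘ suc) n

  ⋆-cong : ∀ {a a′ b b′} → a ≗ a′ → b ≗ b′ → a ⋆ b ≗ a′ ⋆ b′
  ⋆-cong p q zero    = cong₂ _*_ (p 0) (q 0)
  ⋆-cong p q (suc n) = cong₂ _+_ (⋆-cong (p ∘ suc) q n) (⋆-cong p (q ∘ suc) n)

  ⋆-comm : ∀ a b → a ⋆ b ≗ b ⋆ a
  ⋆-comm a b zero    = *-comm (a 0) (b 0)
  ⋆-comm a b (suc n) = trans (+-comm ((a ∘ suc ⋆ b) n) _) (cong₂ _+_ (⋆-comm a (b ∘ suc) n) (⋆-comm (a ∘ suc) b n))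

  ⋆-distribʳ-+ : ∀ a b c n → ((λ i → a i + b i) ⋆ c) n ≡ (a ⋆ c) n + (b ⋆ c) n
  ⋆-distribʳ-+ a b c zero    = *-distribʳ-+ (c 0) (a 0) (b 0)
  ⋆-distribʳ-+ a b c (suc n) = begin
    _ ≡⟨ cong₂ _+_ (⋆-distribʳ-+ (a ∘ suc) (b ∘ suc) c n) (⋆-distribʳ-+ a b (c ∘ suc) n) ⟩
    _ ≡⟨ solve 4 (λ x y z w → (x :+ y) :+ (z :+ w) := (x :+ z) :+ (y :+ w)) refl ((a ∘ suc ⋆ c) n) ((b ∘ suc ⋆ c) n) ((a ⋆ c ∘ suc) n) ((b ⋆ c ∘ suc) n) ⟩
    _ ∎
    where
    open ≡-Reasoning
    open +-*-Solver

  ⋆-distribˡ-+ : ∀ a b c n → (a ⋆ (λ i → b i + c i)) n ≡ (a ⋆ b) n + (a ⋆ c) n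
  ⋆-distribˡ-+ a b c n = begin
    (a ⋆ (λ i → b i + c i)) n ≡⟨ ⋆-comm a (λ i → b i + c i) n ⟩
    ((λ i → b i + c i) ⋆ a) n ≡⟨ ⋆-distribʳ-+ b c a n ⟩
    (b ⋆ a) n + (c ⋆ a) n     ≡⟨ cong₂ _+_ (⋆-comm b a n) (⋆-comm c a n) ⟩
    (a ⋆ b) n + (a ⋆ c) n     ∎
    where open ≡-Reasoning

  ⋆-scaleˡ : ∀ x a b n → ((λ i → x * a i) ⋆ b) n ≡ x * (a ⋆ b) n
  ⋆-scaleˡ x a b zero    = *-assoc x (a 0) (b 0)
  ⋆-scaleˡ x a b (suc n) = trans (cong₂ _+_ (⋆-scaleˡ x (a ∘ suc) b n) (⋆-scaleˡ x a (b ∘ suc) n)) (sym (*-distribˡ-+ x _ _))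

  ⋆-scaleʳ : ∀ x a b n → (a ⋆ (λ i → x * b i)) n ≡ x * (a ⋆ b) n
  ⋆-scaleʳ x a b n = trans (⋆-comm a _ n) (trans (⋆-scaleˡ x b a n) (cong (x *_) (⋆-comm b a n)))

  ⋆-assoc : ∀ a b c → (a ⋆ b) ⋆ c ≗ a ⋆ (b ⋆ c)
  ⋆-assoc a b c zero    = *-assoc (a 0) (b 0) (c 0)
  ⋆-assoc a b c (suc n) = begin
    ((λ i → (a ∘ suc ⋆ b) i + (a ⋆ b ∘ suc) i) ⋆ c) n + ((a ⋆ b) ⋆ c ∘ suc) n
      ≡⟨ cong (_+ ((a ⋆ b) ⋆ c ∘ suc) n) (⋆-distribʳ-+ (a ∘ suc ⋆ b) (a ⋆ b ∘ suc) c n) ⟩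
    ((a ∘ suc ⋆ b) ⋆ c) n + ((a ⋆ b ∘ suc) ⋆ c) n + ((a ⋆ b) ⋆ c ∘ suc) n
      ≡⟨ cong₂ _+_ (cong₂ _+_ (⋆-assoc (a ∘ suc) b c n) (⋆-assoc a (b ∘ suc) c n)) (⋆-assoc a b (c ∘ suc) n) ⟩
    (a ∘ suc ⋆ (b ⋆ c)) n + (a ⋆ (b ∘ suc ⋆ c)) n + (a ⋆ (b ⋆ c ∘ suc)) n
      ≡⟨ +-assoc ((a ∘ suc ⋆ (b ⋆ c)) n) _ _ ⟩
    (a ∘ suc ⋆ (b ⋆ c)) n + ((a ⋆ (b ∘ suc ⋆ c)) n + (a ⋆ (b ⋆ c ∘ suc)) n)
      ≡⟨ cong (_+_ ((a ∘ suc ⋆ (b ⋆ c)) n)) (⋆-distribˡ-+ a (b ∘ suc ⋆ c) (b ⋆ c ∘ suc) n) ⟨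
    (a ∘ suc ⋆ (b ⋆ c)) n + (a ⋆ (λ i → (b ∘ suc ⋆ c) i + (b ⋆ c ∘ suc) i)) n ∎
    where open ≡-Reasoning

  ∂ : PowerSeries → PowerSeries
  ∂ f n = ι (+ suc n) * f (suc n)

  ∂-∘suc : ∀ f n → ∂ f (suc n) ≡ ∂ (f ∘ suc) n + f (2+ n)
  ∂-∘suc f n = begin
    ι (1ℤ ℤ.+ + suc n) * f (2+ n)        ≡⟨ cong (_* f (2+ n)) (ι-+ 1ℤ (+ suc n)) ⟩
    (1ℚ + ι (+ suc n)) * f (2+ n)        ≡⟨ solve 2 (λ x y → (con 1ℚ :+ x) :* y := x :* y :+ y) refl (ι (+ suc n)) (f (2+ n)) ⟩
    ι (+ suc n) * f (2+ n) + f (2+ n)    ∎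
    where
    open ≡-Reasoning
    open +-*-Solver

  ⊛-congʳ : ∀ f {g g′} → g ≗ g′ → f ⊛ g ≗ f ⊛ g′
  ⊛-congʳ f eq zero    = cong (f 0 *_) (eq 0)
  ⊛-congʳ f eq (suc n) = cong₂ _+_ (cong (f (suc n) *_) (eq 0)) (⊛-congʳ f (eq ∘ suc) n)

  ⊛-distribˡ-+ : ∀ f g h n → (f ⊛ (λ i → g i + h i)) n ≡ (f ⊛ g) n + (f ⊛ h) n
  ⊛-distribˡ-+ f g h zero    = *-distribˡ-+ (f 0) (g 0) (h 0)
  ⊛-distribˡ-+ f g h (suc n) = begin
    _ ≡⟨ cong (_+_ (f (suc n) * (g 0 + h 0))) (⊛-distribˡ-+ f (g ∘ suc) (h ∘ suc) n) ⟩
    _ ≡⟨ solve 5 (λ x y z u v → x :* (y :+ z) :+ (u :+ v) := (x :* y :+ u) :+ (x :* z :+ v)) refl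
           (f (suc n)) (g 0) (h 0) ((f ⊛ g ∘ suc) n) ((f ⊛ h ∘ suc) n) ⟩
    _ ∎
    where
    open ≡-Reasoning
    open +-*-Solver

  ∂-⊛ : ∀ f g n → ∂ (f ⊛ g) n ≡ (∂ f ⊛ g) n + (f ⊛ ∂ g) n
  ∂-⊛ f g zero    = solve 4 (λ x y z w → con 1ℚ :* (x :* y :+ z :* w) := con 1ℚ :* x :* y :+ z :* (con 1ℚ :* w)) refl
                      (f 1) (g 0) (f 0) (g 1)
    where open +-*-Solver
  ∂-⊛ f g (suc n) = begin
    ι (+ 2+ n) * (f (2+ n) * g 0 + (f ⊛ g′) (suc n))
      ≡⟨ *-distribˡ-+ (ι (+ 2+ n)) _ _ ⟩
    ι (+ 2+ n) * (f (2+ n) * g 0) + ι (+ 2+ n) * (f ⊛ g′) (suc n)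
      -- The shift by `ℕ.pred` only serves to present `f ⊛ g′` as the tail of a series; the constant
      -- term of that series never enters.
      ≡⟨ cong₂ _+_ (sym (*-assoc (ι (+ 2+ n)) _ _)) (∂-∘suc (λ i → (f ⊛ g′) (ℕ.pred i)) n) ⟩
    ∂ f (suc n) * g 0 + (∂ (f ⊛ g′) n + (f ⊛ g′) (suc n))
      ≡⟨ cong (λ z → ∂ f (suc n) * g 0 + (z + (f ⊛ g′) (suc n))) (∂-⊛ f g′ n) ⟩
    ∂ f (suc n) * g 0 + ((∂ f ⊛ g′) n + (f ⊛ ∂ g′) n + (f (suc n) * g 1 + (f ⊛ g′ ∘ suc) n))
      ≡⟨ solve 5 (λ x y z u v → x :+ (y :+ z :+ (u :+ v)) := x :+ y :+ (u :+ (z :+ v))) refl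
           (∂ f (suc n) * g 0) ((∂ f ⊛ g′) n) ((f ⊛ ∂ g′) n) (f (suc n) * g 1) ((f ⊛ g′ ∘ suc) n) ⟩
    ∂ f (suc n) * g 0 + (∂ f ⊛ g′) n + (f (suc n) * g 1 + ((f ⊛ ∂ g′) n + (f ⊛ g′ ∘ suc) n))
      ≡⟨ cong (_+_ (∂ f (suc n) * g 0 + (∂ f ⊛ g′) n)) (cong₂ _+_ (cong (f (suc n) *_) (sym (*-identityˡ (g 1))))
           (trans (sym (⊛-distribˡ-+ f (∂ g′) (g′ ∘ suc) n)) (⊛-congʳ f (sym ∘ ∂-∘suc g) n))) ⟩
    ∂ f (suc n) * g 0 + (∂ f ⊛ g′) n + (f (suc n) * ∂ g 0 + (f ⊛ ∂ g ∘ suc) n) ∎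
    where
    open ≡-Reasoning
    open +-*-Solver
    g′ = g ∘ suc

  *-cancelˡ-ι : ∀ n .{{_ : NonZero n}} {x y} → ι (+ n) * x ≡ ι (+ n) * y → x ≡ y
  *-cancelˡ-ι n {x} {y} eq = begin
    x                              ≡⟨ inv x ⟩
    1ℤ / n * (ι (+ n) * x)         ≡⟨ cong (1ℤ / n *_) eq ⟩
    1ℤ / n * (ι (+ n) * y)         ≡⟨ inv y ⟨
    y                              ∎
    where
    open ≡-Reasoning
    inv : ∀ z → z ≡ 1ℤ / n * (ι (+ n) * z)
    inv z = begin
      z                            ≡⟨ *-identityˡ z ⟨
      1ℚ * z                       ≡⟨ cong (_* z) (n/1*1/n n) ⟨
      ι (+ n) * (1ℤ / n) * z       ≡⟨ cong (_* z) (*-comm (ι (+ n)) (1ℤ / n)) ⟩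
      1ℤ / n * ι (+ n) * z         ≡⟨ *-assoc (1ℤ / n) _ z ⟩
      1ℤ / n * (ι (+ n) * z)       ∎

  !-egf : ∀ a n → ι (+ (n !)) * egf a n ≡ a n
  !-egf a n = begin
    N * (a n * M)  ≡⟨ *-comm N _ ⟩
    a n * M * N    ≡⟨ *-assoc (a n) M N ⟩
    a n * (M * N)  ≡⟨ cong (a n *_) (trans (*-comm M N) (n/1*1/n (n !) {{n ℕ.!≢0}})) ⟩
    a n * 1ℚ       ≡⟨ *-identityʳ (a n) ⟩
    a n            ∎
    where
    open ≡-Reasoning
    N = ι (+ (n !))
    M = _/_ 1ℤ (n !) {{n ℕ.!≢0}}

  ∂-egf : ∀ a n → ∂ (egf a) n ≡ egf (a ∘ suc) n
  ∂-egf a n = *-cancelˡ-ι (n !) {{n ℕ.!≢0}} (begin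
    ι (+ (n !)) * (ι (+ suc n) * egf a (suc n))  ≡⟨ *-assoc (ι (+ (n !))) _ _ ⟨
    ι (+ (n !)) * ι (+ suc n) * egf a (suc n)    ≡⟨ cong (_* egf a (suc n)) (ι-* (+ (n !)) (+ suc n)) ⟨
    ι (+ (n !) ℤ.* + suc n) * egf a (suc n)      ≡⟨ cong (λ z → ι z * egf a (suc n)) (trans (ℤ.*-comm (+ (n !)) (+ suc n)) (sym (ℤ.pos-* (suc n) (n !)))) ⟩
    ι (+ (suc n !)) * egf a (suc n)              ≡⟨ !-egf a (suc n) ⟩
    a (suc n)                                    ≡⟨ !-egf (a ∘ suc) n ⟨
    ι (+ (n !)) * egf (a ∘ suc) n                ∎)
    where open ≡-Reasoning

  -- A power series is determined by its constant term and its derivative. The derivative obeys the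
  -- Leibniz rule for `⊛`, and on exponential coefficients it is the shift, so both products satisfy
  -- the same recursion and no binomial coefficient is needed.
  egf-⋆ : ∀ a b → egf a ⊛ egf b ≗ egf (a ⋆ b)
  egf-⋆ a b zero    = solve 2 (λ x y → x :* con 1ℚ :* (y :* con 1ℚ) := x :* y :* con 1ℚ) refl (a 0) (b 0)
    where open +-*-Solver
  egf-⋆ a b (suc n) = *-cancelˡ-ι (suc n) (begin
    ∂ (egf a ⊛ egf b) n
      ≡⟨ ∂-⊛ (egf a) (egf b) n ⟩
    (∂ (egf a) ⊛ egf b) n + (egf a ⊛ ∂ (egf b)) n
      ≡⟨ cong₂ _+_ (⊛-congˡ (∂-egf a) (egf b) n) (⊛-congʳ (egf a) (∂-egf b) n) ⟩
    (egf (a ∘ suc) ⊛ egf b) n + (egf a ⊛ egf (b ∘ suc)) n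
      ≡⟨ cong₂ _+_ (egf-⋆ (a ∘ suc) b n) (egf-⋆ a (b ∘ suc) n) ⟩
    egf (a ∘ suc ⋆ b) n + egf (a ⋆ b ∘ suc) n
      ≡⟨ *-distribʳ-+ _ ((a ∘ suc ⋆ b) n) ((a ⋆ b ∘ suc) n) ⟨
    egf ((a ⋆ b) ∘ suc) n
      ≡⟨ ∂-egf (a ⋆ b) n ⟨
    ∂ (egf (a ⋆ b)) n ∎)
    where open ≡-Reasoning

-- Faulhaber's formula

module PowerSums where

  open BinomialConvolution
  open import Data.Integer.Base as ℤ using (ℤ; +_; 0ℤ; 1ℤ)
  import Data.Integer.Properties as ℤ
  open import Data.Nat.Base as ℕ using (ℕ; zero; suc; 2+; _!)
  import Data.Nat.Properties as ℕ
  open import Data.Rational.Base using (0ℚ; 1ℚ; _+_; _*_; -_; _-_; _/_)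
  open import Data.Rational.Properties
  open import Data.Rational.Solver using (module +-*-Solver)
  open import Function.Base using (_∘_)

  -- As exponential generating functions, `pow N` is exp (N z), `pow⁺` is exp z - 1 and `Z` is z;
  -- `pow 0` is the unit of `⋆`.
  pow : ℕ → PowerSeries
  pow N n = ι ((+ N) ℤ.^ n)

  pow⁺ : PowerSeries
  pow⁺ zero    = 0ℚ
  pow⁺ (suc _) = 1ℚ

  -- The exponential coefficients of (exp (N z) - 1) / z.
  γ : ℕ → PowerSeries
  γ N j = ι ((+ N) ℤ.^ suc j) * (1ℤ / suc j)

  Σ< : ℕ → (ℕ → ℤ) → ℤ
  Σ< zero    f = 0ℤ
  Σ< (suc N) f = Σ< N f ℤ.+ f N

  powerSum : ℕ → ℕ → ℤ
  powerSum N n = Σ< N (λ k → (+ k) ℤ.^ n)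

  ⋆-zeroˡ : ∀ a → (∀ n → a n ≡ 0ℚ) → ∀ b n → (a ⋆ b) n ≡ 0ℚ
  ⋆-zeroˡ a a≡0 b zero    = trans (cong (_* b 0) (a≡0 0)) (*-zeroˡ (b 0))
  ⋆-zeroˡ a a≡0 b (suc n) = cong₂ _+_ (⋆-zeroˡ (a ∘ suc) (a≡0 ∘ suc) b n) (⋆-zeroˡ a a≡0 (b ∘ suc) n)

  pow0-⋆ : ∀ a → pow 0 ⋆ a ≗ a
  pow0-⋆ a zero    = *-identityˡ (a 0)
  pow0-⋆ a (suc n) = trans (cong₂ _+_ (⋆-zeroˡ (pow 0 ∘ suc) (λ _ → refl) a n) (pow0-⋆ (a ∘ suc) n)) (+-identityˡ _)

  Z∘suc : Z ∘ suc ≗ pow 0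
  Z∘suc zero    = refl
  Z∘suc (suc n) = refl

  Z-⋆ : ∀ a n → (Z ⋆ a) (suc n) ≡ ι (+ suc n) * a n
  Z-⋆ a n = begin
    (Z ∘ suc ⋆ a) n + (Z ⋆ a ∘ suc) n  ≡⟨ cong₂ _+_ (trans (⋆-cong Z∘suc (λ _ → refl) n) (pow0-⋆ a n)) (lemma n) ⟩
    a n + ι (+ n) * a n                ≡⟨ cong (_+ ι (+ n) * a n) (*-identityˡ (a n)) ⟨
    1ℚ * a n + ι (+ n) * a n           ≡⟨ *-distribʳ-+ (a n) 1ℚ (ι (+ n)) ⟨
    (1ℚ + ι (+ n)) * a n               ≡⟨ cong (_* a n) (ι-+ 1ℤ (+ n)) ⟨
    ι (+ suc n) * a n                  ∎
    where
    open ≡-Reasoning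
    lemma : ∀ n → (Z ⋆ a ∘ suc) n ≡ ι (+ n) * a n
    lemma zero    = trans (*-zeroˡ (a 1)) (sym (*-zeroˡ (a 0)))
    lemma (suc n) = Z-⋆ (a ∘ suc) n

  pow-⋆ : ∀ M N → pow M ⋆ pow N ≗ pow (M ℕ.+ N)
  pow-⋆ M N zero    = refl
  pow-⋆ M N (suc n) = begin
    (pow M ∘ suc ⋆ pow N) n + (pow M ⋆ pow N ∘ suc) n
      ≡⟨ cong₂ _+_ (⋆-cong (pow-suc M) (λ _ → refl) n) (⋆-cong {pow M} (λ _ → refl) (pow-suc N) n) ⟩
    ((λ i → ι (+ M) * pow M i) ⋆ pow N) n + (pow M ⋆ (λ i → ι (+ N) * pow N i)) n
      ≡⟨ cong₂ _+_ (⋆-scaleˡ (ι (+ M)) (pow M) (pow N) n) (⋆-scaleʳ (ι (+ N)) (pow M) (pow N) n) ⟩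
    ι (+ M) * (pow M ⋆ pow N) n + ι (+ N) * (pow M ⋆ pow N) n
      ≡⟨ *-distribʳ-+ _ (ι (+ M)) (ι (+ N)) ⟨
    (ι (+ M) + ι (+ N)) * (pow M ⋆ pow N) n
      ≡⟨ cong₂ _*_ (sym (ι-+ (+ M) (+ N))) (pow-⋆ M N n) ⟩
    ι (+ (M ℕ.+ N)) * pow (M ℕ.+ N) n
      ≡⟨ pow-suc (M ℕ.+ N) n ⟨
    pow (M ℕ.+ N) (suc n) ∎
    where
    open ≡-Reasoning
    pow-suc : ∀ K i → pow K (suc i) ≡ ι (+ K) * pow K i
    pow-suc K i = ι-* (+ K) ((+ K) ℤ.^ i)

  B-⋆-pow⁺ : B ⋆ pow⁺ ≗ Z
  B-⋆-pow⁺ n = begin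
    (B ⋆ pow⁺) n                         ≡⟨ !-egf (B ⋆ pow⁺) n ⟨
    ι (+ (n !)) * egf (B ⋆ pow⁺) n       ≡⟨ cong (ι (+ (n !)) *_) (egf-⋆ B pow⁺ n) ⟨
    ι (+ (n !)) * (egf B ⊛ egf pow⁺) n   ≡⟨ cong (ι (+ (n !)) *_) (⊛-congʳ (egf B) egf-pow⁺ n) ⟩
    ι (+ (n !)) * (egf B ⊛ expm1) n      ≡⟨ cong (ι (+ (n !)) *_) (B-generating-function n) ⟩
    ι (+ (n !)) * Z n                    ≡⟨ !-Z n ⟩
    Z n                                  ∎
    where
    open ≡-Reasoning
    egf-pow⁺ : egf pow⁺ ≗ expm1
    egf-pow⁺ zero    = refl
    egf-pow⁺ (suc n) = refl
    !-Z : ∀ n → ι (+ (n !)) * Z n ≡ Z n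
    !-Z 0      = refl
    !-Z 1      = refl
    !-Z (2+ n) = *-zeroʳ (ι (+ (2+ n !)))

  pow-difference : ∀ N n → pow (suc N) n ≡ (pow N ⋆ pow⁺) n + pow N n
  pow-difference N n = begin
    pow (suc N) n                               ≡⟨ cong (λ K → pow K n) (ℕ.+-comm 1 N) ⟩
    pow (N ℕ.+ 1) n                             ≡⟨ pow-⋆ N 1 n ⟨
    (pow N ⋆ pow 1) n                           ≡⟨ ⋆-cong {pow N} (λ _ → refl) pow1 n ⟩
    (pow N ⋆ (λ i → pow⁺ i + pow 0 i)) n        ≡⟨ ⋆-distribˡ-+ (pow N) pow⁺ (pow 0) n ⟩
    (pow N ⋆ pow⁺) n + (pow N ⋆ pow 0) n        ≡⟨ cong (_+_ ((pow N ⋆ pow⁺) n)) (trans (⋆-comm (pow N) (pow 0) n) (pow0-⋆ (pow N) n)) ⟩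
    (pow N ⋆ pow⁺) n + pow N n                  ∎
    where
    open ≡-Reasoning
    pow1 : ∀ i → pow 1 i ≡ pow⁺ i + pow 0 i
    pow1 zero    = refl
    pow1 (suc i) = cong ι (ℤ.^-zeroˡ (suc i))

  Z-⋆-γ : ∀ N n → pow N n ≡ (Z ⋆ γ N) n + pow 0 n
  Z-⋆-γ N zero    = cong (_+ 1ℚ) (sym (*-zeroˡ (γ N 0)))
  Z-⋆-γ N (suc n) = begin
    pow N (suc n)                                  ≡⟨ *-identityʳ _ ⟨
    pow N (suc n) * 1ℚ                             ≡⟨ cong (pow N (suc n) *_) (n/1*1/n (suc n)) ⟨
    pow N (suc n) * (ι (+ suc n) * (1ℤ / suc n))   ≡⟨ solve 3 (λ x y z → x :* (y :* z) := y :* (x :* z)) refl (pow N (suc n)) (ι (+ suc n)) (1ℤ / suc n) ⟩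
    ι (+ suc n) * γ N n                            ≡⟨ Z-⋆ (γ N) n ⟨
    (Z ⋆ γ N) (suc n)                              ≡⟨ +-identityʳ _ ⟨
    (Z ⋆ γ N) (suc n) + 0ℚ                         ∎
    where
    open ≡-Reasoning
    open +-*-Solver

  -- This is exp ((N + 1) z) - 1 = exp (N z) (exp z - 1) + (exp (N z) - 1), the induction step in N
  -- behind Faulhaber's formula.
  Z-⋆-γ-suc : ∀ N n → (Z ⋆ γ (suc N)) n ≡ (pow N ⋆ pow⁺) n + (Z ⋆ γ N) n
  Z-⋆-γ-suc N n = +-cancelʳ (pow 0 n) _ _ (begin
    (Z ⋆ γ (suc N)) n + pow 0 n                ≡⟨ Z-⋆-γ (suc N) n ⟨
    pow (suc N) n                              ≡⟨ pow-difference N n ⟩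
    (pow N ⋆ pow⁺) n + pow N n                 ≡⟨ cong (_+_ ((pow N ⋆ pow⁺) n)) (Z-⋆-γ N n) ⟩
    (pow N ⋆ pow⁺) n + ((Z ⋆ γ N) n + pow 0 n) ≡⟨ +-assoc ((pow N ⋆ pow⁺) n) ((Z ⋆ γ N) n) (pow 0 n) ⟨
    (pow N ⋆ pow⁺) n + (Z ⋆ γ N) n + pow 0 n   ∎)
    where
    open ≡-Reasoning
    open import Algebra.Properties.Group +-0-group renaming (∙-cancelʳ to +-cancelʳ)

  ⋆-swap : ∀ a b c → a ⋆ (b ⋆ c) ≗ b ⋆ (a ⋆ c)
  ⋆-swap a b c n = begin
    (a ⋆ (b ⋆ c)) n  ≡⟨ ⋆-assoc a b c n ⟨
    ((a ⋆ b) ⋆ c) n  ≡⟨ ⋆-cong (⋆-comm a b) (λ _ → refl) n ⟩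
    ((b ⋆ a) ⋆ c) n  ≡⟨ ⋆-assoc b a c n ⟩
    (b ⋆ (a ⋆ c)) n  ∎
    where open ≡-Reasoning

  -- Faulhaber's formula: B ⋆ γ N is Σⱼ (n choose j) B (n - j) N ^ (j + 1) / (j + 1).
  powerSum-B : ∀ N n → (B ⋆ γ N) n ≡ ι (powerSum N n)
  powerSum-B zero    n = trans (⋆-comm B (γ 0) n) (⋆-zeroˡ (γ 0) (λ j → *-zeroˡ (1ℤ / suc j)) B n)
  powerSum-B (suc N) n = *-cancelˡ-ι (suc n) (begin
    ι (+ suc n) * (B ⋆ γ (suc N)) n
      ≡⟨ scaled (suc N) ⟩
    (B ⋆ (Z ⋆ γ (suc N))) (suc n)
      ≡⟨ ⋆-cong {B} (λ _ → refl) (Z-⋆-γ-suc N) (suc n) ⟩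
    (B ⋆ (λ i → (pow N ⋆ pow⁺) i + (Z ⋆ γ N) i)) (suc n)
      ≡⟨ ⋆-distribˡ-+ B (pow N ⋆ pow⁺) (Z ⋆ γ N) (suc n) ⟩
    (B ⋆ (pow N ⋆ pow⁺)) (suc n) + (B ⋆ (Z ⋆ γ N)) (suc n)
      ≡⟨ cong₂ _+_ new (trans (sym (scaled N)) (cong (ι (+ suc n) *_) (powerSum-B N n))) ⟩
    ι (+ suc n) * pow N n + ι (+ suc n) * ι (powerSum N n)
      ≡⟨ *-distribˡ-+ (ι (+ suc n)) _ _ ⟨
    ι (+ suc n) * (pow N n + ι (powerSum N n))
      ≡⟨ cong (ι (+ suc n) *_) (trans (+-comm (pow N n) _) (sym (ι-+ (powerSum N n) _))) ⟩
    ι (+ suc n) * ι (powerSum (suc N) n) ∎)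
    where
    open ≡-Reasoning
    scaled : ∀ M → ι (+ suc n) * (B ⋆ γ M) n ≡ (B ⋆ (Z ⋆ γ M)) (suc n)
    scaled M = trans (sym (Z-⋆ (B ⋆ γ M) n)) (⋆-swap Z B (γ M) (suc n))
    -- The defining property of the Bernoulli numbers enters here: times exp z - 1 they give z, so
    -- the increment contributes z exp (N z).
    new : (B ⋆ (pow N ⋆ pow⁺)) (suc n) ≡ ι (+ suc n) * pow N n
    new = begin
      (B ⋆ (pow N ⋆ pow⁺)) (suc n)  ≡⟨ ⋆-swap B (pow N) pow⁺ (suc n) ⟩
      (pow N ⋆ (B ⋆ pow⁺)) (suc n)  ≡⟨ ⋆-cong {pow N} (λ _ → refl) B-⋆-pow⁺ (suc n) ⟩
      (pow N ⋆ Z) (suc n)           ≡⟨ ⋆-comm (pow N) Z (suc n) ⟩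
      (Z ⋆ pow N) (suc n)           ≡⟨ Z-⋆ (pow N) n ⟩
      ι (+ suc n) * pow N n         ∎

-- Congruences, inverses and permutations of residues

module Congruences where

  open PowerSums using (Σ<)
  open import Data.Fin.Base as Fin using (Fin; zero; suc; toℕ; fromℕ; fromℕ<; inject₁)
  import Data.Fin.Properties as Fin
  open import Data.Fin.Permutation using (Permutation′; permutation)
  open import Data.Integer.Base as ℤ using (ℤ; +_; -[1+_]; 0ℤ; 1ℤ; _+_; _*_; _-_; -_; _^_)
  import Data.Integer.Divisibility.Signed as S
  open import Data.Integer.DivMod using (_%ℕ_; _/ℕ_; n%ℕd<d; a≡a%ℕn+[a/ℕn]*n)
  open import Data.Integer.Properties
  open import Data.Integer.Tactic.RingSolver using (solve-∀)
  open import Data.Nat.Base as ℕ using (ℕ; zero; suc; NonZero; _<_)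
  open import Data.Nat.Coprimality as Coprimality using (Coprime)
  import Data.Nat.Divisibility as ℕ
  open import Data.Nat.Divisibility using (_∣_; _∤_)
  import Data.Nat.DivMod as ℕ
  open import Data.Nat.GCD using (module Bézout)
  open import Data.Nat.Primality hiding (prime)
  import Data.Nat.Properties as ℕ
  open import Data.Product.Base using (_,_; proj₁; proj₂)
  open import Data.Sum.Base using (inj₁; inj₂)
  open import Function.Base using (_∘_)
  open import Relation.Binary.Bundles using (Setoid)
  open import Relation.Nullary.Negation using (contradiction)

  infix 4 _≈_[_]

  -- Unlike `_≡_[mod_]`, which unfolds to a divisibility of absolute values, this form keeps `a` and
  -- `b` inferable. Matching the equality with `refl` eliminates `a`, so that compatibility with an
  -- operation becomes a ring identity.
  record _≈_[_] (a b : ℤ) (n : ℕ) : Set where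
    constructor _,_
    field
      quotient : ℤ
      equality : a ≡ b + quotient * + n

  open _≈_[_]

  private variable
    a b c d : ℤ
    n : ℕ

  ≈-reflexive : a ≡ b → a ≈ b [ n ]
  ≈-reflexive {b = b} eq = 0ℤ , trans eq (sym (+-identityʳ b))

  ≈-refl : a ≈ a [ n ]
  ≈-refl = ≈-reflexive refl

  ≈-sym : a ≈ b [ n ] → b ≈ a [ n ]
  ≈-sym {b = b} {n} (q , eq) = - q , trans (lemma b q (+ n)) (cong (_+ - q * + n) (sym eq))
    where
    lemma : ∀ b q n → b ≡ b + q * n + - q * n
    lemma = solve-∀

  ≈-trans : a ≈ b [ n ] → b ≈ c [ n ] → a ≈ c [ n ]
  ≈-trans {n = n} {c = c} (q , refl) (r , refl) = r + q , lemma c q r (+ n)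
    where
    lemma : ∀ c q r n → c + r * n + q * n ≡ c + (r + q) * n
    lemma = solve-∀

  ≈-+ : a ≈ b [ n ] → c ≈ d [ n ] → a + c ≈ b + d [ n ]
  ≈-+ {b = b} {n} {d = d} (q , refl) (r , refl) = q + r , lemma b d q r (+ n)
    where
    lemma : ∀ b d q r n → b + q * n + (d + r * n) ≡ b + d + (q + r) * n
    lemma = solve-∀

  ≈-* : a ≈ b [ n ] → c ≈ d [ n ] → a * c ≈ b * d [ n ]
  ≈-* {b = b} {n} {d = d} (q , refl) (r , refl) = b * r + q * (d + r * + n) , lemma b d q r (+ n)
    where
    lemma : ∀ b d q r n → (b + q * n) * (d + r * n) ≡ b * d + (b * r + q * (d + r * n)) * n
    lemma = solve-∀

  ≈-neg : a ≈ b [ n ] → - a ≈ - b [ n ]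
  ≈-neg {b = b} {n} (q , refl) = - q , lemma b q (+ n)
    where
    lemma : ∀ b q n → - (b + q * n) ≡ - b + - q * n
    lemma = solve-∀

  ≈-^ : ∀ k → a ≈ b [ n ] → a ^ k ≈ b ^ k [ n ]
  ≈-^ zero    eq = ≈-refl
  ≈-^ (suc k) eq = ≈-* eq (≈-^ k eq)

  ≈-setoid : ℕ → Setoid _ _
  ≈-setoid n = record
    { _≈_           = _≈_[ n ]
    ; isEquivalence = record { refl = ≈-refl ; sym = ≈-sym ; trans = ≈-trans }
    }

  ≈⇒∣ : a ≈ b [ n ] → n ∣ ℤ.∣ a - b ∣
  ≈⇒∣ {a} {b} {n} (q , refl) = S.∣⇒∣ᵤ (S.divides q (lemma b (q * + n)))
    where
    lemma : ∀ b x → b + x - b ≡ x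
    lemma = solve-∀

  ∣⇒≈ : n ∣ ℤ.∣ a - b ∣ → a ≈ b [ n ]
  ∣⇒≈ {n} {a} {b} n∣a-b with S.∣ᵤ⇒∣ {+ n} {a - b} n∣a-b
  ... | S.divides q eq = q , trans (lemma a b) (cong (_+_ b) eq)
    where
    lemma : ∀ a b → a ≡ b + (a - b)
    lemma = solve-∀

  ≈0⇒∣ : a ≈ 0ℤ [ n ] → n ∣ ℤ.∣ a ∣
  ≈0⇒∣ {a} eq = subst (λ x → _ ∣ ℤ.∣ x ∣) (+-identityʳ a) (≈⇒∣ eq)

  ∣⇒≈0 : n ∣ ℤ.∣ a ∣ → a ≈ 0ℤ [ n ]
  ∣⇒≈0 {n} {a} n∣a = ∣⇒≈ (subst (λ x → n ∣ ℤ.∣ x ∣) (sym (+-identityʳ a)) n∣a)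

  ≈-mono : ∀ {m} → m ∣ n → a ≈ b [ n ] → a ≈ b [ m ]
  ≈-mono m∣n eq = ∣⇒≈ (ℕ.∣-trans m∣n (≈⇒∣ eq))

  %ℕ-≈ : ∀ a n .{{_ : NonZero n}} → + (a %ℕ n) ≈ a [ n ]
  %ℕ-≈ a n = ≈-sym (a /ℕ n , a≡a%ℕn+[a/ℕn]*n a n)

  ≈⇒≡ : ∀ {r s} .{{_ : NonZero n}} → r < n → s < n → + r ≈ + s [ n ] → r ≡ s
  ≈⇒≡ {n} r<n s<n (+ k , eq)      = unique r<n s<n k (+-injective (trans eq (cong (_+_ (+ _)) (sym (pos-* k n)))))
    where
    unique : ∀ {r s} .{{_ : NonZero n}} → r < n → s < n → ∀ k → r ≡ s ℕ.+ k ℕ.* n → r ≡ s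
    unique {r} {s} r<n s<n k eq = begin
      r                    ≡⟨ ℕ.m<n⇒m%n≡m r<n ⟨
      r ℕ.% n              ≡⟨ cong (ℕ._% n) eq ⟩
      (s ℕ.+ k ℕ.* n) ℕ.% n ≡⟨ ℕ.[m+kn]%n≡m%n s k n ⟩
      s ℕ.% n              ≡⟨ ℕ.m<n⇒m%n≡m s<n ⟩
      s                    ∎
      where open ≡-Reasoning
  ≈⇒≡ {n} r<n s<n eq@(-[1+ k ] , _) = sym (≈⇒≡ s<n r<n (+ suc k , equality (≈-sym eq)))

  Σ<-cong : ∀ {n} N {f g} → (∀ k → k < N → f k ≈ g k [ n ]) → Σ< N f ≈ Σ< N g [ n ]
  Σ<-cong zero    eq = ≈-refl
  Σ<-cong (suc N) eq = ≈-+ (Σ<-cong N (λ k k<N → eq k (ℕ.m≤n⇒m≤1+n k<N))) (eq N ℕ.≤-refl)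

  Σ<-+ : ∀ N f g → Σ< N (λ k → f k + g k) ≡ Σ< N f + Σ< N g
  Σ<-+ zero    f g = refl
  Σ<-+ (suc N) f g = trans (cong (_+ (f N + g N)) (Σ<-+ N f g)) (lemma (Σ< N f) (Σ< N g) (f N) (g N))
    where
    lemma : ∀ x y z w → x + y + (z + w) ≡ x + z + (y + w)
    lemma = solve-∀

  Σ<-* : ∀ N c f → Σ< N (λ k → c * f k) ≡ c * Σ< N f
  Σ<-* zero    c f = sym (*-zeroʳ c)
  Σ<-* (suc N) c f = trans (cong (_+ c * f N) (Σ<-* N c f)) (sym (*-distribˡ-+ c (Σ< N f) (f N)))

  import Algebra.Properties.CommutativeMonoid.Sum as Sum
  module ∑ = Sum +-0-commutativeMonoid
  module Π = Sum *-1-commutativeMonoid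

  Σ<-sum : ∀ N f → Σ< N f ≡ ∑.sum {N} (f ∘ toℕ)
  Σ<-sum zero    f = refl
  Σ<-sum (suc N) f = begin
    Σ< N f + f N                                       ≡⟨ cong₂ _+_ (Σ<-sum N f) (cong f (sym (Fin.toℕ-fromℕ N))) ⟩
    ∑.sum {N} (f ∘ toℕ) + f (toℕ (fromℕ N))            ≡⟨ cong (_+ f (toℕ (fromℕ N))) (∑.sum-cong-≗ {N} (λ i → cong f (sym (Fin.toℕ-inject₁ i)))) ⟩
    ∑.sum {N} (f ∘ toℕ ∘ inject₁) + f (toℕ (fromℕ N))  ≡⟨ ∑.sum-init-last {N} (f ∘ toℕ) ⟨
    ∑.sum {suc N} (f ∘ toℕ)                            ∎
    where open ≡-Reasoning

  ∤⇒coprime : ∀ {p m} → Prime p → p ∤ m → Coprime p m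
  ∤⇒coprime pr p∤m (d∣p , d∣m) with prime⇒irreducible pr d∣p
  ... | inj₁ d≡1  = d≡1
  ... | inj₂ refl = contradiction d∣m p∤m

  inverse : ∀ {m} → Coprime m ℤ.∣ a ∣ → ∃[ b ] b * a ≈ 1ℤ [ m ]
  inverse {a} {m} coprime = lemma (Coprimality.coprime-Bézout coprime)
    where
    sgn : ∀ a → ∃[ s ] s * a ≡ + ℤ.∣ a ∣
    sgn (+ n)    = 1ℤ , *-identityˡ (+ n)
    sgn -[1+ n ] = -[1+ 0 ] , -1*i≡-i -[1+ n ]
    s = proj₁ (sgn a)
    lift : ∀ y k → + (1 ℕ.+ y ℕ.* ℤ.∣ a ∣) ≡ + (k ℕ.* m) → 1ℤ + (+ y * s) * a ≡ + k * + m
    lift y k eq = begin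
      1ℤ + (+ y * s) * a          ≡⟨ cong (_+_ 1ℤ) (*-assoc (+ y) s a) ⟩
      1ℤ + + y * (s * a)          ≡⟨ cong (λ z → 1ℤ + + y * z) (proj₂ (sgn a)) ⟩
      1ℤ + + y * + ℤ.∣ a ∣        ≡⟨ cong (_+_ 1ℤ) (pos-* y ℤ.∣ a ∣) ⟨
      + (1 ℕ.+ y ℕ.* ℤ.∣ a ∣)     ≡⟨ eq ⟩
      + (k ℕ.* m)                 ≡⟨ pos-* k m ⟩
      + k * + m                   ∎
      where open ≡-Reasoning
    lemma : Bézout.Identity 1 m ℤ.∣ a ∣ → ∃[ b ] b * a ≈ 1ℤ [ m ]
    lemma (Bézout.+- x y eq) = - (+ y * s) , (- + x , (begin
      - (+ y * s) * a                        ≡⟨ ring (+ y * s) a ⟩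
      1ℤ + - (1ℤ + (+ y * s) * a)            ≡⟨ cong (λ z → 1ℤ + - z) (lift y x (cong +_ eq)) ⟩
      1ℤ + - (+ x * + m)                     ≡⟨ cong (_+_ 1ℤ) (neg-distribˡ-* (+ x) (+ m)) ⟩
      1ℤ + - + x * + m                       ∎))
      where
      open ≡-Reasoning
      ring : ∀ u a → - u * a ≡ 1ℤ + - (1ℤ + u * a)
      ring = solve-∀
    lemma (Bézout.-+ x y eq) = + y * s , (+ x , (begin
      (+ y * s) * a              ≡⟨ *-assoc (+ y) s a ⟩
      + y * (s * a)              ≡⟨ cong (+ y *_) (proj₂ (sgn a)) ⟩
      + y * + ℤ.∣ a ∣            ≡⟨ pos-* y ℤ.∣ a ∣ ⟨
      + (y ℕ.* ℤ.∣ a ∣)          ≡⟨ cong +_ eq ⟨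
      + (1 ℕ.+ x ℕ.* m)          ≡⟨ cong (_+_ 1ℤ) (pos-* x m) ⟩
      1ℤ + + x * + m             ∎))
      where open ≡-Reasoning

  ≈-cancelˡ : ∀ {m} → Coprime m ℤ.∣ a ∣ → a * b ≈ a * c [ m ] → b ≈ c [ m ]
  ≈-cancelˡ {a} {b} {c} {m} coprime eq with inverse {a} coprime
  ... | a⁻¹ , inv = ≈-trans (≈-sym (undo b)) (≈-trans (≈-* (≈-refl {a⁻¹}) eq) (undo c))
    where
    undo : ∀ b → a⁻¹ * (a * b) ≈ b [ m ]
    undo b = ≈-trans (≈-reflexive (sym (*-assoc a⁻¹ a b))) (≈-trans (≈-* inv ≈-refl) (≈-reflexive (*-identityˡ b)))

  module _ {p : ℕ} .{{_ : NonZero p}} where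

    dilate : ℤ → Fin p → Fin p
    dilate a k = fromℕ< (n%ℕd<d (a * + toℕ k) p)

    toℕ-dilate : ∀ a k → toℕ (dilate a k) ≡ (a * + toℕ k) %ℕ p
    toℕ-dilate a k = Fin.toℕ-fromℕ< (n%ℕd<d (a * + toℕ k) p)

    dilate-≈ : ∀ a k → + toℕ (dilate a k) ≈ a * + toℕ k [ p ]
    dilate-≈ a k = ≈-trans (≈-reflexive (cong +_ (toℕ-dilate a k))) (%ℕ-≈ (a * + toℕ k) p)

    dilate-inverse : ∀ a b → b * a ≈ 1ℤ [ p ] → ∀ k → dilate b (dilate a k) ≡ k
    dilate-inverse a b ba≈1 k = Fin.toℕ-injective (≈⇒≡ (Fin.toℕ<n _) (Fin.toℕ<n k) (begin
      + toℕ (dilate b (dilate a k))  ≈⟨ dilate-≈ b (dilate a k) ⟩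
      b * + toℕ (dilate a k)         ≈⟨ ≈-* (≈-refl {b}) (dilate-≈ a k) ⟩
      b * (a * + toℕ k)              ≡⟨ *-assoc b a _ ⟨
      b * a * + toℕ k                ≈⟨ ≈-* ba≈1 ≈-refl ⟩
      1ℤ * + toℕ k                   ≡⟨ *-identityˡ _ ⟩
      + toℕ k                        ∎))
      where open import Relation.Binary.Reasoning.Setoid (≈-setoid p)

    dilation : Coprime p ℤ.∣ a ∣ → Permutation′ p
    dilation {a} coprime = permutation (dilate a) (dilate a⁻¹)
      (dilate-inverse a⁻¹ a (≈-trans (≈-reflexive (*-comm a a⁻¹)) inv)) (dilate-inverse a a⁻¹ inv)
      where
      a⁻¹ = proj₁ (inverse {a} coprime)
      inv = proj₂ (inverse {a} coprime)

-- Power sums modulo p and p²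

module PowerSumCongruences where

  open PowerSums using (Σ<; powerSum)
  open Congruences
  open import Data.Fin.Base as Fin using (Fin; zero; suc; toℕ)
  import Data.Fin.Properties as Fin
  open import Data.Integer.Base as ℤ using (ℤ; +_; 0ℤ; 1ℤ; _+_; _*_; _-_; -_; _^_)
  open import Data.Integer.Properties
  open import Data.Integer.Tactic.RingSolver using (solve-∀)
  open import Data.Nat.Base as ℕ using (ℕ; zero; suc; NonZero; _<_; z≤n; s≤s)
  open import Data.Nat.Coprimality as Coprimality using (Coprime)
  import Data.Nat.Divisibility as ℕ
  open import Data.Nat.Divisibility using (_∣_)
  open import Data.Nat.Primality hiding (prime)
  import Data.Nat.Properties as ℕ
  open import Data.Product.Base using (_,_)
  open import Data.Sum.Base using (_⊎_; inj₁; inj₂)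
  open import Function.Base using (_∘_)
  open import Relation.Nullary.Negation using (¬_; contradiction)

  *-^-distrib : ∀ a b n → (a * b) ^ n ≡ a ^ n * b ^ n
  *-^-distrib a b zero    = refl
  *-^-distrib a b (suc n) = trans (cong (a * b *_) (*-^-distrib a b n)) (lemma a b (a ^ n) (b ^ n))
    where
    lemma : ∀ a b x y → a * b * (x * y) ≡ a * x * (b * y)
    lemma = solve-∀

  Σ<-dilate : ∀ {p a} .{{_ : NonZero p}} → Coprime p ℤ.∣ a ∣ → ∀ f →
              Σ< p f ≡ ∑.sum (λ i → f (toℕ (dilate {p} a i)))
  Σ<-dilate {p} {a} coprime f = trans (Σ<-sum p f) (∑.sum-permute (λ i → f (toℕ i)) (dilation {a = a} coprime))

  ∑-cong : ∀ {M n} {f g : Fin n → ℤ} → (∀ i → f i ≈ g i [ M ]) → ∑.sum f ≈ ∑.sum g [ M ]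
  ∑-cong {n = zero}  eq = ≈-refl
  ∑-cong {n = suc n} eq = ≈-+ (eq zero) (∑-cong (eq ∘ suc))

  Π-cong : ∀ {M n} {f g : Fin n → ℤ} → (∀ i → f i ≈ g i [ M ]) → Π.sum f ≈ Π.sum g [ M ]
  Π-cong {n = zero}  eq = ≈-refl
  Π-cong {n = suc n} eq = ≈-* (eq zero) (Π-cong (eq ∘ suc))

  Π-scale : ∀ n a (f : Fin n → ℤ) → Π.sum (λ i → a * f i) ≡ a ^ n * Π.sum f
  Π-scale zero    a f = refl
  Π-scale (suc n) a f = trans (cong (a * f zero *_) (Π-scale n a (f ∘ suc))) (lemma a (f zero) (a ^ n) (Π.sum (f ∘ suc)))
    where
    lemma : ∀ a b x y → a * b * (x * y) ≡ a * x * (b * y)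
    lemma = solve-∀

  -- Multiplication by the unit a permutes the residues k.
  powerSum-dilate : ∀ {p a M} n .{{_ : NonZero p}} → Coprime p ℤ.∣ a ∣ →
                    (∀ {x y} → x ≈ y [ p ] → x ^ n ≈ y ^ n [ M ]) →
                    a ^ n * powerSum p n ≈ powerSum p n [ M ]
  powerSum-dilate {p} {a} {M} n coprime ^-cong = begin
    a ^ n * powerSum p n                                ≡⟨ Σ<-* p (a ^ n) (λ k → (+ k) ^ n) ⟨
    Σ< p (λ k → a ^ n * (+ k) ^ n)                      ≡⟨ Σ<-sum p (λ k → a ^ n * (+ k) ^ n) ⟩
    ∑.sum {p} (λ i → a ^ n * (+ toℕ i) ^ n)             ≈⟨ ∑-cong (λ i → ≈-trans (≈-reflexive (sym (*-^-distrib a (+ toℕ i) n))) (^-cong (≈-sym (dilate-≈ a i)))) ⟩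
    ∑.sum {p} (λ i → (+ toℕ (dilate {p} a i)) ^ n)      ≡⟨ Σ<-dilate {a = a} coprime (λ k → (+ k) ^ n) ⟨
    powerSum p n                                        ∎
    where open import Relation.Binary.Reasoning.Setoid (≈-setoid M)

  -- By `powerSum-dilate` the factor a ^ n - 1 annihilates the power sum, and it is a unit modulo M.
  -- The modulus M will be p or p²; for p² the last hypothesis restricts n to multiples of p.
  powerSum≈0 : ∀ {p a M} n .{{_ : NonZero p}} → Coprime p ℤ.∣ a ∣ → Coprime M ℤ.∣ a ^ n - 1ℤ ∣ →
               (∀ {x y} → x ≈ y [ p ] → x ^ n ≈ y ^ n [ M ]) →
               powerSum p n ≈ 0ℤ [ M ]
  powerSum≈0 {p} {a} {M} n coprime coprime′ ^-cong = ≈-cancelˡ {a = a ^ n - 1ℤ} coprime′ (begin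
    (a ^ n - 1ℤ) * s          ≡⟨ ring (a ^ n) s ⟩
    a ^ n * s + - s           ≈⟨ ≈-+ (powerSum-dilate {a = a} n coprime ^-cong) ≈-refl ⟩
    s + - s                   ≡⟨ +-inverseʳ s ⟩
    0ℤ                        ≡⟨ *-zeroʳ (a ^ n - 1ℤ) ⟨
    (a ^ n - 1ℤ) * 0ℤ         ∎)
    where
    open import Relation.Binary.Reasoning.Setoid (≈-setoid M)
    s = powerSum p n
    ring : ∀ x s → (x - 1ℤ) * s ≡ x * s + - s
    ring = solve-∀

  ≉0⇒coprime : ∀ {p a} → Prime p → ¬ a ≈ 0ℤ [ p ] → Coprime p ℤ.∣ a ∣
  ≉0⇒coprime pr a≉0 = ∤⇒coprime pr (λ p∣a → a≉0 (∣⇒≈0 p∣a))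

  coprime-* : ∀ {m n k} → Coprime m k → Coprime n k → Coprime (m ℕ.* n) k
  coprime-* {m} {n} m⊥k n⊥k {d} (d∣mn , d∣k) =
    n⊥k (Coprimality.coprime-divisor (λ (e∣d , e∣m) → m⊥k (e∣m , ℕ.∣-trans e∣d d∣k)) d∣mn , d∣k)

  pos≉0 : ∀ {p k} → k < p → k ≢ 0 → ¬ + k ≈ 0ℤ [ p ]
  pos≉0 {p} {zero}  k<p k≢0 eq = k≢0 refl
  pos≉0 {p} {suc k} k<p k≢0 eq = ℕ.>⇒∤ k<p (≈0⇒∣ eq)

  *≈0 : ∀ {p} → Prime p → ∀ a b → a * b ≈ 0ℤ [ p ] → a ≈ 0ℤ [ p ] ⊎ b ≈ 0ℤ [ p ]
  *≈0 {p} pr a b eq with euclidsLemma ℤ.∣ a ∣ ℤ.∣ b ∣ pr (subst (p ∣_) (abs-* a b) (≈0⇒∣ eq))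
  ... | inj₁ p∣a = inj₁ (∣⇒≈0 p∣a)
  ... | inj₂ p∣b = inj₂ (∣⇒≈0 p∣b)

  -- Multiplication by `a` permutes the nonzero residues, so their product P equals a ^ q P, and P
  -- is a unit.
  fermat : ∀ {q} → Prime (suc q) → ∀ a → ¬ a ≈ 0ℤ [ suc q ] → a ^ q ≈ 1ℤ [ suc q ]
  fermat {q} pr a a≉0 = ≈-cancelˡ {a = P} (≉0⇒coprime pr P≉0) (begin
    P * a ^ q                                           ≡⟨ *-comm P (a ^ q) ⟩
    a ^ q * P                                           ≡⟨ Π-scale q a (λ i → + suc (toℕ i)) ⟨
    Π.sum {q} (λ i → a * + suc (toℕ i))                 ≡⟨ *-identityˡ _ ⟨
    1ℤ * Π.sum {q} (λ i → a * + suc (toℕ i))            ≈⟨ ≈-* F-zero (Π-cong F-suc) ⟨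
    Π.sum {suc q} (λ i → F (toℕ (dilate {suc q} a i)))  ≡⟨ Π.sum-permute (λ i → F (toℕ i)) (dilation {a = a} (≉0⇒coprime pr a≉0)) ⟨
    Π.sum {suc q} (λ i → F (toℕ i))                     ≡⟨ *-identityˡ P ⟩
    P                                                   ≡⟨ *-identityʳ P ⟨
    P * 1ℤ                                              ∎)
    where
    open import Relation.Binary.Reasoning.Setoid (≈-setoid (suc q))
    -- The permutation acts on all residues, including 0. Giving 0 the weight 1 lets it act on the
    -- product of the others.
    F : ℕ → ℤ
    F zero    = 1ℤ
    F (suc k) = + suc k
    P = Π.sum {q} (λ i → + suc (toℕ i))

    F-zero : F (toℕ (dilate {suc q} a zero)) ≈ 1ℤ [ suc q ]
    F-zero = ≈-reflexive (cong F (≈⇒≡ (Fin.toℕ<n _) (s≤s z≤n)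
      (≈-trans (dilate-≈ {suc q} a zero) (≈-reflexive (*-zeroʳ a)))))

    suc≉0 : ∀ i → ¬ + suc (toℕ {q} i) ≈ 0ℤ [ suc q ]
    suc≉0 i = pos≉0 (s≤s (Fin.toℕ<n i)) λ ()

    F-suc : ∀ i → F (toℕ (dilate {suc q} a (suc i))) ≈ a * + suc (toℕ i) [ suc q ]
    F-suc i with toℕ (dilate {suc q} a (suc i)) | dilate-≈ {suc q} a (suc i)
    ... | suc k | eq = eq
    ... | zero  | eq with *≈0 pr a (+ suc (toℕ i)) (≈-sym eq)
    ...   | inj₁ a≈0 = contradiction a≈0 a≉0
    ...   | inj₂ i≈0 = contradiction i≈0 (suc≉0 i)

    1≉0 : ¬ 1ℤ ≈ 0ℤ [ suc q ]
    1≉0 eq = ¬prime[1] (subst Prime (ℕ.∣1⇒≡1 (≈0⇒∣ eq)) pr)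

    P′≉0 : ∀ n (f : Fin n → ℤ) → (∀ i → ¬ f i ≈ 0ℤ [ suc q ]) → ¬ Π.sum f ≈ 0ℤ [ suc q ]
    P′≉0 zero    f f≉0 eq = 1≉0 eq
    P′≉0 (suc n) f f≉0 eq with *≈0 pr (f zero) (Π.sum (f ∘ suc)) eq
    ... | inj₁ eq′ = f≉0 zero eq′
    ... | inj₂ eq′ = P′≉0 n (f ∘ suc) (f≉0 ∘ suc) eq′

    P≉0 : ¬ P ≈ 0ℤ [ suc q ]
    P≉0 = P′≉0 q (λ i → + suc (toℕ i)) suc≉0

  -- The binomial theorem cut off after the linear term. It is applied with u a multiple of p, so
  -- that the modulus u² can be replaced by p².
  ^-first-order : ∀ y u k → (y + u) ^ suc k ≈ y ^ suc k + + suc k * (y ^ k * u) [ ℤ.∣ u * u ∣ ]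
  ^-first-order y u zero    = ≈-reflexive (ring y u)
    where
    ring : ∀ y u → (y + u) * 1ℤ ≡ y * 1ℤ + 1ℤ * (1ℤ * u)
    ring = solve-∀
  ^-first-order y u (suc k) = begin
    (y + u) * (y + u) ^ suc k
      ≈⟨ ≈-* (≈-refl {y + u}) (^-first-order y u k) ⟩
    (y + u) * (y * y ^ k + + suc k * (y ^ k * u))
      ≡⟨ ring y u (y ^ k) (+ suc k) ⟩
    y * (y * y ^ k) + (1ℤ + + suc k) * (y * y ^ k * u) + + suc k * y ^ k * (u * u)
      ≈⟨ ≈-+ (≈-refl {y * (y * y ^ k) + (1ℤ + + suc k) * (y * y ^ k * u)}) (≈-trans (≈-* (≈-refl {+ suc k * y ^ k}) (∣⇒≈0 {a = u * u} ℕ.∣-refl)) (≈-reflexive (*-zeroʳ (+ suc k * y ^ k)))) ⟩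
    y * (y * y ^ k) + (1ℤ + + suc k) * (y * y ^ k * u) + 0ℤ
      ≡⟨ +-identityʳ _ ⟩
    y * (y * y ^ k) + (1ℤ + + suc k) * (y * y ^ k * u) ∎
    where
    open import Relation.Binary.Reasoning.Setoid (≈-setoid ℤ.∣ u * u ∣)
    ring : ∀ y u x s → (y + u) * (y * x + s * (x * u)) ≡ y * (y * x) + (1ℤ + s) * (y * x * u) + s * x * (u * u)
    ring = solve-∀

  -- The linear term carries one factor p from the exponent and another from x - y.
  ^-lift : ∀ {p x y} .{{_ : NonZero p}} → x ≈ y [ p ] → x ^ p ≈ y ^ p [ p ℕ.* p ]
  ^-lift {p@(suc k)} {x} {y} (q , refl) = begin
    (y + u) ^ suc k                              ≈⟨ ≈-mono p²∣u² (^-first-order y u k) ⟩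
    y ^ suc k + + p * (y ^ k * (q * + p))        ≡⟨ cong (_+_ (y ^ suc k)) (ring (+ p) (y ^ k) q) ⟩
    y ^ suc k + y ^ k * q * (+ p * + p)          ≡⟨ cong (λ z → y ^ suc k + y ^ k * q * z) (pos-* p p) ⟨
    y ^ suc k + y ^ k * q * + (p ℕ.* p)          ≈⟨ (y ^ k * q , refl) ⟩
    y ^ suc k                                    ∎
    where
    open import Relation.Binary.Reasoning.Setoid (≈-setoid (p ℕ.* p))
    u = q * + p
    ring : ∀ p x q → p * (x * (q * p)) ≡ x * q * (p * p)
    ring = solve-∀
    p∣u : p ∣ ℤ.∣ u ∣
    p∣u = subst (p ∣_) (sym (abs-* q (+ p))) (ℕ.n∣m*n ℤ.∣ q ∣)
    p²∣u² : p ℕ.* p ∣ ℤ.∣ u * u ∣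
    p²∣u² = subst (p ℕ.* p ∣_) (sym (abs-* u u)) (ℕ.*-pres-∣ p∣u p∣u)

  ^-near-1 : ∀ {p x} k → x ≈ 1ℤ [ p ] → x ^ k ≈ 1ℤ + + k * (x - 1ℤ) [ p ℕ.* p ]
  ^-near-1 {p} {x} zero    eq = ≈-refl
  ^-near-1 {p} {x} (suc k) eq = begin
    x ^ suc k                                        ≡⟨ cong (_^ suc k) (ring x) ⟩
    (1ℤ + u) ^ suc k                                 ≈⟨ ≈-mono p²∣u² (^-first-order 1ℤ u k) ⟩
    1ℤ ^ suc k + + suc k * (1ℤ ^ k * u)              ≡⟨ cong₂ (λ a b → a + + suc k * (b * u)) (^-zeroˡ (suc k)) (^-zeroˡ k) ⟩
    1ℤ + + suc k * (1ℤ * u)                          ≡⟨ cong (λ z → 1ℤ + + suc k * z) (*-identityˡ u) ⟩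
    1ℤ + + suc k * u                                 ∎
    where
    open import Relation.Binary.Reasoning.Setoid (≈-setoid (p ℕ.* p))
    u = x - 1ℤ
    ring : ∀ x → x ≡ 1ℤ + (x - 1ℤ)
    ring = solve-∀
    p²∣u² : p ℕ.* p ∣ ℤ.∣ u * u ∣
    p²∣u² = subst (p ℕ.* p ∣_) (sym (abs-* u u)) (ℕ.*-pres-∣ (≈⇒∣ eq) (≈⇒∣ eq))

  -- Both sides are l + t + l t (x - 1) modulo p² when multiplied out with x = k ^ (p - 1).
  powerSum-interpolation : ∀ {q} → Prime (suc q) → ∀ l .{{_ : NonZero l}} t →
    + l * powerSum (suc q) (l ℕ.+ q ℕ.* t) + + t * powerSum (suc q) l
      ≈ + l * powerSum (suc q) l + + t * powerSum (suc q) (l ℕ.* suc q) [ suc q ℕ.* suc q ]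
  powerSum-interpolation {q} pr l@(suc _) t = begin
    + l * powerSum p m + + t * powerSum p l
      ≡⟨ combine (λ k → k ^ m) (λ k → k ^ l) ⟩
    Σ< p (λ k → + l * (+ k) ^ m + + t * (+ k) ^ l)
      ≈⟨ Σ<-cong p pointwise ⟩
    Σ< p (λ k → + l * (+ k) ^ l + + t * (+ k) ^ (l ℕ.* p))
      ≡⟨ combine (λ k → k ^ l) (λ k → k ^ (l ℕ.* p)) ⟨
    + l * powerSum p l + + t * powerSum p (l ℕ.* p) ∎
    where
    open import Relation.Binary.Reasoning.Setoid (≈-setoid (suc q ℕ.* suc q))
    p = suc q
    m = l ℕ.+ q ℕ.* t

    combine : ∀ (f g : ℤ → ℤ) → + l * Σ< p (λ k → f (+ k)) + + t * Σ< p (λ k → g (+ k)) ≡ Σ< p (λ k → + l * f (+ k) + + t * g (+ k))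
    combine f g = trans (cong₂ _+_ (sym (Σ<-* p (+ l) (λ k → f (+ k)))) (sym (Σ<-* p (+ t) (λ k → g (+ k)))))
                        (sym (Σ<-+ p (λ k → + l * f (+ k)) (λ k → + t * g (+ k))))

    split : ∀ k s → k ^ (l ℕ.+ q ℕ.* s) ≡ k ^ l * (k ^ q) ^ s
    split k s = trans (^-distribˡ-+-* k l (q ℕ.* s)) (cong (k ^ l *_) (sym (^-*-assoc k q s)))

    lp≡ : l ℕ.* p ≡ l ℕ.+ q ℕ.* l
    lp≡ = trans (ℕ.*-suc l q) (cong (l ℕ.+_) (ℕ.*-comm l q))

    exchange : ∀ y x → x ≈ 1ℤ [ p ] → + l * (y * x ^ t) + + t * y ≈ + l * y + + t * (y * x ^ l) [ p ℕ.* p ]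
    exchange y x x≈1 = begin
      + l * (y * x ^ t) + + t * y
        ≈⟨ ≈-+ (≈-* (≈-refl {+ l}) (≈-* (≈-refl {y}) (^-near-1 t x≈1))) (≈-refl {+ t * y}) ⟩
      + l * (y * (1ℤ + + t * (x - 1ℤ))) + + t * y
        ≡⟨ ring (+ l) (+ t) y (x - 1ℤ) ⟩
      + l * y + + t * (y * (1ℤ + + l * (x - 1ℤ)))
        ≈⟨ ≈-+ (≈-refl {+ l * y}) (≈-* (≈-refl {+ t}) (≈-* (≈-refl {y}) (^-near-1 l x≈1))) ⟨
      + l * y + + t * (y * x ^ l) ∎
      where
      ring : ∀ l t y u → l * (y * (1ℤ + t * u)) + t * y ≡ l * y + t * (y * (1ℤ + l * u))
      ring = solve-∀

    pointwise : ∀ k → k < p → + l * (+ k) ^ m + + t * (+ k) ^ l ≈ + l * (+ k) ^ l + + t * (+ k) ^ (l ℕ.* p) [ p ℕ.* p ]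
    -- Fermat's theorem does not cover k = 0. There all exponents are positive because `l` is, and
    -- every power vanishes.
    pointwise zero      _   = ≈-reflexive (trans (cong₂ _+_ (*-zeroʳ (+ l)) (*-zeroʳ (+ t))) (sym (cong₂ _+_ (*-zeroʳ (+ l)) (*-zeroʳ (+ t)))))
    pointwise k@(suc _) k<p = begin
      + l * (+ k) ^ m + + t * (+ k) ^ l
        ≡⟨ cong (λ z → + l * z + + t * (+ k) ^ l) (split (+ k) t) ⟩
      + l * ((+ k) ^ l * x ^ t) + + t * (+ k) ^ l
        ≈⟨ exchange ((+ k) ^ l) x (fermat pr (+ k) (pos≉0 k<p λ ())) ⟩
      + l * (+ k) ^ l + + t * ((+ k) ^ l * x ^ l)
        ≡⟨ cong (λ z → + l * (+ k) ^ l + + t * z) (trans (sym (split (+ k) l)) (cong ((+ k) ^_) (sym lp≡))) ⟩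
      + l * (+ k) ^ l + + t * (+ k) ^ (l ℕ.* p) ∎
      where x = (+ k) ^ q

  -- The term k = 0 vanishes since n is nonzero, and the q remaining terms add up to q ≡ - 1 modulo
  -- q + 1.
  powerSum≈-1 : ∀ {q} n .{{_ : NonZero n}} → (∀ k → k ≢ 0 → k < suc q → (+ k) ^ n ≈ 1ℤ [ suc q ]) →
                powerSum (suc q) n ≈ - 1ℤ [ suc q ]
  powerSum≈-1 {q} n@(suc _) ^≈1 = ≈-trans (partial q ℕ.≤-refl) q≈-1
    where
    partial : ∀ k → k < suc q → powerSum (suc k) n ≈ + k [ suc q ]
    partial zero    _   = ≈-refl
    partial (suc k) k<p = ≈-trans (≈-+ (partial k (ℕ.<-trans ℕ.≤-refl k<p)) (^≈1 (suc k) (λ ()) k<p))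
                                  (≈-reflexive (+-comm (+ k) 1ℤ))
    q≈-1 : + q ≈ - 1ℤ [ suc q ]
    q≈-1 = 1ℤ , ring (+ q)
      where
      ring : ∀ q → q ≡ - 1ℤ + 1ℤ * (1ℤ + q)
      ring = solve-∀

-- Divisibility by powers of p in the localisation at p

module LocalDivisibility where

  open BinomialConvolution
  open PowerSums
  open Congruences using (∤⇒coprime)
  open import Data.Integer.Base as ℤ using (ℤ; +_; 0ℤ; 1ℤ)
  import Data.Integer.Properties as ℤ
  open import Data.Nat.Base as ℕ using (ℕ; zero; suc; 2+; NonZero; _≤_; _<_; z≤n; s≤s; _∸_)
  open import Data.Nat.Coprimality as Coprimality using (Coprime)
  import Data.Nat.Divisibility as ℕ
  open import Data.Nat.Divisibility using (_∣_; _∤_; divides)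
  open import Data.Nat.Induction using (<-rec)
  open import Data.Nat.Primality hiding (prime)
  import Data.Nat.Properties as ℕ
  open import Data.Product.Base using (_×_; _,_)
  open import Data.Sum.Base using ([_,_]′)
  open import Data.Rational.Base using (ℚ; 0ℚ; 1ℚ; _+_; _*_; -_; _-_; _/_; toℚᵘ; ↥_; ↧_; ↧ₙ_; mkℚ)
  open import Data.Rational.Properties
  open import Data.Rational.Solver using (module +-*-Solver)
  open import Data.Rational.Unnormalised.Base as ℚᵘ using (mkℚᵘ; *≡*)
  import Data.Rational.Unnormalised.Properties as ℚᵘ
  open import Function.Base using (_∘_)
  open import Relation.Nullary.Decidable.Core using (yes; no)

  infix 4 _^_∣ℚ_

  -- x lies in p ^ k ℤ₍ₚ₎, where ℤ₍ₚ₎ is the localisation of ℤ at p.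
  record _^_∣ℚ_ (p k : ℕ) (x : ℚ) : Set where
    constructor frac
    field
      den      : ℕ
      num      : ℤ
      p∤den    : p ∤ den
      equality : ι (+ den) * x ≡ ι (+ (p ℕ.^ k)) * ι num

  ↧*≡↥ : ∀ x → ι (+ ↧ₙ x) * x ≡ ι (↥ x)
  ↧*≡↥ x@(mkℚ n d-1 _) = toℚᵘ-injective (begin
    toℚᵘ (ι (↧ x) * x)                ≈⟨ toℚᵘ-homo-* (ι (↧ x)) x ⟩
    toℚᵘ (ι (↧ x)) ℚᵘ.* mkℚᵘ n d-1    ≈⟨ ℚᵘ.*-congʳ {mkℚᵘ n d-1} (toℚᵘ-ι (↧ x)) ⟩
    mkℚᵘ (↧ x) 0 ℚᵘ.* mkℚᵘ n d-1      ≈⟨ *≡* (trans (ℤ.*-identityʳ (↧ x ℤ.* n)) (trans (ℤ.*-comm (↧ x) n) (cong (λ d → n ℤ.* + suc d) (sym (ℕ.+-identityʳ d-1))))) ⟩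
    mkℚᵘ n 0                          ≈⟨ toℚᵘ-ι n ⟨
    toℚᵘ (ι n)                        ∎)
    where open ℚᵘ.≃-Reasoning

  ι-*ℕ : ∀ m n → ι (+ (m ℕ.* n)) ≡ ι (+ m) * ι (+ n)
  ι-*ℕ m n = trans (cong ι (ℤ.pos-* m n)) (ι-* (+ m) (+ n))

  -- This is `γ N` divided by N. The variants `β⁺` and `β⁺⁺` drop the terms of index below 1 and
  -- below 2, which are treated separately.
  β : ℕ → PowerSeries
  β N j = ι ((+ N) ℤ.^ j) * (1ℤ / suc j)

  β⁺ : ℕ → PowerSeries
  β⁺ N zero    = 0ℚ
  β⁺ N (suc j) = β N (suc j)

  β⁺⁺ : ℕ → PowerSeries
  β⁺⁺ N 0        = 0ℚ
  β⁺⁺ N 1        = 0ℚ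
  β⁺⁺ N (2+ j)   = β N (2+ j)

  -- The term j = 0 of Faulhaber's formula is N B n. The factor N is moved onto the Bernoulli
  -- numbers because for N = p only the products p B i are always p-integral.
  powerSum-split : ∀ N n → ι (powerSum N n) ≡ ι (+ N) * B n + ((λ i → ι (+ N) * B i) ⋆ β⁺ N) n
  powerSum-split N n = begin
    ι (powerSum N n)
      ≡⟨ powerSum-B N n ⟨
    (B ⋆ γ N) n
      ≡⟨ ⋆-cong {B} (λ _ → refl) γ-β n ⟩
    (B ⋆ (λ i → ι (+ N) * (pow 0 i + β⁺ N i))) n
      ≡⟨ trans (⋆-scaleʳ (ι (+ N)) B _ n) (sym (⋆-scaleˡ (ι (+ N)) B _ n)) ⟩
    ((λ i → ι (+ N) * B i) ⋆ (λ i → pow 0 i + β⁺ N i)) n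
      ≡⟨ ⋆-distribˡ-+ (λ i → ι (+ N) * B i) (pow 0) (β⁺ N) n ⟩
    ((λ i → ι (+ N) * B i) ⋆ pow 0) n + ((λ i → ι (+ N) * B i) ⋆ β⁺ N) n
      ≡⟨ cong (_+ ((λ i → ι (+ N) * B i) ⋆ β⁺ N) n) (trans (⋆-comm (λ i → ι (+ N) * B i) (pow 0) n) (pow0-⋆ (λ i → ι (+ N) * B i) n)) ⟩
    ι (+ N) * B n + ((λ i → ι (+ N) * B i) ⋆ β⁺ N) n ∎
    where
    open ≡-Reasoning
    γ-β : ∀ i → γ N i ≡ ι (+ N) * (pow 0 i + β⁺ N i)
    γ-β zero    = trans (*-identityʳ _) (trans (cong ι (ℤ.*-identityʳ (+ N))) (sym (*-identityʳ _)))
    γ-β (suc i) = begin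
      ι (+ N ℤ.* (+ N) ℤ.^ suc i) * (1ℤ / 2+ i)         ≡⟨ cong (_* (1ℤ / 2+ i)) (ι-* (+ N) ((+ N) ℤ.^ suc i)) ⟩
      ι (+ N) * ι ((+ N) ℤ.^ suc i) * (1ℤ / 2+ i)       ≡⟨ *-assoc (ι (+ N)) _ _ ⟩
      ι (+ N) * β N (suc i)                             ≡⟨ cong (ι (+ N) *_) (+-identityˡ (β N (suc i))) ⟨
      ι (+ N) * (0ℚ + β N (suc i))                      ∎

  pos-^ : ∀ n k → + (n ℕ.^ k) ≡ (+ n) ℤ.^ k
  pos-^ n zero    = refl
  pos-^ n (suc k) = trans (ℤ.pos-* n (n ℕ.^ k)) (cong (+ n ℤ.*_) (pos-^ n k))

  module Local {p} (pr : Prime p) where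

    private instance
      p≢0 : NonZero p
      p≢0 = prime⇒nonZero pr

    private variable
      j k : ℕ
      x y : ℚ

    ∤-* : ∀ {m n} → p ∤ m → p ∤ n → p ∤ m ℕ.* n
    ∤-* {m} {n} p∤m p∤n p∣mn = [ p∤m , p∤n ]′ (euclidsLemma m n pr p∣mn)

    p∤1 : p ∤ 1
    p∤1 p∣1 = ¬prime[1] (subst Prime (ℕ.∣1⇒≡1 p∣1) pr)

    ^-coprime : ∀ k {d} → p ∤ d → Coprime (p ℕ.^ k) d
    ^-coprime zero    p∤d = Coprimality.1-coprimeTo _
    ^-coprime (suc k) p∤d (e∣p^k , e∣d) =
      ^-coprime k p∤d (Coprimality.coprime-divisor (λ (f∣e , f∣p) → ∤⇒coprime pr p∤d (f∣p , ℕ.∣-trans f∣e e∣d)) e∣p^k , e∣d)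

    ∣ℚ-+ : p ^ k ∣ℚ x → p ^ k ∣ℚ y → p ^ k ∣ℚ x + y
    ∣ℚ-+ {k} {x} {y} (frac d a p∤d eq) (frac e b p∤e eq′) = frac (d ℕ.* e) (+ e ℤ.* a ℤ.+ + d ℤ.* b) (∤-* p∤d p∤e) (begin
      ι (+ (d ℕ.* e)) * (x + y)        ≡⟨ cong (_* (x + y)) (ι-*ℕ d e) ⟩
      D * E * (x + y)                  ≡⟨ solve 4 (λ D E x y → D :* E :* (x :+ y) := E :* (D :* x) :+ D :* (E :* y)) refl D E x y ⟩
      E * (D * x) + D * (E * y)        ≡⟨ cong₂ (λ u v → E * u + D * v) eq eq′ ⟩
      E * (P * ι a) + D * (P * ι b)    ≡⟨ solve 5 (λ D E P a b → E :* (P :* a) :+ D :* (P :* b) := P :* (E :* a :+ D :* b)) refl D E P (ι a) (ι b) ⟩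
      P * (E * ι a + D * ι b)          ≡⟨ cong (P *_) (trans (ι-+ (+ e ℤ.* a) (+ d ℤ.* b)) (cong₂ _+_ (ι-* (+ e) a) (ι-* (+ d) b))) ⟨
      P * ι (+ e ℤ.* a ℤ.+ + d ℤ.* b)  ∎)
      where
      open ≡-Reasoning
      open +-*-Solver
      D = ι (+ d)
      E = ι (+ e)
      P = ι (+ (p ℕ.^ k))

    ∣ℚ-* : p ^ j ∣ℚ x → p ^ k ∣ℚ y → p ^ j ℕ.+ k ∣ℚ x * y
    ∣ℚ-* {j} {x} {k} {y} (frac d a p∤d eq) (frac e b p∤e eq′) = frac (d ℕ.* e) (a ℤ.* b) (∤-* p∤d p∤e) (begin
      ι (+ (d ℕ.* e)) * (x * y)      ≡⟨ cong (_* (x * y)) (ι-*ℕ d e) ⟩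
      D * E * (x * y)                ≡⟨ interchange D E x y ⟩
      D * x * (E * y)                ≡⟨ cong₂ _*_ eq eq′ ⟩
      P * ι a * (Q * ι b)            ≡⟨ interchange P (ι a) Q (ι b) ⟩
      P * Q * (ι a * ι b)            ≡⟨ cong₂ _*_ (trans (cong (ι ∘ +_) (ℕ.^-distribˡ-+-* p j k)) (ι-*ℕ (p ℕ.^ j) (p ℕ.^ k))) (ι-* a b) ⟨
      ι (+ (p ℕ.^ (j ℕ.+ k))) * ι (a ℤ.* b) ∎)
      where
      open ≡-Reasoning
      D = ι (+ d)
      E = ι (+ e)
      P = ι (+ (p ℕ.^ j))
      Q = ι (+ (p ℕ.^ k))
      interchange : ∀ a b c d → a * b * (c * d) ≡ a * c * (b * d)
      interchange = solve 4 (λ a b c d → a :* b :* (c :* d) := a :* c :* (b :* d)) refl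
        where open +-*-Solver

    ∣ℚ-ι : ∀ a → p ℕ.^ k ∣ ℤ.∣ a ∣ → p ^ k ∣ℚ ι a
    ∣ℚ-ι {k} a p^k∣a with S.∣ᵤ⇒∣ {+ (p ℕ.^ k)} {a} p^k∣a
      where import Data.Integer.Divisibility.Signed as S
    ... | record { quotient = q ; equality = eq } = frac 1 q p∤1
      (trans (*-identityˡ (ι a)) (trans (cong ι (trans eq (ℤ.*-comm q _))) (ι-* (+ (p ℕ.^ k)) q)))

    ι-∣ℚ : ∀ a → p ^ k ∣ℚ ι a → p ℕ.^ k ∣ ℤ.∣ a ∣
    ι-∣ℚ {k} a (frac d b p∤d eq) = Coprimality.coprime-divisor (^-coprime k p∤d) (divides ℤ.∣ b ∣ (begin
      d ℕ.* ℤ.∣ a ∣                    ≡⟨ ℤ.abs-* (+ d) a ⟨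
      ℤ.∣ + d ℤ.* a ∣                  ≡⟨ cong ℤ.∣_∣ (ι-injective {+ d ℤ.* a} {+ (p ℕ.^ k) ℤ.* b} (trans (ι-* (+ d) a) (trans eq (sym (ι-* (+ (p ℕ.^ k)) b))))) ⟩
      ℤ.∣ + (p ℕ.^ k) ℤ.* b ∣          ≡⟨ ℤ.abs-* (+ (p ℕ.^ k)) b ⟩
      p ℕ.^ k ℕ.* ℤ.∣ b ∣              ≡⟨ ℕ.*-comm (p ℕ.^ k) ℤ.∣ b ∣ ⟩
      ℤ.∣ b ∣ ℕ.* p ℕ.^ k              ∎))
      where open ≡-Reasoning

    ∣ℚ-integer : ∀ a → p ^ 0 ∣ℚ ι a
    ∣ℚ-integer a = ∣ℚ-ι {0} a (ℕ.1∣ ℤ.∣ a ∣)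

    ∣ℚ-p^ : ∀ k → p ^ k ∣ℚ ι (+ (p ℕ.^ k))
    ∣ℚ-p^ k = ∣ℚ-ι {k} (+ (p ℕ.^ k)) ℕ.∣-refl

    ∣ℚ-p : p ^ 1 ∣ℚ ι (+ p)
    ∣ℚ-p = ∣ℚ-ι {1} (+ p) (ℕ.∣-reflexive (ℕ.*-identityʳ p))

    ∣ℚ-0 : p ^ k ∣ℚ 0ℚ
    ∣ℚ-0 {k} = ∣ℚ-ι {k} 0ℤ ((p ℕ.^ k) ℕ.∣0)

    ∣ℚ-neg : p ^ k ∣ℚ x → p ^ k ∣ℚ - x
    ∣ℚ-neg {k} {x} p^k∣x = subst (p ^ k ∣ℚ_) (solve 1 (λ x → con (ι (ℤ.- 1ℤ)) :* x := :- x) refl x)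
      (∣ℚ-* {0} (∣ℚ-integer (ℤ.- 1ℤ)) p^k∣x)
      where open +-*-Solver

    ∣ℚ-weaken : j ≤ k → p ^ k ∣ℚ x → p ^ j ∣ℚ x
    ∣ℚ-weaken {j} {k} {x} j≤k (frac d a p∤d eq) = frac d (+ (p ℕ.^ (k ∸ j)) ℤ.* a) p∤d (begin
      ι (+ d) * x                                       ≡⟨ eq ⟩
      ι (+ (p ℕ.^ k)) * ι a                             ≡⟨ cong (λ z → ι (+ (p ℕ.^ z)) * ι a) (sym (ℕ.m+[n∸m]≡n j≤k)) ⟩
      ι (+ (p ℕ.^ (j ℕ.+ (k ∸ j)))) * ι a               ≡⟨ cong (λ z → ι (+ z) * ι a) (ℕ.^-distribˡ-+-* p j (k ∸ j)) ⟩
      ι (+ (p ℕ.^ j ℕ.* p ℕ.^ (k ∸ j))) * ι a           ≡⟨ cong (_* ι a) (ι-*ℕ (p ℕ.^ j) (p ℕ.^ (k ∸ j))) ⟩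
      ι (+ (p ℕ.^ j)) * ι (+ (p ℕ.^ (k ∸ j))) * ι a     ≡⟨ *-assoc (ι (+ (p ℕ.^ j))) _ _ ⟩
      ι (+ (p ℕ.^ j)) * (ι (+ (p ℕ.^ (k ∸ j))) * ι a)   ≡⟨ cong (ι (+ (p ℕ.^ j)) *_) (ι-* (+ (p ℕ.^ (k ∸ j))) a) ⟨
      ι (+ (p ℕ.^ j)) * ι (+ (p ℕ.^ (k ∸ j)) ℤ.* a)     ∎)
      where open ≡-Reasoning

    ∣ℚ-cancel-unit : ∀ n → p ∤ n → p ^ k ∣ℚ ι (+ n) * x → p ^ k ∣ℚ x
    ∣ℚ-cancel-unit {k} {x} n p∤n (frac d a p∤d eq) = frac (d ℕ.* n) a (∤-* p∤d p∤n)
      (trans (cong (_* x) (ι-*ℕ d n)) (trans (*-assoc (ι (+ d)) (ι (+ n)) x) eq))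

    ∣ℚ-cancel-p : p ^ suc k ∣ℚ ι (+ p) * x → p ^ k ∣ℚ x
    ∣ℚ-cancel-p {k} {x} (frac d a p∤d eq) = frac d a p∤d (*-cancelˡ-ι p (begin
      ι (+ p) * (ι (+ d) * x)             ≡⟨ solve 3 (λ x y z → x :* (y :* z) := y :* (x :* z)) refl (ι (+ p)) (ι (+ d)) x ⟩
      ι (+ d) * (ι (+ p) * x)             ≡⟨ eq ⟩
      ι (+ (p ℕ.* p ℕ.^ k)) * ι a         ≡⟨ cong (_* ι a) (ι-*ℕ p (p ℕ.^ k)) ⟩
      ι (+ p) * ι (+ (p ℕ.^ k)) * ι a     ≡⟨ *-assoc (ι (+ p)) _ _ ⟩
      ι (+ p) * (ι (+ (p ℕ.^ k)) * ι a)   ∎))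
      where
      open ≡-Reasoning
      open +-*-Solver

    1/-∣ℚ : ∀ n .{{_ : NonZero n}} → p ∤ n → p ^ 0 ∣ℚ 1ℤ / n
    1/-∣ℚ n p∤n = frac n 1ℤ p∤n (n/1*1/n n)

    ∣↥⇒∣ℚ : p ∣ ℤ.∣ ↥ x ∣ → p ^ 1 ∣ℚ x
    ∣↥⇒∣ℚ {x@(mkℚ n d-1 coprime)} p∣n = ∣ℚ-cancel-unit (↧ₙ x) p∤d
      (subst (p ^ 1 ∣ℚ_) (sym (↧*≡↥ x)) (∣ℚ-ι {1} n (subst (_∣ ℤ.∣ n ∣) (sym (ℕ.*-identityʳ p)) p∣n)))
      where
      p∤d : p ∤ suc d-1
      p∤d p∣d = ¬prime[1] (subst Prime (Coprimality.recompute coprime (p∣n , p∣d)) pr)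

    ∣ℚ⇒∣↥ : p ^ 1 ∣ℚ x → p ∣ ℤ.∣ ↥ x ∣
    ∣ℚ⇒∣↥ {x} p∣x = subst (_∣ ℤ.∣ ↥ x ∣) (ℕ.*-identityʳ p)
      (ι-∣ℚ {1} (↥ x) (subst (p ^ 1 ∣ℚ_) (↧*≡↥ x) (∣ℚ-* {0} (∣ℚ-integer (↧ x)) p∣x)))

    factor : ∀ n .{{_ : NonZero n}} → ∃[ e ] ∃[ u ] (n ≡ p ℕ.^ e ℕ.* u × p ∤ u)
    factor = <-rec _ step
      where
      Goal : ℕ → Set
      Goal n = .{{_ : NonZero n}} → ∃[ e ] ∃[ u ] (n ≡ p ℕ.^ e ℕ.* u × p ∤ u)
      step : ∀ n → (∀ {m} → m < n → Goal m) → Goal n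
      step n rec with p ℕ.∣? n
      ... | no  p∤n  = 0 , n , sym (ℕ.*-identityˡ n) , p∤n
      ... | yes p∣n@(divides m n≡mp) with rec m<n {{m≢0}}
        where
        instance _ = prime⇒nonTrivial pr
        m<n : m < n
        m<n = ℕ.quotient-< p∣n
        m≢0 : NonZero m
        m≢0 = ℕ.quotient≢0 p∣n
      ...   | e , u , refl , p∤u = suc e , u , trans n≡mp (trans (ℕ.*-comm _ p) (sym (ℕ.*-assoc p (p ℕ.^ e) u))) , p∤u

    ⋆-∣ℚ : ∀ {s t} a b n → (∀ i → i ≤ n → p ^ s ∣ℚ a i) → (∀ i → i ≤ n → p ^ t ∣ℚ b i) → p ^ s ℕ.+ t ∣ℚ (a ⋆ b) n
    ⋆-∣ℚ a b zero    a∣ b∣ = ∣ℚ-* (a∣ 0 z≤n) (b∣ 0 z≤n)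
    ⋆-∣ℚ a b (suc n) a∣ b∣ = ∣ℚ-+
      (⋆-∣ℚ (a ∘ suc) b n (λ i i≤n → a∣ (suc i) (s≤s i≤n)) (λ i i≤n → b∣ i (ℕ.m≤n⇒m≤1+n i≤n)))
      (⋆-∣ℚ a (b ∘ suc) n (λ i i≤n → a∣ i (ℕ.m≤n⇒m≤1+n i≤n)) (λ i i≤n → b∣ (suc i) (s≤s i≤n)))

    -- Since `b` starts with 0, the value `a n` does not contribute. This permits strong induction,
    -- where `a` is known only below n.
    ⋆-∣ℚ′ : ∀ {s t} a b n → b 0 ≡ 0ℚ → (∀ i → i < n → p ^ s ∣ℚ a i) → (∀ i → i ≤ n → p ^ t ∣ℚ b i) → p ^ s ℕ.+ t ∣ℚ (a ⋆ b) n
    ⋆-∣ℚ′ a b zero    b0 a∣ b∣ = subst (p ^ _ ∣ℚ_) (sym (trans (cong (a 0 *_) b0) (*-zeroʳ (a 0)))) ∣ℚ-0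
    ⋆-∣ℚ′ a b (suc n) b0 a∣ b∣ = ∣ℚ-+
      (⋆-∣ℚ′ (a ∘ suc) b n b0 (λ i i<n → a∣ (suc i) (s≤s i<n)) (λ i i≤n → b∣ i (ℕ.m≤n⇒m≤1+n i≤n)))
      (⋆-∣ℚ a (b ∘ suc) n (λ i i≤n → a∣ i (s≤s i≤n)) (λ i i≤n → b∣ (suc i) (s≤s i≤n)))

    -- If p ^ e is the exact power of p in j + 1, then p ^ j / (j + 1) has p-adic valuation j - e,
    -- and p ^ e ≤ j + 1 < p ^ i forces e < i.
    β-∣ℚ : ∀ i j → suc j < p ℕ.^ i → i ≤ j → p ^ suc (j ∸ i) ∣ℚ β p j
    β-∣ℚ i j j<p^i i≤j with factor (suc j)
    ... | e , u , 1+j≡ , p∤u = ∣ℚ-cancel-unit u p∤u (subst (p ^ suc (j ∸ i) ∣ℚ_) (sym (*-cancelˡ-ι (p ℕ.^ e) eq))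
      (∣ℚ-weaken bound (∣ℚ-p^ (j ∸ e))))
      where
      instance
        _ = ℕ.m^n≢0 p e
      e<i : e < i
      e<i = ℕ.≰⇒> λ i≤e → ℕ.<⇒≱ j<p^i (ℕ.≤-trans (ℕ.^-monoʳ-≤ p i≤e) (ℕ.∣⇒≤ (divides u (trans 1+j≡ (ℕ.*-comm (p ℕ.^ e) u)))))
      bound : suc (j ∸ i) ≤ j ∸ e
      bound = ℕ.∸-monoʳ-< e<i i≤j
      eq : ι (+ (p ℕ.^ e)) * (ι (+ u) * β p j) ≡ ι (+ (p ℕ.^ e)) * ι (+ (p ℕ.^ (j ∸ e)))
      eq = begin
        ι (+ (p ℕ.^ e)) * (ι (+ u) * (ι ((+ p) ℤ.^ j) * (1ℤ / suc j)))
          ≡⟨ solve 4 (λ P u Q d → P :* (u :* (Q :* d)) := Q :* (P :* u :* d)) refl (ι (+ (p ℕ.^ e))) (ι (+ u)) (ι ((+ p) ℤ.^ j)) (1ℤ / suc j) ⟩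
        ι ((+ p) ℤ.^ j) * (ι (+ (p ℕ.^ e)) * ι (+ u) * (1ℤ / suc j))
          ≡⟨ cong (λ z → ι ((+ p) ℤ.^ j) * (z * (1ℤ / suc j))) (trans (cong (ι ∘ +_) 1+j≡) (ι-*ℕ (p ℕ.^ e) u)) ⟨
        ι ((+ p) ℤ.^ j) * (ι (+ suc j) * (1ℤ / suc j))
          ≡⟨ cong (ι ((+ p) ℤ.^ j) *_) (n/1*1/n (suc j)) ⟩
        ι ((+ p) ℤ.^ j) * 1ℚ
          ≡⟨ *-identityʳ _ ⟩
        ι ((+ p) ℤ.^ j)
          ≡⟨ cong ι (pos-^ p j) ⟨
        ι (+ (p ℕ.^ j))
          ≡⟨ cong (λ z → ι (+ (p ℕ.^ z))) (ℕ.m+[n∸m]≡n (ℕ.<⇒≤ (ℕ.<-≤-trans e<i i≤j))) ⟨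
        ι (+ (p ℕ.^ (e ℕ.+ (j ∸ e))))
          ≡⟨ trans (cong (ι ∘ +_) (ℕ.^-distribˡ-+-* p e (j ∸ e))) (ι-*ℕ (p ℕ.^ e) (p ℕ.^ (j ∸ e))) ⟩
        ι (+ (p ℕ.^ e)) * ι (+ (p ℕ.^ (j ∸ e))) ∎
        where
        open ≡-Reasoning
        open +-*-Solver

    -- With j = n + 1 this is j + 1 < p ^ j, the input for `β-∣ℚ` at i = j: p ^ j / (j + 1) keeps a
    -- factor p for all j ≥ 1.
    2+n<p^1+n : 3 ≤ p → ∀ n → 2+ n < p ℕ.^ suc n
    2+n<p^1+n 3≤p zero    = subst (3 ≤_) (sym (ℕ.*-identityʳ p)) 3≤p
    2+n<p^1+n 3≤p (suc n) = begin
      4 ℕ.+ n                       ≤⟨ ℕ.m≤m+n (4 ℕ.+ n) (5 ℕ.+ (n ℕ.+ n)) ⟩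
      4 ℕ.+ n ℕ.+ (5 ℕ.+ (n ℕ.+ n)) ≡⟨ ring n ⟩
      3 ℕ.* (3 ℕ.+ n)               ≤⟨ ℕ.*-mono-≤ 3≤p (2+n<p^1+n 3≤p n) ⟩
      p ℕ.* p ℕ.^ suc n             ∎
      where
      open ℕ.≤-Reasoning
      open import Data.Nat.Tactic.RingSolver using (solve-∀)
      ring : ∀ n → 4 ℕ.+ n ℕ.+ (5 ℕ.+ (n ℕ.+ n)) ≡ 3 ℕ.* (3 ℕ.+ n)
      ring = solve-∀

    -- With j = n + 2 this is j + 1 < p ^ (j - 1), which leaves two factors p in p ^ j / (j + 1).
    -- For p = 3 it fails at j = 2: 3² / 3 is not divisible by 3².
    3+n<p^1+n : 5 ≤ p → ∀ n → 3 ℕ.+ n < p ℕ.^ suc n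
    3+n<p^1+n 5≤p zero    = subst (4 ≤_) (sym (ℕ.*-identityʳ p)) (ℕ.<⇒≤ 5≤p)
    3+n<p^1+n 5≤p (suc n) = begin
      5 ℕ.+ n                            ≤⟨ ℕ.m≤m+n (5 ℕ.+ n) (15 ℕ.+ (4 ℕ.* n)) ⟩
      5 ℕ.+ n ℕ.+ (15 ℕ.+ (4 ℕ.* n))     ≡⟨ ring n ⟩
      5 ℕ.* (4 ℕ.+ n)                    ≤⟨ ℕ.*-mono-≤ 5≤p (3+n<p^1+n 5≤p n) ⟩
      p ℕ.* p ℕ.^ suc n                  ∎
      where
      open ℕ.≤-Reasoning
      open import Data.Nat.Tactic.RingSolver using (solve-∀)
      ring : ∀ n → 5 ℕ.+ n ℕ.+ (15 ℕ.+ (4 ℕ.* n)) ≡ 5 ℕ.* (4 ℕ.+ n)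
      ring = solve-∀

    β⁺-∣ℚ : 3 ≤ p → ∀ j → p ^ 1 ∣ℚ β⁺ p j
    β⁺-∣ℚ 3≤p zero    = ∣ℚ-0
    β⁺-∣ℚ 3≤p (suc j) = subst (λ k → p ^ suc k ∣ℚ β p (suc j)) (ℕ.n∸n≡0 j)
      (β-∣ℚ (suc j) (suc j) (2+n<p^1+n 3≤p j) ℕ.≤-refl)

    β⁺⁺-∣ℚ : 5 ≤ p → ∀ j → p ^ 2 ∣ℚ β⁺⁺ p j
    β⁺⁺-∣ℚ 5≤p 0      = ∣ℚ-0
    β⁺⁺-∣ℚ 5≤p 1      = ∣ℚ-0
    β⁺⁺-∣ℚ 5≤p (2+ j) = subst (λ k → p ^ suc k ∣ℚ β p (2+ j)) (ℕ.m+n∸n≡m 1 j)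
      (β-∣ℚ (suc j) (2+ j) (3+n<p^1+n 5≤p j) (ℕ.n≤1+n (suc j)))

    pB : PowerSeries
    pB n = ι (+ p) * B n

    ∣ℚ-difference : ∀ {x y z} → z ≡ x + y → p ^ k ∣ℚ y → p ^ k ∣ℚ z - x
    ∣ℚ-difference {k} {x} {y} {z} eq p^k∣y = subst (p ^ k ∣ℚ_) (sym (trans (cong (_- x) eq) (lemma x y))) p^k∣y
      where
      lemma : ∀ x y → x + y - x ≡ y
      lemma = solve 2 (λ x y → x :+ y :- x := y) refl
        where open +-*-Solver

    ∣ℚ-subtrahend : ∀ {x y} → p ^ k ∣ℚ x → p ^ k ∣ℚ x - y → p ^ k ∣ℚ y
    ∣ℚ-subtrahend {k} {x} {y} p^k∣x p^k∣x-y = subst (p ^ k ∣ℚ_) (lemma x y) (∣ℚ-+ p^k∣x (∣ℚ-neg p^k∣x-y))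
      where
      lemma : ∀ x y → x + - (x - y) ≡ y
      lemma = solve 2 (λ x y → x :+ :- (x :- y) := y) refl
        where open +-*-Solver

    -- Faulhaber's formula expresses p B n by the integer S n and by p B i with i < n, with
    -- p-integral coefficients.
    pB-integral : 3 ≤ p → ∀ n → p ^ 0 ∣ℚ pB n
    pB-integral 3≤p = <-rec _ λ n rec → ∣ℚ-subtrahend (∣ℚ-integer (powerSum p n))
      (∣ℚ-difference {0} {x = pB n} (powerSum-split p n)
        (⋆-∣ℚ′ {0} {0} pB (β⁺ p) n refl (λ i i<n → rec i<n) (λ i _ → ∣ℚ-weaken {0} z≤n (β⁺-∣ℚ 3≤p i))))

    powerSum-pB : 3 ≤ p → ∀ n → p ^ 1 ∣ℚ ι (powerSum p n) - pB n
    powerSum-pB 3≤p n = ∣ℚ-difference {1} {x = pB n} (powerSum-split p n)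
      (⋆-∣ℚ′ {0} {1} pB (β⁺ p) n refl (λ i _ → pB-integral 3≤p i) (λ i _ → β⁺-∣ℚ 3≤p i))

    -- Faulhaber's formula at N = 1 is a recurrence for B n in which only the denominators 2, …, n + 1 occur.
    B-integral-small : ∀ n → suc n < p → p ^ 0 ∣ℚ B n
    B-integral-small = <-rec _ λ n rec 1+n<p → ∣ℚ-cancel-unit 1 p∤1 (∣ℚ-subtrahend (∣ℚ-integer (powerSum 1 n))
      (∣ℚ-difference {0} {x = 1ℚ * B n} (powerSum-split 1 n)
        (⋆-∣ℚ′ {0} {0} (λ i → 1ℚ * B i) (β⁺ 1) n refl
          (λ i i<n → subst (p ^ 0 ∣ℚ_) (sym (*-identityˡ (B i))) (rec i<n (ℕ.<-trans (s≤s i<n) 1+n<p)))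
          (λ i i≤n → β⁺1-∣ℚ i (ℕ.≤-<-trans (s≤s i≤n) 1+n<p)))))
      where
      β⁺1-∣ℚ : ∀ i → suc i < p → p ^ 0 ∣ℚ β⁺ 1 i
      β⁺1-∣ℚ zero    _     = ∣ℚ-0
      β⁺1-∣ℚ (suc i) 2+i<p = ∣ℚ-* {0} {k = 0} (∣ℚ-integer ((+ 1) ℤ.^ suc i)) (1/-∣ℚ (2+ i) (ℕ.>⇒∤ 2+i<p))

    -- All terms j ≥ 2 are divisible by p². The term j = 1 is (p / 2) (n + 1) (p B n), where p / 2
    -- supplies only one factor p; the other is visible once B n is p-integral.
    powerSum-pB² : 5 ≤ p → ∀ n → p ^ 0 ∣ℚ B n → p ^ 2 ∣ℚ ι (powerSum p (suc n)) - pB (suc n)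
    powerSum-pB² 5≤p n p^0∣Bn = ∣ℚ-difference {2} {x = pB (suc n)} (powerSum-split p (suc n))
      (subst (p ^ 2 ∣ℚ_) (sym split) (∣ℚ-+ linear
        (⋆-∣ℚ {0} {2} pB (β⁺⁺ p) (suc n) (λ i _ → pB-integral 3≤p i) (λ i _ → β⁺⁺-∣ℚ 5≤p i))))
      where
      open ≡-Reasoning
      3≤p : 3 ≤ p
      3≤p = ℕ.≤-trans (s≤s (s≤s (s≤s z≤n))) 5≤p
      split : (pB ⋆ β⁺ p) (suc n) ≡ β p 1 * (ι (+ suc n) * pB n) + (pB ⋆ β⁺⁺ p) (suc n)
      split = begin
        (pB ⋆ β⁺ p) (suc n)
          ≡⟨ ⋆-cong {pB} (λ _ → refl) β⁺-split (suc n) ⟩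
        (pB ⋆ (λ i → β p 1 * Z i + β⁺⁺ p i)) (suc n)
          ≡⟨ ⋆-distribˡ-+ pB (λ i → β p 1 * Z i) (β⁺⁺ p) (suc n) ⟩
        (pB ⋆ (λ i → β p 1 * Z i)) (suc n) + (pB ⋆ β⁺⁺ p) (suc n)
          ≡⟨ cong (_+ (pB ⋆ β⁺⁺ p) (suc n)) (trans (⋆-scaleʳ (β p 1) pB Z (suc n)) (cong (β p 1 *_) (trans (⋆-comm pB Z (suc n)) (Z-⋆ pB n)))) ⟩
        β p 1 * (ι (+ suc n) * pB n) + (pB ⋆ β⁺⁺ p) (suc n) ∎
        where
        β⁺-split : ∀ i → β⁺ p i ≡ β p 1 * Z i + β⁺⁺ p i
        β⁺-split 0      = sym (trans (+-identityʳ _) (*-zeroʳ (β p 1)))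
        β⁺-split 1      = sym (trans (+-identityʳ _) (*-identityʳ (β p 1)))
        β⁺-split (2+ i) = sym (trans (cong (_+ β p (2+ i)) (*-zeroʳ (β p 1))) (+-identityˡ _))
      linear : p ^ 2 ∣ℚ β p 1 * (ι (+ suc n) * pB n)
      linear = ∣ℚ-* {1} {k = 1} (β⁺-∣ℚ 3≤p 1) (∣ℚ-* {0} {k = 1} (∣ℚ-integer (+ suc n)) (∣ℚ-* {1} {k = 0} ∣ℚ-p p^0∣Bn))

-- The theorems of von Staudt and Kummer

module KummerCongruence where

  open BinomialConvolution
  open PowerSums
  open Congruences
  open PowerSumCongruences
  open LocalDivisibility
  open import Data.Integer.Base as ℤ using (ℤ; +_; 0ℤ; 1ℤ)
  import Data.Integer.Properties as ℤ
  open import Data.Nat.Base as ℕ using (ℕ; suc; NonZero; _≤_; _<_; z≤n; s≤s; _%_)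
  open import Data.Nat.Coprimality as Coprimality using (Coprime)
  import Data.Nat.Divisibility as ℕ
  import Data.Nat.DivMod as ℕ
  open import Data.Nat.Divisibility using (_∣_; _∤_)
  open import Data.Nat.Primality hiding (prime)
  import Data.Nat.Properties as ℕ
  open import Data.Product.Base using (_×_; _,_)
  open import Data.Rational.Base using (0ℚ; 1ℚ; _+_; _*_; -_; _-_; _/_)
  open import Data.Rational.Properties
  open import Data.Rational.Solver using (module +-*-Solver)
  open import Function.Base using (case_of_)
  open import Relation.Nullary.Decidable using (Dec; yes; no; map′; ¬?; _×-dec_; decidable-stable; from-yes)
  open import Relation.Nullary.Negation using (¬_; contradiction)

  ≈? : ∀ a b n → Dec (a ≈ b [ n ])
  ≈? a b n = map′ ∣⇒≈ ≈⇒∣ (n ℕ.∣? ℤ.∣ a ℤ.- b ∣)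

  module ModuloPrime {q} (pr : Prime (suc q)) (3≤p : 3 ≤ suc q) where

    open Local pr

    private
      p = suc q

      instance
        q≢0 : NonZero q
        q≢0 = ℕ.>-nonZero (ℕ.≤-trans (s≤s z≤n) (ℕ.≤-pred 3≤p))

    ∣ℚ⇒≈0 : ∀ a → p ^ 1 ∣ℚ ι a → a ≈ 0ℤ [ p ]
    ∣ℚ⇒≈0 a p∣a = ∣⇒≈0 (subst (_∣ ℤ.∣ a ∣) (ℕ.*-identityʳ p) (ι-∣ℚ {1} a p∣a))

    ≈0⇒∣ℚ : ∀ a → a ≈ 0ℤ [ p ] → p ^ 1 ∣ℚ ι a
    ≈0⇒∣ℚ a a≈0 = ∣ℚ-ι {1} a (subst (_∣ ℤ.∣ a ∣) (sym (ℕ.*-identityʳ p)) (≈0⇒∣ a≈0))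

    ≈0⇒∣ℚ² : ∀ a → a ≈ 0ℤ [ p ℕ.* p ] → p ^ 2 ∣ℚ ι a
    ≈0⇒∣ℚ² a a≈0 = ∣ℚ-ι {2} a (subst (λ z → p ℕ.* z ∣ ℤ.∣ a ∣) (sym (ℕ.*-identityʳ p)) (≈0⇒∣ a≈0))

    1≉0 : ¬ 1ℤ ≈ 0ℤ [ p ]
    1≉0 1≈0 = p∤1 (≈0⇒∣ 1≈0)

    -- Modulo p the power sum is p B n. With the converse that follows, p-integrality of B n becomes
    -- a question about power sums.
    B-integral⇒powerSum≈0 : ∀ n → p ^ 0 ∣ℚ B n → powerSum p n ≈ 0ℤ [ p ]
    B-integral⇒powerSum≈0 n p^0∣B = ∣ℚ⇒≈0 (powerSum p n) (subst (p ^ 1 ∣ℚ_) (lemma (ι (powerSum p n)) (pB n))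
      (∣ℚ-+ (powerSum-pB 3≤p n) (∣ℚ-* {1} {k = 0} ∣ℚ-p p^0∣B)))
      where
      lemma : ∀ x y → x - y + y ≡ x
      lemma = solve 2 (λ x y → x :- y :+ y := x) refl
        where open +-*-Solver

    powerSum≈0⇒B-integral : ∀ n → powerSum p n ≈ 0ℤ [ p ] → p ^ 0 ∣ℚ B n
    powerSum≈0⇒B-integral n S≈0 = ∣ℚ-cancel-p {0} (∣ℚ-subtrahend (≈0⇒∣ℚ (powerSum p n) S≈0) (powerSum-pB 3≤p n))

    -- If every unit were an l-th root of unity, powerSum p l would be - 1 and not 0 modulo p.
    ∃-nonroot : ∀ l .{{_ : NonZero l}} → l < q → ∃[ k ] (¬ + k ≈ 0ℤ [ p ] × ¬ (+ k) ℤ.^ l ≈ 1ℤ [ p ])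
    ∃-nonroot l l<q with ℕ.anyUpTo? (λ k → ¬? (k ℕ.≟ 0) ×-dec ¬? (≈? ((+ k) ℤ.^ l) 1ℤ p)) p
    ... | yes (k , k<p , k≢0 , k^l≉1) = k , pos≉0 k<p k≢0 , k^l≉1
    ... | no  none = contradiction (≈-neg (≈-trans (≈-sym S≈-1) (B-integral⇒powerSum≈0 l (B-integral-small l (s≤s l<q))))) 1≉0
      where
      S≈-1 : powerSum p l ≈ ℤ.- 1ℤ [ p ]
      S≈-1 = powerSum≈-1 l (λ k k≢0 k<p → decidable-stable (≈? ((+ k) ℤ.^ l) 1ℤ p) (λ k^l≉1 → none (k , k<p , k≢0 , k^l≉1)))

    ^-periodic : ∀ a l t → ¬ a ≈ 0ℤ [ p ] → a ℤ.^ (l ℕ.+ q ℕ.* t) ≈ a ℤ.^ l [ p ]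
    ^-periodic a l t a≉0 = begin
      a ℤ.^ (l ℕ.+ q ℕ.* t)             ≡⟨ ℤ.^-distribˡ-+-* a l (q ℕ.* t) ⟩
      a ℤ.^ l ℤ.* a ℤ.^ (q ℕ.* t)       ≡⟨ cong (a ℤ.^ l ℤ.*_) (ℤ.^-*-assoc a q t) ⟨
      a ℤ.^ l ℤ.* (a ℤ.^ q) ℤ.^ t       ≈⟨ ≈-* (≈-refl {a ℤ.^ l}) (≈-^ t (fermat pr a a≉0)) ⟩
      a ℤ.^ l ℤ.* 1ℤ ℤ.^ t              ≡⟨ cong (a ℤ.^ l ℤ.*_) (ℤ.^-zeroˡ t) ⟩
      a ℤ.^ l ℤ.* 1ℤ                    ≡⟨ ℤ.*-identityʳ (a ℤ.^ l) ⟩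
      a ℤ.^ l                           ∎
      where open import Relation.Binary.Reasoning.Setoid (≈-setoid p)

    %-split : ∀ n → n ≡ n % q ℕ.+ q ℕ.* (n ℕ./ q)
    %-split n = trans (ℕ.m≡m%n+[m/n]*n n q) (cong (n % q ℕ.+_) (ℕ.*-comm (n ℕ./ q) q))

    ^-% : ∀ a n → ¬ a ≈ 0ℤ [ p ] → a ℤ.^ n ≈ a ℤ.^ (n % q) [ p ]
    ^-% a n a≉0 = ≈-trans (≈-reflexive (cong (a ℤ.^_) (%-split n))) (^-periodic a (n % q) (n ℕ./ q) a≉0)

    ∃-nonroot′ : ∀ n → q ∤ n → ∃[ k ] (¬ + k ≈ 0ℤ [ p ] × ¬ (+ k) ℤ.^ n ≈ 1ℤ [ p ])
    ∃-nonroot′ n q∤n with ∃-nonroot (n % q) {{ℕ.≢-nonZero (λ n%q≡0 → q∤n (ℕ.m%n≡0⇒n∣m n q n%q≡0))}} (ℕ.m%n<n n q)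
    ... | k , k≉0 , k^l≉1 = k , k≉0 , λ k^n≈1 → k^l≉1 (≈-trans (≈-sym (^-% (+ k) n k≉0)) k^n≈1)

    ≉1⇒coprime : ∀ {a} → ¬ a ≈ 1ℤ [ p ] → Coprime p ℤ.∣ a ℤ.- 1ℤ ∣
    ≉1⇒coprime a≉1 = ∤⇒coprime pr (λ p∣a-1 → a≉1 (∣⇒≈ p∣a-1))

    powerSum≈0-∤ : ∀ n → q ∤ n → powerSum p n ≈ 0ℤ [ p ]
    powerSum≈0-∤ n q∤n = case ∃-nonroot′ n q∤n of λ
      { (k , k≉0 , k^n≉1) → powerSum≈0 {a = + k} n (≉0⇒coprime pr k≉0) (≉1⇒coprime k^n≉1) (≈-^ n) }

    -- The factor p in the exponent makes powers of residues modulo p well defined modulo p². By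
    -- Fermat's theorem k ^ (n p) ≡ k ^ n modulo p, so k ^ (n p) - 1 is still prime to p and hence a
    -- unit modulo p².
    powerSum≈0-∤² : ∀ n → q ∤ n → powerSum p (n ℕ.* p) ≈ 0ℤ [ p ℕ.* p ]
    powerSum≈0-∤² n q∤n = case ∃-nonroot′ n q∤n of λ
      { (k , k≉0 , k^n≉1) → powerSum≈0 {a = + k} (n ℕ.* p) (≉0⇒coprime pr k≉0)
        (coprime-* (coprime k k≉0 k^n≉1) (coprime k k≉0 k^n≉1)) ^-cong }
      where
      np≡ : n ℕ.* p ≡ n ℕ.+ q ℕ.* n
      np≡ = trans (ℕ.*-suc n q) (cong (n ℕ.+_) (ℕ.*-comm n q))
      coprime : ∀ k → ¬ + k ≈ 0ℤ [ p ] → ¬ (+ k) ℤ.^ n ≈ 1ℤ [ p ] → Coprime p ℤ.∣ (+ k) ℤ.^ (n ℕ.* p) ℤ.- 1ℤ ∣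
      coprime k k≉0 k^n≉1 = ≉1⇒coprime {(+ k) ℤ.^ (n ℕ.* p)} λ k^np≈1 →
        k^n≉1 (≈-trans (≈-sym (^-periodic (+ k) n n k≉0)) (subst (λ e → (+ k) ℤ.^ e ≈ 1ℤ [ p ]) np≡ k^np≈1))
      ^-cong : ∀ {x y} → x ≈ y [ p ] → x ℤ.^ (n ℕ.* p) ≈ y ℤ.^ (n ℕ.* p) [ p ℕ.* p ]
      ^-cong {x} {y} x≈y = subst₂ (λ u v → u ≈ v [ p ℕ.* p ]) (rearr x) (rearr y) (≈-^ n (^-lift x≈y))
        where
        rearr : ∀ x → (x ℤ.^ p) ℤ.^ n ≡ x ℤ.^ (n ℕ.* p)
        rearr x = trans (ℤ.^-*-assoc x p n) (cong (x ℤ.^_) (ℕ.*-comm p n))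

    powerSum≈-1-∣ : ∀ n .{{_ : NonZero n}} → q ∣ n → powerSum p n ≈ ℤ.- 1ℤ [ p ]
    powerSum≈-1-∣ n q∣n = powerSum≈-1 n λ k k≢0 k<p →
      subst (λ e → (+ k) ℤ.^ n ≈ (+ k) ℤ.^ e [ p ]) (ℕ.n∣m⇒m%n≡0 n q q∣n) (^-% (+ k) n (pos≉0 k<p k≢0))

    B-integral : ∀ n → q ∤ n → p ^ 0 ∣ℚ B n
    B-integral n q∤n = powerSum≈0⇒B-integral n (powerSum≈0-∤ n q∤n)

    -- Integrality would make the power sum 0 modulo p, but every unit is an n-th root of unity and
    -- the power sum is - 1.
    vonStaudt : ∀ n .{{_ : NonZero n}} → q ∣ n → ¬ p ^ 0 ∣ℚ B n
    vonStaudt n q∣n p^0∣B = 1≉0 (≈-neg (≈-trans (≈-sym (powerSum≈-1-∣ n q∣n)) (B-integral⇒powerSum≈0 n p^0∣B)))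

  -- Since 3 - 1 divides every even m, the prime 3 occurs in the denominator of B m, while 0 is
  -- 3-integral.
  B≢0 : ∀ m .{{_ : NonZero m}} → 2 ∣ m → B m ≢ 0ℚ
  B≢0 m 2∣m B≡0 = vonStaudt m 2∣m (subst (3 ^ 0 ∣ℚ_) (sym B≡0) ∣ℚ-0)
    where
    prime[3] : Prime 3
    prime[3] = from-yes (prime? 3)
    open ModuloPrime prime[3] ℕ.≤-refl
    open Local prime[3]

  module Irregularity {q} (pr : Prime (suc q)) (5≤p : 5 ≤ suc q) (2∣q : 2 ∣ q) where

    open Local pr
    3≤p : 3 ≤ suc q
    3≤p = ℕ.≤-trans (s≤s (s≤s (s≤s z≤n))) 5≤p
    open ModuloPrime pr 3≤p
    private
      p = suc q

    instance
      q≢0 : NonZero q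
      q≢0 = ℕ.>-nonZero (ℕ.≤-trans (s≤s z≤n) (ℕ.≤-pred 3≤p))

    -- Kummer's congruence B m / m ≡ B l / l modulo p, simplified by m ≡ 1.
    kummer : ∀ m l t .{{_ : NonZero m}} .{{_ : NonZero l}} → 2 ∣ m → l < q → m ≡ l ℕ.+ q ℕ.* t → + m ≈ 1ℤ [ p ] →
             p ^ 1 ∣ℚ ι (+ l) * B m - B l
    kummer m@(suc m-1) l@(suc l-1) t 2∣m l<q m≡l+qt m≈1 =
      subst (p ^ 1 ∣ℚ_) (ring₁ (ι (+ l)) (ι (+ t)) (B m) (B l))
        (∣ℚ-+ (∣ℚ-cancel-p {1} (subst (p ^ 2 ∣ℚ_) (ring₂ (ι (+ p)) (ι (+ l)) (ι (+ t)) (B m) (B l) (ι Sm) (ι Sl)) scaled))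
              (∣ℚ-* {1} {k = 0} coefficient (B-integral-small l (s≤s l<q))))
      where
      open +-*-Solver
      Sm = powerSum p m
      Sl = powerSum p l

      q∤l : q ∤ l
      q∤l = ℕ.>⇒∤ l<q

      -- As m and q are even, q cannot divide m - 1. So B (m - 1) is p-integral, as `powerSum-pB²`
      -- requires.
      q∤m-1 : q ∤ m-1
      q∤m-1 q∣m-1 = p∤1′ (ℕ.∣m+n∣m⇒∣n (subst (2 ∣_) (ℕ.+-comm 1 m-1) 2∣m) (ℕ.∣-trans 2∣q q∣m-1))
        where
        p∤1′ : 2 ∤ 1
        p∤1′ = ℕ.>⇒∤ ℕ.≤-refl

      -- By interpolation E is congruent to t S (l p) modulo p², and S (l p) vanishes there.
      E : ℤ
      E = + l ℤ.* Sm ℤ.+ + t ℤ.* Sl ℤ.+ ℤ.- (+ l ℤ.* Sl)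

      E≈0 : E ≈ 0ℤ [ p ℕ.* p ]
      E≈0 = begin
        + l ℤ.* Sm ℤ.+ + t ℤ.* Sl ℤ.+ ℤ.- (+ l ℤ.* Sl)
          ≡⟨ cong (λ n → + l ℤ.* powerSum p n ℤ.+ + t ℤ.* Sl ℤ.+ ℤ.- (+ l ℤ.* Sl)) m≡l+qt ⟩
        + l ℤ.* powerSum p (l ℕ.+ q ℕ.* t) ℤ.+ + t ℤ.* Sl ℤ.+ ℤ.- (+ l ℤ.* Sl)
          ≈⟨ ≈-+ (powerSum-interpolation pr l t) (≈-refl {ℤ.- (+ l ℤ.* Sl)}) ⟩
        + l ℤ.* Sl ℤ.+ + t ℤ.* powerSum p (l ℕ.* p) ℤ.+ ℤ.- (+ l ℤ.* Sl)
          ≈⟨ ≈-+ (≈-+ (≈-refl {+ l ℤ.* Sl}) (≈-* (≈-refl {+ t}) (powerSum≈0-∤² l q∤l))) (≈-refl {ℤ.- (+ l ℤ.* Sl)}) ⟩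
        + l ℤ.* Sl ℤ.+ + t ℤ.* 0ℤ ℤ.+ ℤ.- (+ l ℤ.* Sl)
          ≡⟨ cong (λ z → + l ℤ.* Sl ℤ.+ z ℤ.+ ℤ.- (+ l ℤ.* Sl)) (ℤ.*-zeroʳ (+ t)) ⟩
        + l ℤ.* Sl ℤ.+ 0ℤ ℤ.+ ℤ.- (+ l ℤ.* Sl)
          ≡⟨ cong (ℤ._+ ℤ.- (+ l ℤ.* Sl)) (ℤ.+-identityʳ (+ l ℤ.* Sl)) ⟩
        + l ℤ.* Sl ℤ.+ ℤ.- (+ l ℤ.* Sl)
          ≡⟨ ℤ.+-inverseʳ (+ l ℤ.* Sl) ⟩
        0ℤ ∎
        where open import Relation.Binary.Reasoning.Setoid (≈-setoid (p ℕ.* p))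

      ι-E : ι E ≡ ι (+ l) * ι Sm + ι (+ t) * ι Sl + - (ι (+ l) * ι Sl)
      ι-E = trans (ι-+ (+ l ℤ.* Sm ℤ.+ + t ℤ.* Sl) (ℤ.- (+ l ℤ.* Sl)))
                  (cong₂ _+_ (trans (ι-+ (+ l ℤ.* Sm) (+ t ℤ.* Sl)) (cong₂ _+_ (ι-* (+ l) Sm) (ι-* (+ t) Sl)))
                             (trans (ι-neg (+ l ℤ.* Sl)) (cong -_ (ι-* (+ l) Sl))))

      -- The added multiples of S m - p B m and S l - p B l replace the power sums in E by Bernoulli
      -- numbers; what remains is p (l B m + t B l - l B l).
      scaled : p ^ 2 ∣ℚ ι (+ l) * ι Sm + ι (+ t) * ι Sl + - (ι (+ l) * ι Sl)
                        + (- (ι (+ l) * (ι Sm - pB m)) + (ι (+ l) + - ι (+ t)) * (ι Sl - pB l))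
      scaled = ∣ℚ-+ (subst (p ^ 2 ∣ℚ_) ι-E (≈0⇒∣ℚ² E E≈0))
        (∣ℚ-+ (∣ℚ-neg (∣ℚ-* {0} (∣ℚ-integer (+ l)) (powerSum-pB² 5≤p m-1 (B-integral m-1 q∤m-1))))
              (∣ℚ-* {0} (∣ℚ-+ (∣ℚ-integer (+ l)) (∣ℚ-neg (∣ℚ-integer (+ t))))
                        (powerSum-pB² 5≤p l-1 (B-integral-small l-1 (ℕ.<-trans l<q ℕ.≤-refl)))))

      ring₂ : ∀ P L T Bm Bl Sm Sl →
        L * Sm + T * Sl + - (L * Sl) + (- (L * (Sm - P * Bm)) + (L + - T) * (Sl - P * Bl))
          ≡ P * (L * Bm + T * Bl - L * Bl)
      ring₂ = solve 7 (λ P L T Bm Bl Sm Sl →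
        L :* Sm :+ T :* Sl :+ :- (L :* Sl) :+ (:- (L :* (Sm :- P :* Bm)) :+ (L :+ :- T) :* (Sl :- P :* Bl))
          := P :* (L :* Bm :+ T :* Bl :- L :* Bl)) refl

      ring₁ : ∀ L T Bm Bl → L * Bm + T * Bl - L * Bl + (L + - T + - 1ℚ) * Bl ≡ L * Bm - Bl
      ring₁ = solve 4 (λ L T Bm Bl → L :* Bm :+ T :* Bl :- L :* Bl :+ (L :+ :- T :+ :- con 1ℚ) :* Bl := L :* Bm :- Bl) refl

      -- From m = l + q t, q ≡ - 1 and m ≡ 1 it follows that l - t ≡ 1, so l B m ≡ (l - t) B l
      -- becomes l B m ≡ B l.
      coefficient : p ^ 1 ∣ℚ ι (+ l) + - ι (+ t) + - 1ℚ
      coefficient = subst (p ^ 1 ∣ℚ_) ι-eq (≈0⇒∣ℚ (+ l ℤ.+ ℤ.- + t ℤ.+ ℤ.- 1ℤ) (begin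
        + l ℤ.+ ℤ.- + t ℤ.+ ℤ.- 1ℤ                         ≈⟨ (ℤ.- + t , ring₃ (+ l) (+ q) (+ t)) ⟩
        + l ℤ.+ + q ℤ.* + t ℤ.+ ℤ.- 1ℤ                     ≡⟨ cong (ℤ._+ ℤ.- 1ℤ) (trans (cong +_ m≡l+qt) (trans (ℤ.pos-+ l (q ℕ.* t)) (cong (ℤ._+_ (+ l)) (ℤ.pos-* q t)))) ⟨
        + m ℤ.+ ℤ.- 1ℤ                                     ≈⟨ ≈-+ m≈1 (≈-refl {ℤ.- 1ℤ}) ⟩
        0ℤ                                                 ∎))
        where
        open import Relation.Binary.Reasoning.Setoid (≈-setoid p)
        open import Data.Integer.Tactic.RingSolver using (solve-∀)
        ring₃ : ∀ l q t → l ℤ.+ ℤ.- t ℤ.+ ℤ.- 1ℤ ≡ l ℤ.+ q ℤ.* t ℤ.+ ℤ.- 1ℤ ℤ.+ ℤ.- t ℤ.* (1ℤ ℤ.+ q)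
        ring₃ = solve-∀
        ι-eq : ι (+ l ℤ.+ ℤ.- + t ℤ.+ ℤ.- 1ℤ) ≡ ι (+ l) + - ι (+ t) + - 1ℚ
        ι-eq = trans (ι-+ (+ l ℤ.+ ℤ.- + t) (ℤ.- 1ℤ)) (cong (_+ - 1ℚ) (trans (ι-+ (+ l) (ℤ.- + t)) (cong (_+_ (ι (+ l))) (ι-neg (+ t)))))

-- From divisibility of B m to irregular pairs

module IrregularPairs where

  open BinomialConvolution
  open Congruences
  open LocalDivisibility
  open KummerCongruence
  open import Data.Integer.Base as ℤ using (ℤ; +_; 1ℤ)
  import Data.Integer.Properties as ℤ
  open import Data.Nat.Base as ℕ using (ℕ; zero; suc; 2+; NonZero; _≤_; _<_; z≤n; s≤s; _%_; _*_; _+_)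
  open import Data.Nat.Divisibility
  open import Data.Nat.DivMod using (m%n<n; _/_)
  open import Data.Nat.Primality hiding (prime)
  open import Data.Nat.Properties
  open import Data.Product.Base using (_×_; _,_)
  open import Data.Sum.Base using (_⊎_; inj₁; inj₂)
  open import Data.Rational.Base as ℚ using (ℚ; 1ℚ; ↥_)
  import Data.Rational.Properties as ℚ
  open import Data.Rational.Solver using (module +-*-Solver)
  open import Data.Fin.Base using (zero; suc)
  open import Relation.Nullary.Negation using (contradiction)

  2∣n⊎2∣1+n : ∀ n → 2 ∣ n ⊎ 2 ∣ suc n
  2∣n⊎2∣1+n zero    = inj₁ (2 ∣0)
  2∣n⊎2∣1+n (suc n) with 2∣n⊎2∣1+n n
  ... | inj₁ 2∣n   = inj₂ (∣m∣n⇒∣m+n (∣-refl {2}) 2∣n)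
  ... | inj₂ 2∣1+n = inj₁ 2∣1+n

  odd-prime⇒2∣q : ∀ {q} → Prime (suc q) → suc q ≢ 2 → 2 ∣ q
  odd-prime⇒2∣q {q} pr p≢2 with 2∣n⊎2∣1+n q
  ... | inj₁ 2∣q = 2∣q
  ... | inj₂ 2∣p with prime⇒irreducible pr 2∣p
  ...   | inj₂ 2≡p = contradiction (sym 2≡p) p≢2

  *-÷ℕ : ∀ x m .{{_ : NonZero m}} → ι (+ m) ℚ.* (x ÷ℕ m) ≡ x
  *-÷ℕ x m = begin
    ι (+ m) ℚ.* (x ÷ℕ m)               ≡⟨ ℚ.*-comm (ι (+ m)) (x ÷ℕ m) ⟩
    x ÷ℕ m ℚ.* ι (+ m)                 ≡⟨ ℚ.*-assoc x _ _ ⟩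
    x ℚ.* (1ℤ ℚ./ m ℚ.* ι (+ m))       ≡⟨ cong (x ℚ.*_) (trans (ℚ.*-comm (1ℤ ℚ./ m) (ι (+ m))) (n/1*1/n m)) ⟩
    x ℚ.* 1ℚ                           ≡⟨ ℚ.*-identityʳ x ⟩
    x                                  ∎
    where open ≡-Reasoning

  module _ {q} (pr : Prime (suc q)) (5≤p : 5 ≤ suc q) where

    private
      p = suc q
      2∣q : 2 ∣ q
      2∣q = odd-prime⇒2∣q pr λ p≡2 → <⇒≱ (s≤s (s≤s (s≤s z≤n))) (subst (5 ≤_) p≡2 5≤p)

    open Local pr
    open Irregularity pr 5≤p 2∣q
    open ModuloPrime pr 3≤p

    ∣B⇒irregular : ∀ m .{{_ : NonZero m}} → 2 ∣ m → + m ≈ 1ℤ [ p ] → p ∣ ℤ.∣ ↥ B m ∣ → IrregularPair p (m % q)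
    ∣B⇒irregular m 2∣m m≈1 p∣Bm = record
      { prime = pr
      ; odd   = λ p≡2 → <⇒≱ (s≤s (s≤s (s≤s z≤n))) (subst (5 ≤_) p≡2 5≤p)
      ; even  = 2∣l
      ; 2≤l   = ∣⇒≤ 2∣l
      ; l≤p-3 = subst (_≤ p) (+-comm 3 (m % q)) (s≤s 2+l≤q)
      ; p∣B   = ∣ℚ⇒∣↥ (subst (p ^ 1 ∣ℚ_) (lemma (ι (+ (m % q)) ℚ.* B m) (B (m % q)))
          (∣ℚ-+ (∣ℚ-* {0} {k = 1} (∣ℚ-integer (+ (m % q))) p^1∣Bm)
                (∣ℚ-neg (kummer m (m % q) (m / q) 2∣m l<q (%-split m) m≈1))))
      }
      where
      p^1∣Bm : p ^ 1 ∣ℚ B m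
      p^1∣Bm = ∣↥⇒∣ℚ p∣Bm
      q∤m : q ∤ m
      q∤m q∣m = vonStaudt m q∣m (∣ℚ-weaken {0} z≤n p^1∣Bm)
      instance
        l≢0 : NonZero (m % q)
        l≢0 = ℕ.≢-nonZero (λ m%q≡0 → q∤m (m%n≡0⇒n∣m m q m%q≡0))
      l<q : m % q < q
      l<q = m%n<n m q
      2∣l : 2 ∣ m % q
      2∣l = %-presˡ-∣ 2∣m 2∣q
      -- The bound l ≤ p - 3 is one stronger than l < q; the remaining case l = q - 1 is odd.
      2+l≤q : 2+ (m % q) ≤ q
      2+l≤q with m≤n⇒m<n∨m≡n l<q
      ... | inj₁ 2+l≤q = 2+l≤q
      ... | inj₂ 1+l≡q = contradiction (∣m+n∣m⇒∣n (subst (2 ∣_) (trans (sym 1+l≡q) (+-comm 1 (m % q))) 2∣q) 2∣l) (>⇒∤ ≤-refl)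
      lemma : ∀ x y → x ℚ.+ ℚ.- (x ℚ.- y) ≡ y
      lemma = solve 2 (λ x y → x :+ :- (x :- y) := y) refl
        where open +-*-Solver

    irregular⇒∣B : ∀ m .{{_ : NonZero m}} → 2 ∣ m → + m ≈ 1ℤ [ p ] → IrregularPair p (m % q) → p ∣ ℤ.∣ ↥ B m ∣
    irregular⇒∣B m 2∣m m≈1 irr = ∣ℚ⇒∣↥ (∣ℚ-cancel-unit l (>⇒∤ (<-trans l<q ≤-refl))
      (subst (p ^ 1 ∣ℚ_) (lemma (ι (+ l) ℚ.* B m) (B l)) (∣ℚ-+ (kummer m l (m / q) 2∣m l<q (%-split m) m≈1) (∣↥⇒∣ℚ p∣B))))
      where
      open IrregularPair irr
      l = m % q
      instance
        l≢0 : NonZero l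
        l≢0 = ℕ.>-nonZero (<-trans (s≤s z≤n) 2≤l)
      l<q : l < q
      l<q = m%n<n m q
      lemma : ∀ x y → x ℚ.- y ℚ.+ y ≡ x
      lemma = solve 2 (λ x y → x :- y :+ y := x) refl
        where open +-*-Solver

    ∣B/m⇔∣B : ∀ m .{{_ : NonZero m}} → + m ≈ 1ℤ [ p ] →
      (p ∣ ℤ.∣ ↥ (B m ÷ℕ m) ∣ → p ∣ ℤ.∣ ↥ B m ∣) × (p ∣ ℤ.∣ ↥ B m ∣ → p ∣ ℤ.∣ ↥ (B m ÷ℕ m) ∣)
    ∣B/m⇔∣B m m≈1 =
      (λ p∣x → ∣ℚ⇒∣↥ (subst (p ^ 1 ∣ℚ_) (*-÷ℕ (B m) m) (∣ℚ-* {0} (∣ℚ-integer (+ m)) (∣↥⇒∣ℚ p∣x)))) ,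
      (λ p∣B → ∣ℚ⇒∣↥ (∣ℚ-cancel-unit m p∤m (subst (p ^ 1 ∣ℚ_) (sym (*-÷ℕ (B m) m)) (∣↥⇒∣ℚ p∣B))))
      where
      p∤m : p ∤ m
      p∤m p∣m = 1≉0 (≈-trans (≈-sym m≈1) (∣⇒≈0 p∣m))

-- The quotient of numerators as a system of congruences

module LambdaSolutions where

  open BinomialConvolution
  open Congruences
  open LocalDivisibility using (↧*≡↥; ι-*ℕ)
  open KummerCongruence
  open IrregularPairs
  open import Data.Integer.Base as ℤ using (ℤ; +_; 0ℤ; 1ℤ)
  import Data.Integer.Divisibility.Signed as S
  import Data.Integer.Properties as ℤ
  open import Data.Nat.Base as ℕ using (ℕ; zero; suc; 2+; NonZero; _≤_; _<_; z≤n; s≤s; _∸_; _%_; _*_; _+_)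
  open import Data.Nat.Coprimality as Coprimality using (Coprime; coprime-divisor; coprime-factors)
  open import Data.Nat.Divisibility
  open import Data.Nat.DivMod using (m%n<n; _/_; m≡m%n+[m/n]*n)
  open import Data.Nat.Primality hiding (prime)
  open import Data.Nat.Properties
  open import Data.Product.Base using (_×_; _,_; proj₁; proj₂)
  open import Data.Sum.Base using (inj₁; inj₂)
  open import Data.Rational.Base as ℚ using (ℚ; 0ℚ; ↥_; ↧_; ↧ₙ_; mkℚ)
  import Data.Rational.Properties as ℚ
  open import Data.Rational.Solver using (module +-*-Solver)
  open import Data.Vec.Functional using (Vector)
  open import Data.Fin.Base using (Fin; zero; suc)
  import Data.Fin.Properties as Fin
  open import Function.Base using (_∘_)
  open import Function.Definitions using (Injective)
  open import Relation.Nullary.Negation using (contradiction)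

  coprime-↥-↧ : ∀ x → Coprime ℤ.∣ ↥ x ∣ (↧ₙ x)
  coprime-↥-↧ (mkℚ n d-1 coprime) = Coprimality.recompute coprime

  module _ (k : ℕ) where

    private
      m = 2+ k
      n = suc k
      x = B m ÷ℕ m
      y = B m ÷ℕ (m * n)

    x≡ny : x ≡ ι (+ n) ℚ.* y
    x≡ny = *-cancelˡ-ι m (begin
      ι (+ m) ℚ.* x                        ≡⟨ cancel (B m) m ⟩
      B m                                  ≡⟨ cancel (B m) (m * n) ⟨
      ι (+ (m * n)) ℚ.* y                  ≡⟨ cong (ℚ._* y) (ι-*ℕ m n) ⟩
      ι (+ m) ℚ.* ι (+ n) ℚ.* y            ≡⟨ ℚ.*-assoc (ι (+ m)) (ι (+ n)) y ⟩
      ι (+ m) ℚ.* (ι (+ n) ℚ.* y)          ∎)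
      where
      open ≡-Reasoning
      cancel : ∀ x m .{{_ : NonZero m}} → ι (+ m) ℚ.* (x ÷ℕ m) ≡ x
      cancel = *-÷ℕ

    -- This is x = (m - 1) y cleared of denominators. Signs are dropped because only divisibility
    -- matters from here on.
    cross : ℤ.∣ ↥ x ∣ * ↧ₙ y ≡ n * (ℤ.∣ ↥ y ∣ * ↧ₙ x)
    cross = begin
      ℤ.∣ ↥ x ∣ * ↧ₙ y                     ≡⟨ ℤ.abs-* (↥ x) (↧ y) ⟨
      ℤ.∣ ↥ x ℤ.* ↧ y ∣                    ≡⟨ cong ℤ.∣_∣ (ι-injective {↥ x ℤ.* ↧ y} {+ n ℤ.* (↥ y ℤ.* ↧ x)} eq) ⟩
      ℤ.∣ + n ℤ.* (↥ y ℤ.* ↧ x) ∣          ≡⟨ trans (ℤ.abs-* (+ n) (↥ y ℤ.* ↧ x)) (cong (n *_) (ℤ.abs-* (↥ y) (↧ x))) ⟩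
      n * (ℤ.∣ ↥ y ∣ * ↧ₙ x)               ∎
      where
      open ≡-Reasoning
      eq : ι (↥ x ℤ.* ↧ y) ≡ ι (+ n ℤ.* (↥ y ℤ.* ↧ x))
      eq = begin
        ι (↥ x ℤ.* ↧ y)                                  ≡⟨ ι-* (↥ x) (↧ y) ⟩
        ι (↥ x) ℚ.* ι (↧ y)                              ≡⟨ cong (ℚ._* ι (↧ y)) (↧*≡↥ x) ⟨
        ι (↧ x) ℚ.* x ℚ.* ι (↧ y)                        ≡⟨ cong (λ z → ι (↧ x) ℚ.* z ℚ.* ι (↧ y)) x≡ny ⟩
        ι (↧ x) ℚ.* (ι (+ n) ℚ.* y) ℚ.* ι (↧ y)          ≡⟨ rearrange (ι (↧ x)) (ι (+ n)) y (ι (↧ y)) ⟩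
        ι (+ n) ℚ.* (ι (↧ y) ℚ.* y ℚ.* ι (↧ x))          ≡⟨ cong (λ z → ι (+ n) ℚ.* (z ℚ.* ι (↧ x))) (↧*≡↥ y) ⟩
        ι (+ n) ℚ.* (ι (↥ y) ℚ.* ι (↧ x))                ≡⟨ trans (ι-* (+ n) (↥ y ℤ.* ↧ x)) (cong (ι (+ n) ℚ.*_) (ι-* (↥ y) (↧ x))) ⟨
        ι (+ n ℤ.* (↥ y ℤ.* ↧ x))                        ∎
        where
        rearrange : ∀ D n y E → D ℚ.* (n ℚ.* y) ℚ.* E ≡ n ℚ.* (E ℚ.* y ℚ.* D)
        rearrange = solve 4 (λ D n y E → D :* (n :* y) :* E := n :* (E :* y :* D)) refl
          where open +-*-Solver

    ↥y≢0 : 2 ∣ m → ↥ y ≢ 0ℤ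
    ↥y≢0 2∣m ↥y≡0 = B≢0 m 2∣m (begin
      B m                     ≡⟨ *-÷ℕ (B m) (m * n) ⟨
      ι (+ (m * n)) ℚ.* y     ≡⟨ cong (ι (+ (m * n)) ℚ.*_) (ℚ.↥p≡0⇒p≡0 y ↥y≡0) ⟩
      ι (+ (m * n)) ℚ.* 0ℚ    ≡⟨ ℚ.*-zeroʳ (ι (+ (m * n))) ⟩
      0ℚ                      ∎)
      where open ≡-Reasoning

    quotient-relation : ∀ q → ↥ y ≢ 0ℤ → ↥ x ≡ q ℤ.* ↥ y → ℤ.∣ q ∣ * ↧ₙ y ≡ n * ↧ₙ x
    quotient-relation q ↥y≢0 ↥x≡q↥y = *-cancelˡ-≡ _ _ Y {{ℤ.≢-nonZero ↥y≢0}} (begin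
      Y * (ℤ.∣ q ∣ * ↧ₙ y)           ≡⟨ ring₁ Y ℤ.∣ q ∣ (↧ₙ y) ⟩
      ℤ.∣ q ∣ * Y * ↧ₙ y             ≡⟨ cong (_* ↧ₙ y) (trans (cong ℤ.∣_∣ ↥x≡q↥y) (ℤ.abs-* q (↥ y))) ⟨
      ℤ.∣ ↥ x ∣ * ↧ₙ y               ≡⟨ cross ⟩
      n * (Y * ↧ₙ x)                 ≡⟨ ring₂ n Y (↧ₙ x) ⟩
      Y * (n * ↧ₙ x)                 ∎)
      where
      open ≡-Reasoning
      open import Data.Nat.Tactic.RingSolver using (solve-∀)
      Y = ℤ.∣ ↥ y ∣
      ring₁ : ∀ y q d → y * (q * d) ≡ q * y * d
      ring₁ = solve-∀
      ring₂ : ∀ n y d → n * (y * d) ≡ y * (n * d)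
      ring₂ = solve-∀

    -- The quotient of numerators is ± gcd (num (B m / m)) (m - 1).
    Λ-Solution⇒∣ : ∀ {c} → Λ-Solution c m → 2 ∣ m × c ∣ n × c ∣ ℤ.∣ ↥ x ∣
    Λ-Solution⇒∣ {c} (2∣m , q , ↥y≢0 , ↥x≡q↥y , c∣q) = 2∣m , c∣n , c∣x
      where
      c∣x : c ∣ ℤ.∣ ↥ x ∣
      c∣x = ∣-trans c∣q (subst (ℤ.∣ q ∣ ∣_) (sym (trans (cong ℤ.∣_∣ ↥x≡q↥y) (ℤ.abs-* q (↥ y)))) (m∣m*n ℤ.∣ ↥ y ∣))
      -- After cancelling the numerator of y, c divides (m - 1) times the denominator of x. That
      -- denominator is prime to c because c divides the numerator of x.
      c∣n : c ∣ n
      c∣n = coprime-divisor (λ (d∣c , d∣↧) → coprime-↥-↧ x (∣-trans d∣c c∣x , d∣↧))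
        (subst (c ∣_) (trans (quotient-relation q ↥y≢0 ↥x≡q↥y) (*-comm n (↧ₙ x))) (∣m⇒∣m*n (↧ₙ y) c∣q))

    -- The numerator of y divides that of x because it is prime to the denominator of y. Then c
    -- divides the quotient times the numerator of y as well as the quotient times the denominator
    -- of y, and these two factors are coprime.
    ∣⇒Λ-Solution : ∀ {c} → 2 ∣ m → c ∣ n → c ∣ ℤ.∣ ↥ x ∣ → Λ-Solution c m
    ∣⇒Λ-Solution {c} 2∣m c∣n c∣x = 2∣m , q , ↥y≢0 2∣m , ↥x≡q↥y , c∣q
      where
      y∣x : ℤ.∣ ↥ y ∣ ∣ ℤ.∣ ↥ x ∣
      y∣x = coprime-divisor (coprime-↥-↧ y)
        (subst (ℤ.∣ ↥ y ∣ ∣_) (trans (sym cross) (*-comm ℤ.∣ ↥ x ∣ (↧ₙ y))) (∣n⇒∣m*n n (m∣m*n (↧ₙ x))))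
      open S._∣_ (S.∣ᵤ⇒∣ {↥ y} {↥ x} y∣x) renaming (quotient to q; equality to ↥x≡q↥y)
      c∣q : c ∣ ℤ.∣ q ∣
      c∣q = coprime-factors (coprime-↥-↧ y)
        ( subst (c ∣_) (trans (cong ℤ.∣_∣ ↥x≡q↥y) (trans (ℤ.abs-* q (↥ y)) (*-comm ℤ.∣ q ∣ ℤ.∣ ↥ y ∣))) c∣x
        , subst (c ∣_) (trans (sym (quotient-relation q (↥y≢0 2∣m) ↥x≡q↥y)) (*-comm ℤ.∣ q ∣ (↧ₙ y))) (∣m⇒∣m*n (↧ₙ x) c∣n))

  Prime-family : ∀ {n} → Vector ℕ n → Set
  Prime-family p = Injective _≡_ _≡_ p × (∀ i → Prime (p i))

  tail-family : ∀ {n} {p : Vector ℕ (suc n)} → Prime-family p → Prime-family (p ∘ suc)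
  tail-family (injective , primes) = Fin.suc-injective ∘ injective , primes ∘ suc

  ∣-∏ : ∀ {n} (p : Vector ℕ n) i → p i ∣ ∏ p
  ∣-∏ p zero    = m∣m*n (∏ (p ∘ suc))
  ∣-∏ p (suc i) = ∣n⇒∣m*n (p zero) (∣-∏ (p ∘ suc) i)

  ∤-∏ : ∀ {n q} (p : Vector ℕ n) → Prime q → (∀ i → Prime (p i)) → (∀ i → q ≢ p i) → q ∤ ∏ p
  ∤-∏ {zero}  p pr primes q≢p q∣1 = ¬prime[1] (subst Prime (∣1⇒≡1 q∣1) pr)
  ∤-∏ {suc n} p pr primes q≢p q∣∏ with euclidsLemma (p zero) (∏ (p ∘ suc)) pr q∣∏
  ... | inj₂ q∣tail = ∤-∏ (p ∘ suc) pr (primes ∘ suc) (q≢p ∘ suc) q∣tail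
  ... | inj₁ q∣p₀ with prime⇒irreducible (primes zero) q∣p₀
  ...   | inj₁ refl = ¬prime[1] pr
  ...   | inj₂ q≡p₀ = q≢p zero q≡p₀

  coprime⇒*∣ : ∀ {m n z} → Coprime m n → m ∣ z → n ∣ z → m * n ∣ z
  coprime⇒*∣ {m} {n} m⊥n m∣z (divides k refl) = *-monoˡ-∣ n (coprime-divisor m⊥n (subst (m ∣_) (*-comm k n) m∣z))

  ∏-least : ∀ {n z} (p : Vector ℕ n) → Prime-family p → (∀ i → p i ∣ z) → ∏ p ∣ z
  ∏-least {zero}  {z} p family p∣z = 1∣ z
  ∏-least {suc n} p family@(injective , primes) p∣z = coprime⇒*∣
    (∤⇒coprime (primes zero) (∤-∏ (p ∘ suc) (primes zero) (primes ∘ suc) (λ i p₀≡pᵢ → Fin.0≢1+n (injective p₀≡pᵢ))))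
    (p∣z zero) (∏-least (p ∘ suc) (tail-family {p = p} family) (p∣z ∘ suc))

  -- The pair is not tied to the remainder of m modulo p - 1, but the bound l ≤ p - 3 makes `l` that
  -- remainder.
  Residue : ℕ → ℕ → Set
  Residue p m = + m ≈ 1ℤ [ p ] × (∃[ l ] (IrregularPair p l × + m ≈ + l [ p ∸ 1 ]))

  Solution : ∀ {n} → Vector ℕ n → ℕ → Set
  Solution p m = 2 ≤ m × 2 ∣ m × (∀ i → Residue (p i) m)

  irregular⇒5≤ : ∀ {p l} → IrregularPair p l → 5 ≤ p
  irregular⇒5≤ irr = ≤-trans (+-monoˡ-≤ 3 (IrregularPair.2≤l irr)) (IrregularPair.l≤p-3 irr)

  %-≈ : ∀ m q .{{_ : NonZero q}} → + m ≈ + (m % q) [ q ]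
  %-≈ m q = + (m / q) , trans (cong +_ (m≡m%n+[m/n]*n m q)) (trans (ℤ.pos-+ (m % q) (m / q * q)) (cong (ℤ._+_ (+ (m % q))) (ℤ.pos-* (m / q) q)))

  ∣B/m⇒residue : ∀ {p m} .{{_ : NonZero m}} → Prime p → 5 ≤ p → 2 ∣ m → + m ≈ 1ℤ [ p ] → p ∣ ℤ.∣ ↥ (B m ÷ℕ m) ∣ → Residue p m
  ∣B/m⇒residue {suc q@(suc _)} {m} pr 5≤p 2∣m m≈1 p∣x =
    m≈1 , m % q , ∣B⇒irregular pr 5≤p m 2∣m m≈1 (proj₁ (∣B/m⇔∣B pr 5≤p m m≈1) p∣x) , %-≈ m q
  ∣B/m⇒residue {suc zero} pr (s≤s ()) _ _ _

  residue⇒∣B/m : ∀ {p m} .{{_ : NonZero m}} → 2 ∣ m → Residue p m → p ∣ ℤ.∣ ↥ (B m ÷ℕ m) ∣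
  residue⇒∣B/m {zero} 2∣m (m≈1 , l , irr , m≈l) = contradiction (IrregularPair.prime irr) ¬prime[0]
  residue⇒∣B/m {suc zero} 2∣m (m≈1 , l , irr , m≈l) = contradiction (IrregularPair.prime irr) ¬prime[1]
  residue⇒∣B/m {suc q@(suc _)} {m} 2∣m (m≈1 , l , irr , m≈l) =
    proj₂ (∣B/m⇔∣B prime 5≤p m m≈1) (irregular⇒∣B prime 5≤p m 2∣m m≈1 (subst (IrregularPair (suc q)) l≡ irr))
    where
    open IrregularPair irr
    5≤p = irregular⇒5≤ irr
    l<q : l < q
    l<q = ≤-trans (≤-trans (≤-reflexive (+-comm 1 l)) (+-monoʳ-≤ l (s≤s (z≤n {1})))) (≤-pred (subst (_≤ suc q) (+-suc l 2) l≤p-3))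
    l≡ : l ≡ m % q
    l≡ = ≈⇒≡ l<q (m%n<n m q) (≈-trans (≈-sym m≈l) (%-≈ m q))

  Λ-Solution⇒Solution : ∀ {n} {p : Vector ℕ n} m → (∀ i → Irregular (p i)) → Λ-Solution (∏ p) m → Solution p m
  Λ-Solution⇒Solution {p = p} (2+ k) irr sol = s≤s (s≤s z≤n) , 2∣m , λ i →
    ∣B/m⇒residue (IrregularPair.prime (proj₂ (irr i))) (irregular⇒5≤ (proj₂ (irr i))) 2∣m
      (∣⇒≈ {a = + 2+ k} (∣-trans (∣-∏ p i) c∣m-1)) (∣-trans (∣-∏ p i) c∣x)
    where
    divisibility = Λ-Solution⇒∣ k sol
    2∣m = proj₁ divisibility
    c∣m-1 = proj₁ (proj₂ divisibility)
    c∣x = proj₂ (proj₂ divisibility)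

  Solution⇒Λ-Solution : ∀ {n} {p : Vector ℕ n} m → Prime-family p → Solution p m → Λ-Solution (∏ p) m
  Solution⇒Λ-Solution (suc zero) family (s≤s () , _)
  Solution⇒Λ-Solution {p = p} (2+ k) family (2≤m , 2∣m , residue) = ∣⇒Λ-Solution k 2∣m
    (∏-least p family (λ i → ≈⇒∣ {a = + 2+ k} (proj₁ (residue i))))
    (∏-least p family (λ i → residue⇒∣B/m 2∣m (residue i)))

-- Simultaneous congruences for moduli that need not be coprime

module ChineseRemainder where

  open Congruences
  open LambdaSolutions
  open import Data.Integer.Base as ℤ using (ℤ; +_; 0ℤ)
  import Data.Integer.Properties as ℤ
  open import Data.Nat.Base as ℕ using (ℕ; zero; suc; NonZero; _*_; _+_)
  open import Data.Nat.Coprimality as Coprimality using (coprime-divisor; coprime-factors; coprime-/gcd)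
  open import Data.Nat.Divisibility
  open import Data.Nat.DivMod using (_/_)
  open import Data.Nat.GCD
  open import Data.Nat.LCM
  open import Data.Nat.Primality hiding (prime)
  open import Data.Nat.Properties
  open import Data.Product.Base using (_×_; _,_; proj₁; proj₂)
  open import Data.Sum.Base using (inj₁)
  open import Data.Vec.Functional using (Vector; foldr)
  open import Data.Fin.Base using (Fin; zero; suc)
  import Data.Fin.Properties as Fin
  open import Function.Base using (_∘_)
  open import Relation.Nullary.Decidable using (yes; no)

  -- With g = gcd a b the cofactors a / g and b / g are coprime, and gcd (lcm a b) n divides both
  -- (a / g) (gcd b n) and (b / g) (gcd a n).
  gcd-lcm-∣ : ∀ a b n {z} .{{_ : NonZero a}} → gcd a n ∣ z → gcd b n ∣ z → gcd (lcm a b) n ∣ z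
  gcd-lcm-∣ a b n {z} a∣z b∣z = coprime-factors (coprime-/gcd a b) (d∣ b a′ lcm≡a′b b∣z , d∣ a b′ lcm≡b′a a∣z)
    where
    instance
      g≢0 : NonZero (gcd a b)
      g≢0 = ℕ.≢-nonZero (gcd[m,n]≢0 a b (inj₁ (ℕ.≢-nonZero⁻¹ a)))
    a′ = a / gcd a b
    b′ = b / gcd a b
    a≡ : a ≡ gcd a b * a′
    a≡ = trans (m∣n⇒n≡m*quotient (gcd[m,n]∣m a b)) (cong (gcd a b *_) (sym (n/m≡quotient (gcd[m,n]∣m a b))))
    b≡ : b ≡ gcd a b * b′
    b≡ = trans (m∣n⇒n≡m*quotient (gcd[m,n]∣n a b)) (cong (gcd a b *_) (sym (n/m≡quotient (gcd[m,n]∣n a b))))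
    lcm≡a′b : lcm a b ≡ a′ * b
    lcm≡a′b = *-cancelˡ-≡ _ _ (gcd a b) (trans (gcd*lcm a b) (trans (cong (_* b) a≡) (*-assoc (gcd a b) a′ b)))
    lcm≡b′a : lcm a b ≡ b′ * a
    lcm≡b′a = *-cancelˡ-≡ _ _ (gcd a b) (trans (gcd*lcm a b) (trans (*-comm a b) (trans (cong (_* a) b≡) (*-assoc (gcd a b) b′ a))))
    d = gcd (lcm a b) n
    d∣ : ∀ y x → lcm a b ≡ x * y → gcd y n ∣ z → d ∣ x * z
    d∣ y x lcm≡xy y∣z = ∣-trans
      (subst (d ∣_) (sym (c*gcd[m,n]≡gcd[cm,cn] x y n))
        (gcd-greatest (subst (d ∣_) lcm≡xy (gcd[m,n]∣m (lcm a b) n)) (∣n⇒∣m*n x (gcd[m,n]∣n (lcm a b) n))))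
      (*-monoʳ-∣ x y∣z)

  -- Distributivity of gcd over lcm: a residue compatible with each modulus separately is compatible
  -- with their lcm.
  gcd-foldr-lcm-∣ : ∀ {k} c (m : Vector ℕ k) n {z} → (∀ i → NonZero (m i)) →
                    gcd c n ∣ z → (∀ i → gcd (m i) n ∣ z) → gcd (foldr lcm c m) n ∣ z
  gcd-foldr-lcm-∣ {zero}  c m n m≢0 c∣z m∣z = c∣z
  gcd-foldr-lcm-∣ {suc k} c m n m≢0 c∣z m∣z = gcd-lcm-∣ (m zero) _ n {{m≢0 zero}} (m∣z zero)
    (gcd-foldr-lcm-∣ c (m ∘ suc) n (m≢0 ∘ suc) c∣z (m∣z ∘ suc))

  base∣foldr-lcm : ∀ {k} c (m : Vector ℕ k) → c ∣ foldr lcm c m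
  base∣foldr-lcm {zero}  c m = ∣-refl
  base∣foldr-lcm {suc k} c m = ∣-trans (base∣foldr-lcm c (m ∘ suc)) (n∣lcm[m,n] (m zero) _)

  ∣foldr-lcm : ∀ {k} c (m : Vector ℕ k) i → m i ∣ foldr lcm c m
  ∣foldr-lcm c m zero    = m∣lcm[m,n] (m zero) _
  ∣foldr-lcm c m (suc i) = ∣-trans (∣foldr-lcm c (m ∘ suc) i) (n∣lcm[m,n] (m zero) _)

  foldr-lcm-least : ∀ {k} c (m : Vector ℕ k) {z} → c ∣ z → (∀ i → m i ∣ z) → foldr lcm c m ∣ z
  foldr-lcm-least {zero}  c m c∣z m∣z = c∣z
  foldr-lcm-least {suc k} c m c∣z m∣z = lcm-least (m∣z zero) (foldr-lcm-least c (m ∘ suc) c∣z (m∣z ∘ suc))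

  bézout : ∀ M n → ∃[ w ] + gcd M n ≈ w ℤ.* + M [ n ]
  bézout M n = from (Bézout.identity (gcd-GCD M n))
    where
    open ≡-Reasoning
    open import Data.Integer.Tactic.RingSolver using (solve-∀)
    ring : ∀ g u → g ≡ (g ℤ.+ u) ℤ.+ ℤ.- u
    ring = solve-∀
    ring′ : ∀ v x M → v ℤ.+ ℤ.- (x ℤ.* M) ≡ ℤ.- x ℤ.* M ℤ.+ v
    ring′ = solve-∀
    from : ∀ {g} → Bézout.Identity g M n → ∃[ w ] + g ≈ w ℤ.* + M [ n ]
    from {g} (Bézout.+- x y eq) = + x , ≈-sym (+ y , trans (sym (ℤ.pos-* x M)) (trans (cong +_ (sym eq)) (cong (ℤ._+_ (+ g)) (ℤ.pos-* y n))))
    from {g} (Bézout.-+ x y eq) = ℤ.- + x , (+ y , (begin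
      + g                                            ≡⟨ ring (+ g) (+ x ℤ.* + M) ⟩
      (+ g ℤ.+ + x ℤ.* + M) ℤ.+ ℤ.- (+ x ℤ.* + M)
        ≡⟨ cong (ℤ._+ ℤ.- (+ x ℤ.* + M)) (trans (cong (ℤ._+_ (+ g)) (sym (ℤ.pos-* x M))) (trans (cong +_ eq) (ℤ.pos-* y n))) ⟩
      + y ℤ.* + n ℤ.+ ℤ.- (+ x ℤ.* + M)              ≡⟨ ring′ (+ y ℤ.* + n) (+ x) (+ M) ⟩
      ℤ.- + x ℤ.* + M ℤ.+ + y ℤ.* + n                ∎))

  -- With g the gcd, x = a + k g and g ≡ w M modulo n, the number k w M is a multiple of M congruent
  -- to k g modulo n; subtracting it from x gives y.
  chineseRemainder₂ : ∀ M n x a → x ≈ a [ gcd M n ] → ∃[ y ] (y ≈ x [ M ] × y ≈ a [ n ])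
  chineseRemainder₂ M n x a (k , x≡a+kg) = x ℤ.+ ℤ.- (k ℤ.* (w ℤ.* + M)) , (ℤ.- (k ℤ.* w) , ring₁ x k w (+ M)) , (begin
    x ℤ.+ ℤ.- (k ℤ.* (w ℤ.* + M))                     ≈⟨ ≈-+ (≈-refl {x}) (≈-neg (≈-* (≈-refl {k}) g≈wM)) ⟨
    x ℤ.+ ℤ.- (k ℤ.* + gcd M n)                       ≡⟨ cong (ℤ._+ ℤ.- (k ℤ.* + gcd M n)) x≡a+kg ⟩
    a ℤ.+ k ℤ.* + gcd M n ℤ.+ ℤ.- (k ℤ.* + gcd M n)   ≡⟨ ring₂ a (k ℤ.* + gcd M n) ⟩
    a                                                 ∎)
    where
    open import Relation.Binary.Reasoning.Setoid (≈-setoid n)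
    open import Data.Integer.Tactic.RingSolver using (solve-∀)
    w = proj₁ (bézout M n)
    g≈wM = proj₂ (bézout M n)
    ring₁ : ∀ x k w M → x ℤ.+ ℤ.- (k ℤ.* (w ℤ.* M)) ≡ x ℤ.+ ℤ.- (k ℤ.* w) ℤ.* M
    ring₁ = solve-∀
    ring₂ : ∀ a u → a ℤ.+ u ℤ.+ ℤ.- u ≡ a
    ring₂ = solve-∀

  -- The unknown will be m - 1, which has residue 0 modulo c and l ν - 1 modulo p ν - 1. The modulus
  -- `c` is the base of the fold, as in the upper bound for m_S.
  chineseRemainder : ∀ {k} c (m : Vector ℕ k) (a : Vector ℤ k) → (∀ i → NonZero (m i)) →
    (∀ i → a i ≈ 0ℤ [ gcd c (m i) ]) → (∀ i j → i ≢ j → a i ≈ a j [ gcd (m i) (m j) ]) →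
    ∃[ x ] (x ≈ 0ℤ [ c ] × (∀ i → x ≈ a i [ m i ]))
  chineseRemainder {zero}  c m a m≢0 a≈0 a≈a = 0ℤ , ≈-refl , λ ()
  chineseRemainder {suc k} c m a m≢0 a≈0 a≈a = y , ≈-trans (≈-mono (base∣foldr-lcm c (m ∘ suc)) y≈x) x≈0 , λ where
      zero    → y≈a
      (suc i) → ≈-trans (≈-mono (∣foldr-lcm c (m ∘ suc) i) y≈x) (x≈a i)
    where
    rest = chineseRemainder c (m ∘ suc) (a ∘ suc) (m≢0 ∘ suc) (a≈0 ∘ suc)
             (λ i j i≢j → a≈a (suc i) (suc j) (i≢j ∘ Fin.suc-injective))
    x = proj₁ rest
    x≈0 = proj₁ (proj₂ rest)
    x≈a = proj₂ (proj₂ rest)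
    compatible : x ≈ a zero [ gcd (foldr lcm c (m ∘ suc)) (m zero) ]
    compatible = ∣⇒≈ (gcd-foldr-lcm-∣ c (m ∘ suc) (m zero) (m≢0 ∘ suc)
      (≈⇒∣ (≈-trans (≈-mono (gcd[m,n]∣m c (m zero)) x≈0) (≈-sym (a≈0 zero))))
      (λ i → ≈⇒∣ (≈-trans (≈-mono (gcd[m,n]∣m (m (suc i)) (m zero)) (x≈a i)) (a≈a (suc i) zero λ ()))))
    step = chineseRemainder₂ (foldr lcm c (m ∘ suc)) (m zero) x (a zero) compatible
    y = proj₁ step
    y≈x = proj₁ (proj₂ step)
    y≈a = proj₂ (proj₂ step)

  -- A product of distinct primes is squarefree, so a divisor d of it is the product of the p i that
  -- divide d.
  ∣∏⇒∣ : ∀ {n d z} (p : Vector ℕ n) → Prime-family p → d ∣ ∏ p → (∀ i → p i ∣ d → p i ∣ z) → d ∣ z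
  ∣∏⇒∣ {zero}  {z = z} p family d∣1 h = ∣-trans d∣1 (1∣ z)
  ∣∏⇒∣ {suc n} {d} {z} p family@(injective , primes) d∣∏ h with p zero ∣? d
  ... | no p₀∤d = ∣∏⇒∣ (p ∘ suc) (tail-family {p = p} family)
    (coprime-divisor (Coprimality.sym (∤⇒coprime (primes zero) p₀∤d)) d∣∏) (h ∘ suc)
  ... | yes p₀∣d@(divides e refl) = subst (_∣ z) (*-comm (p zero) e) (coprime⇒*∣ (∤⇒coprime (primes zero) p₀∤e) (h zero p₀∣d)
      (∣∏⇒∣ (p ∘ suc) (tail-family {p = p} family) e∣∏ (λ i pᵢ∣e → h (suc i) (∣m⇒∣m*n (p zero) pᵢ∣e))))
    where
    e∣∏ : e ∣ ∏ (p ∘ suc)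
    e∣∏ = *-cancelʳ-∣ (p zero) {{prime⇒nonZero (primes zero)}} (subst (e * p zero ∣_) (*-comm (p zero) _) d∣∏)
    p₀∤e : p zero ∤ e
    p₀∤e p₀∣e = ∤-∏ (p ∘ suc) (primes zero) (primes ∘ suc) (λ i p₀≡pᵢ → Fin.0≢1+n (injective p₀≡pᵢ)) (∣-trans p₀∣e e∣∏)

-- The integers m_S and the minimum

module LambdaMinimum where

  open Congruences
  open KummerCongruence using (≈?)
  open IrregularPairs using (odd-prime⇒2∣q)
  open LambdaSolutions
  open ChineseRemainder
  open import Data.Integer.Base as ℤ using (ℤ; +_; 0ℤ; 1ℤ)
  import Data.Integer.Properties as ℤ
  open import Data.Integer.DivMod using (_%ℕ_; n%ℕd<d)
  open import Data.Nat.Base as ℕ using (ℕ; zero; suc; 2+; NonZero; _≤_; _<_; z≤n; s≤s; _∸_; _*_; _+_)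
  open import Data.Nat.Coprimality as Coprimality using (Coprime)
  open import Data.Nat.Divisibility
  open import Data.Nat.GCD
  open import Data.Nat.LCM
  open import Data.Nat.Primality hiding (prime)
  open import Data.Nat.Properties
  open import Data.Product using (_×_; _,_; ∃; ∃!; proj₁; proj₂)
  open import Data.Sum.Base using (_⊎_; inj₁; inj₂; [_,_]′)
  open import Data.Vec.Functional using (Vector; foldr)
  open import Data.Fin.Base using (Fin; zero; suc)
  import Data.Fin.Properties as Fin
  open import Function.Base using (_∘_; case_of_)
  open import Function.Definitions using (Injective)
  open import Relation.Nullary.Construct.Add.Supremum using (⊤⁺; [_])
  open import Relation.Nullary.Decidable using (Dec; yes; no; map′; ¬?; _×-dec_)
  open import Relation.Nullary.Negation using (¬_; contradiction)

  irregularPair? : ∀ {p} → Prime p → ∀ l → Dec (IrregularPair p l)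
  irregularPair? {p} pr l = map′
    (λ (odd , even , 2≤l , l≤p-3 , p∣B) → record
      { prime = pr ; odd = odd ; even = even ; 2≤l = 2≤l ; l≤p-3 = l≤p-3 ; p∣B = p∣B })
    (λ irr → IrregularPair.odd irr , IrregularPair.even irr , IrregularPair.2≤l irr , IrregularPair.l≤p-3 irr , IrregularPair.p∣B irr)
    (¬? (p ≟ 2) ×-dec 2 ∣? l ×-dec 2 ≤? l ×-dec l + 3 ≤? p ×-dec p ∣? _)

  irregular⇒l<p : ∀ {p l} → IrregularPair p l → l < p
  irregular⇒l<p {p} {l} irr = ≤-trans (subst (suc l ≤_) (+-comm 3 l) (m≤n+m (suc l) 2)) (IrregularPair.l≤p-3 irr)

  residue? : ∀ {p} → Prime p → ∀ m → Dec (Residue p m)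
  residue? {p} pr m = ≈? (+ m) 1ℤ p ×-dec map′
    (λ (l , _ , irr , m≈l) → l , irr , m≈l)
    (λ (l , irr , m≈l) → l , irregular⇒l<p irr , irr , m≈l)
    (anyUpTo? (λ l → irregularPair? pr l ×-dec ≈? (+ m) (+ l) (p ∸ 1)) p)

  -- A minimum found below N is minimal among all numbers; failure only excludes numbers below N, so
  -- N has to be chosen such that this refutes every solution.
  least : ∀ {P : ℕ → Set} → (∀ n → Dec (P n)) → ∀ N →
          (∃[ m ] (m < N × P m × (∀ k → P k → m ≤ k))) ⊎ (∀ k → k < N → ¬ P k)
  least P? zero = inj₂ λ _ ()
  least P? (suc N) with least P? N
  ... | inj₁ (m , m<N , Pm , minimal) = inj₁ (m , m<n⇒m<1+n m<N , Pm , minimal)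
  ... | inj₂ none with P? N
  ...   | yes PN = inj₁ (N , ≤-refl , PN , λ k Pk → ≮⇒≥ λ k<N → none k k<N Pk)
  ...   | no ¬PN = inj₂ λ k k<1+N Pk → [ (λ k<N → none k k<N Pk) , (λ k≡N → ¬PN (subst _ k≡N Pk)) ]′ (m≤n⇒m<n∨m≡n (≤-pred k<1+N))

  pred-≈ : ∀ {M a b n} → M ≈ a [ n ] → a ℤ.- 1ℤ ≡ b → M ℤ.- 1ℤ ≈ b [ n ]
  pred-≈ M≈a a-1≡b = ≈-trans (≈-+ M≈a (≈-refl {ℤ.- 1ℤ})) (≈-reflexive a-1≡b)

  unpred-≈ : ∀ {M a n} → M ℤ.- 1ℤ ≈ a ℤ.- 1ℤ [ n ] → M ≈ a [ n ]
  unpred-≈ {M} {a} M-1≈a-1 = subst₂ (_≈_[ _ ]) (ring M) (ring a) (≈-+ M-1≈a-1 (≈-refl {1ℤ}))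
    where
    open import Data.Integer.Tactic.RingSolver using (solve-∀)
    ring : ∀ M → M ℤ.- 1ℤ ℤ.+ 1ℤ ≡ M
    ring = solve-∀

  p≈1 : ∀ p .{{_ : NonZero p}} → + p ≈ 1ℤ [ p ∸ 1 ]
  p≈1 (suc q) = 1ℤ , cong (ℤ._+_ 1ℤ) (sym (ℤ.*-identityˡ (+ q)))

  coprime-pred : ∀ {p} → Prime p → Coprime p (p ∸ 1)
  coprime-pred {suc q@(suc _)} pr = ∤⇒coprime pr (>⇒∤ ≤-refl)
  coprime-pred {suc zero} pr = contradiction pr ¬prime[1]

  ≈-combine : ∀ {m n a b} → Coprime m n → a ≈ b [ m ] → a ≈ b [ n ] → a ≈ b [ m * n ]
  ≈-combine m⊥n a≈b a≈b′ = ∣⇒≈ (coprime⇒*∣ m⊥n (≈⇒∣ a≈b) (≈⇒∣ a≈b′))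

  module _ {n : ℕ} (p : Vector ℕ n) (injective : Injective _≡_ _≡_ p) (irregularP : ∀ ν → Irregular (p ν)) where

    private
      primes : ∀ i → Prime (p i)
      primes i = IrregularPair.prime (proj₂ (irregularP i))

      family : Prime-family p
      family = injective , primes

      5≤p : ∀ i → 5 ≤ p i
      5≤p i = irregular⇒5≤ (proj₂ (irregularP i))

      c L : ℕ
      c = ∏ p
      L = foldr lcm c (λ ν → p ν ∸ 1)

      instance
        p≢0 : ∀ {i} → NonZero (p i)
        p≢0 {i} = prime⇒nonZero (primes i)

      p-1≢0 : ∀ i → NonZero (p i ∸ 1)
      p-1≢0 i with p i | 5≤p i
      ... | suc (suc _) | _ = _
      ... | suc zero    | s≤s ()

      ∏≢0 : ∀ {k} (p : Vector ℕ k) → (∀ i → NonZero (p i)) → NonZero (∏ p)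
      ∏≢0 {zero}  p p≢0 = _
      ∏≢0 {suc k} p p≢0 = m*n≢0 (p zero) (∏ (p ∘ suc)) {{p≢0 zero}} {{∏≢0 (p ∘ suc) (p≢0 ∘ suc)}}

      lcm≢0 : ∀ m n → NonZero m → NonZero n → NonZero (lcm m n)
      lcm≢0 m n m≢0 n≢0 = ℕ.≢-nonZero λ lcm≡0 → ℕ.≢-nonZero⁻¹ (m * n) {{m*n≢0 m n {{m≢0}} {{n≢0}}}}
        (trans (sym (gcd*lcm m n)) (trans (cong (gcd m n *_) lcm≡0) (*-zeroʳ (gcd m n))))

      foldr-lcm≢0 : ∀ {k} c (m : Vector ℕ k) → NonZero c → (∀ i → NonZero (m i)) → NonZero (foldr lcm c m)
      foldr-lcm≢0 {zero}  c m c≢0 m≢0 = c≢0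
      foldr-lcm≢0 {suc k} c m c≢0 m≢0 = lcm≢0 (m zero) _ (m≢0 zero) (foldr-lcm≢0 c (m ∘ suc) c≢0 (m≢0 ∘ suc))

      instance
        c≢0 : NonZero c
        c≢0 = ∏≢0 p (λ i → p≢0 {i})

        L≢0 : NonZero L
        L≢0 = foldr-lcm≢0 c (λ ν → p ν ∸ 1) c≢0 p-1≢0

    -- The congruence for m_S - 1 modulo p (p - 1), split into its two coprime parts: p (l - 1) is 0
    -- modulo p and l - 1 modulo p - 1.
    LiesOver : Vector ℕ n → ℤ → Set
    LiesOver l M = ∀ i → M ≈ 1ℤ [ p i ] × M ≈ + l i [ p i ∸ 1 ]

    private
      p≈0 : ∀ i (x : ℤ) → + p i ℤ.* x ≈ 0ℤ [ p i ]
      p≈0 i x = x , trans (ℤ.*-comm (+ p i) x) (sym (ℤ.+-identityˡ _))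

      px≈x : ∀ i (x : ℤ) → + p i ℤ.* x ≈ x [ p i ∸ 1 ]
      px≈x i x = ≈-trans (≈-* (p≈1 (p i)) (≈-refl {x})) (≈-reflexive (ℤ.*-identityˡ x))

    Is-m_S⇒LiesOver : ∀ {l M} → Is-m_S p l M → LiesOver l M
    Is-m_S⇒LiesOver {l} {M} is i =
      unpred-≈ (≈-trans (≈-mono (m∣m*n (p i ∸ 1)) M-1≈) (p≈0 i x)) ,
      unpred-≈ (≈-trans (≈-mono (n∣m*n (p i)) M-1≈) (px≈x i x))
      where
      x = + l i ℤ.- 1ℤ
      M-1≈ : M ℤ.- 1ℤ ≈ + p i ℤ.* x [ p i * (p i ∸ 1) ]
      M-1≈ = ∣⇒≈ (Is-m_S.congruence is i)

    LiesOver⇒c∣ : ∀ {l m} → LiesOver l (+ suc m) → c ∣ m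
    LiesOver⇒c∣ {m = m} over = ∏-least p family (λ i → ≈⇒∣ {a = + suc m} (proj₁ (over i)))

    -- The lower bound is automatic: c divides m - 1, which is positive.
    LiesOver⇒Is-m_S : ∀ {l m} → LiesOver l (+ m) → 2 ≤ m → m ≤ suc L → Is-m_S p l (+ m)
    LiesOver⇒Is-m_S {l} {m@(2+ k)} over 2≤m m≤1+L = record
      { lower      = ℤ.+≤+ (∣⇒≤ (LiesOver⇒c∣ {l} over))
      ; upper      = ℤ.+≤+ (≤-pred m≤1+L)
      ; congruence = λ i → ≈⇒∣ (≈-combine {a = + suc k} (coprime-pred (primes i))
          (≈-trans (pred-≈ (proj₁ (over i)) refl) (≈-sym (p≈0 i (+ l i ℤ.- 1ℤ))))
          (≈-trans (pred-≈ (proj₂ (over i)) refl) (≈-sym (px≈x i (+ l i ℤ.- 1ℤ)))))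
      }
    LiesOver⇒Is-m_S {m = suc zero} _ (s≤s ()) _

    -- Since c ≥ 1, the admissible M lie among the L consecutive integers 2, ..., L + 1, and a class
    -- modulo L meets these exactly once.
    Is-m_S-bounds : ∀ {l M} → Is-m_S p l M → ∃[ k ] (M ≡ + 2+ k × k < L)
    Is-m_S-bounds {l} {M} is = bounds (M ℤ.- 1ℤ) refl (Is-m_S.lower is) (Is-m_S.upper is)
      where
      open import Data.Integer.Tactic.RingSolver using (solve-∀)
      ring : ∀ M → M ≡ M ℤ.- 1ℤ ℤ.+ 1ℤ
      ring = solve-∀
      bounds : ∀ x → M ℤ.- 1ℤ ≡ x → + c ℤ.≤ x → x ℤ.≤ + L → ∃[ k ] (M ≡ + 2+ k × k < L)
      bounds (+ zero)  eq (ℤ.+≤+ c≤0) _           = contradiction (≤-trans (ℕ.>-nonZero⁻¹ c) c≤0) λ ()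
      bounds (+ suc k) eq _           (ℤ.+≤+ k<L) = k , trans (ring M) (trans (cong (ℤ._+ 1ℤ) eq) (cong +_ (+-comm (suc k) 1))) , k<L

    LiesOver-unique : ∀ {l M N} → LiesOver l M → LiesOver l N → M ≈ N [ L ]
    LiesOver-unique overM overN = ∣⇒≈ (foldr-lcm-least c (λ ν → p ν ∸ 1)
      (∏-least p family (λ i → ≈⇒∣ (≈-trans (proj₁ (overM i)) (≈-sym (proj₁ (overN i))))))
      (λ i → ≈⇒∣ (≈-trans (proj₂ (overM i)) (≈-sym (proj₂ (overN i))))))

    Is-m_S-unique : ∀ {l M N} → Is-m_S p l M → Is-m_S p l N → M ≡ N
    Is-m_S-unique {l} isM isN = unique (Is-m_S-bounds isM) (Is-m_S-bounds isN)
      (LiesOver-unique (Is-m_S⇒LiesOver isM) (Is-m_S⇒LiesOver isN))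
      where
      unique : ∀ {M N} → ∃[ j ] (M ≡ + 2+ j × j < L) → ∃[ k ] (N ≡ + 2+ k × k < L) → M ≈ N [ L ] → M ≡ N
      unique (j , refl , j<L) (k , refl , k<L) M≈N =
        cong (λ x → + 2+ x) (≈⇒≡ j<L k<L (≈-+ M≈N (≈-refl {ℤ.- + 2})))

    module _ {l : Vector ℕ n} (sf : StrongFriendly p l) where
      open StrongFriendly sf

      private
        a : Vector ℤ n
        a i = + l i ℤ.- 1ℤ

        -- The gcd is squarefree, being a divisor of c, so its prime factors p j can be treated one
        -- by one. Each satisfies p i ≡ 1 modulo p j, and the strong condition then gives l i ≡ 1; j
        -- = i is impossible because p i is prime to p i - 1.
        a≈0 : ∀ i → a i ≈ 0ℤ [ gcd c (p i ∸ 1) ]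
        a≈0 i = ∣⇒≈0 (∣∏⇒∣ p family (gcd[m,n]∣m c (p i ∸ 1)) λ j pⱼ∣g → pⱼ∣a j (∣-trans pⱼ∣g (gcd[m,n]∣n c (p i ∸ 1))))
          where
          pᵢ-1 : ∀ q .{{_ : NonZero q}} → ℤ.∣ + q ℤ.- 1ℤ ∣ ≡ q ∸ 1
          pᵢ-1 (suc q) = refl
          pⱼ∣a : ∀ j → p j ∣ p i ∸ 1 → p j ∣ ℤ.∣ a i ∣
          pⱼ∣a j pⱼ∣pᵢ-1 with i Fin.≟ j
          ... | yes refl = contradiction (subst Prime (coprime-pred (primes i) (∣-refl , pⱼ∣pᵢ-1)) (primes i)) ¬prime[1]
          ... | no i≢j with strong i j i≢j
          ...   | inj₁ pᵢ≢1     = contradiction (subst (p j ∣_) (sym (pᵢ-1 (p i))) pⱼ∣pᵢ-1) pᵢ≢1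
          ...   | inj₂ (_ , l≡1) = l≡1

        a≈a : ∀ i j → i ≢ j → a i ≈ a j [ gcd (p i ∸ 1) (p j ∸ 1) ]
        a≈a i j i≢j = ≈-+ (∣⇒≈ {a = + l i} {b = + l j} (friendly i j i≢j)) (≈-refl {ℤ.- 1ℤ})

      ∃-LiesOver : ∃[ m ] (LiesOver l (+ m) × 2 ≤ m × m ≤ suc L)
      ∃-LiesOver = m , over , s≤s (s≤s z≤n) , s≤s (n%ℕd<d (x ℤ.- 1ℤ) L)
        where
        remainder = chineseRemainder c (λ ν → p ν ∸ 1) a p-1≢0 a≈0 a≈a
        x = proj₁ remainder
        x≈0 = proj₁ (proj₂ remainder)
        x≈a = proj₂ (proj₂ remainder)
        -- This makes m - 1 the representative of x in 1, ..., L. The remainder of x itself could be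
        -- 0, which would give m = 1.
        m = 2+ ((x ℤ.- 1ℤ) %ℕ L)
        m≈ : + m ℤ.- 1ℤ ≈ x [ L ]
        m≈ = ≈-trans (≈-+ (≈-refl {1ℤ}) (%ℕ-≈ (x ℤ.- 1ℤ) L)) (≈-reflexive (ring x))
          where
          open import Data.Integer.Tactic.RingSolver using (solve-∀)
          ring : ∀ x → 1ℤ ℤ.+ (x ℤ.- 1ℤ) ≡ x
          ring = solve-∀
        over : LiesOver l (+ m)
        over i = unpred-≈ (≈-trans (≈-mono (∣-trans (∣-∏ p i) (base∣foldr-lcm c (λ ν → p ν ∸ 1))) m≈) (≈-mono (∣-∏ p i) x≈0)) ,
                 unpred-≈ (≈-trans (≈-mono (∣foldr-lcm c (λ ν → p ν ∸ 1) i) m≈) (x≈a i))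

      ∃!-m_S : ∃! _≡_ (Is-m_S p l)
      ∃!-m_S = case ∃-LiesOver of λ where
        (m , over , 2≤m , m≤1+L) → let is = LiesOver⇒Is-m_S {l} over 2≤m m≤1+L in + m , is , Is-m_S-unique is

      LiesOver⇒Solution : ∀ {m} → Fin n → LiesOver l (+ m) → 2 ≤ m → Solution p m
      LiesOver⇒Solution {m} i over 2≤m = 2≤m , 2∣m , λ i → proj₁ (over i) , l i , irregular i , proj₂ (over i)
        where
        open IrregularPair (irregular i)
        2∣pred : ∀ {p} → Prime p → p ≢ 2 → 2 ∣ p ∸ 1
        2∣pred {suc q} = odd-prime⇒2∣q
        2∣pred {zero} _ _ = 2 ∣0
        -- One index suffices for the parity of m: m ≡ l i modulo p i - 1, and both l i and p i - 1
        -- are even.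
        2∣m : 2 ∣ m
        2∣m = ≈0⇒∣ (≈-trans (≈-mono (2∣pred prime odd) (proj₂ (over i))) (∣⇒≈0 even))

    Solution⇒StrongFriendly : ∀ {m} → Solution p m → ∃[ l ] (StrongFriendly p l × LiesOver l (+ m))
    Solution⇒StrongFriendly {m} (_ , _ , residue) = l , record
      { irregular = λ i → proj₁ (proj₂ (proj₂ (residue i)))
      ; friendly  = λ i j _ → ≈⇒∣ {a = + l i} {b = + l j} (≈-trans (≈-mono (gcd[m,n]∣m (p i ∸ 1) (p j ∸ 1)) (≈-sym (m≈l i)))
                                                    (≈-mono (gcd[m,n]∣n (p i ∸ 1) (p j ∸ 1)) (m≈l j)))
      ; strong    = λ i j _ → strong i j
      } , λ i → proj₁ (residue i) , m≈l i
      where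
      l : Vector ℕ n
      l i = proj₁ (proj₂ (residue i))
      m≈l : ∀ i → + m ≈ + l i [ p i ∸ 1 ]
      m≈l i = proj₂ (proj₂ (proj₂ (residue i)))
      pred∣ : ∀ {n} q .{{_ : NonZero q}} → n ∣ ℤ.∣ + q ℤ.- 1ℤ ∣ → n ∣ q ∸ 1
      pred∣ (suc q) n∣ = n∣
      -- If p j divides p i - 1, then m ≡ l i modulo p j by restriction, while m ≡ 1 modulo p j.
      strong : ∀ i j → (¬ (+ p i ≡ 1ℤ [mod p j ])) ⊎ (+ p i ≡ 1ℤ [mod p j ] × + l i ≡ 1ℤ [mod p j ])
      strong i j with p j ∣? ℤ.∣ + p i ℤ.- 1ℤ ∣
      ... | no  pᵢ≢1 = inj₁ pᵢ≢1
      ... | yes pᵢ≡1 = inj₂ (pᵢ≡1 , ≈⇒∣ {a = + l i} {b = 1ℤ} (≈-trans (≈-sym (≈-mono (pred∣ (p i) pᵢ≡1) (m≈l i))) (proj₁ (residue j))))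

    solution? : ∀ m → Dec (Solution p m)
    solution? m = 2 ≤? m ×-dec 2 ∣? m ×-dec Fin.all? (λ i → residue? (primes i) m)

    Λ⇒StrongFriendly : ∃ (Λ-Solution c) → ∃[ l ] StrongFriendly p l
    Λ⇒StrongFriendly (m , sol) = case Solution⇒StrongFriendly (Λ-Solution⇒Solution m irregularP sol) of λ where
      (l , sf , _) → l , sf

    Is-m_S⇒Solution : ∀ {l m} → Fin n → StrongFriendly p l → Is-m_S p l (+ m) → Solution p m × m < 2+ L
    Is-m_S⇒Solution i sf is = case Is-m_S-bounds is of λ where
      (k , refl , k<L) → LiesOver⇒Solution sf i (Is-m_S⇒LiesOver is) (s≤s (s≤s z≤n)) , s≤s (s≤s k<L)

    -- Both minima are identified with the least `Solution`: the solutions are exactly those of Λ,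
    -- every m_S is a solution, and every solution up to L + 1 is some m_S.
    Λ-is-min : Fin n → ∃[ x ] (IsΛ c x × IsMin (λ m → ∃[ l ] (StrongFriendly p l × Is-m_S p l (+ m))) x)
    Λ-is-min i = [ attained , (λ none → ⊤⁺ , unattained none) ]′ (least solution? (2+ L))
      where
      P : ℕ → Set
      P m = ∃[ l ] (StrongFriendly p l × Is-m_S p l (+ m))

      attained : ∃[ m ] (m < 2+ L × Solution p m × (∀ k → Solution p k → m ≤ k)) → ∃[ x ] (IsΛ c x × IsMin P x)
      attained (m , m<2+L , sol , minimal) = [ m ]
        , (Solution⇒Λ-Solution m family sol , λ k sol′ → minimal k (Λ-Solution⇒Solution k irregularP sol′))
        , ((case Solution⇒StrongFriendly sol of λ where
             (l , sf , over) → l , sf , LiesOver⇒Is-m_S {l} over (proj₁ sol) (≤-pred m<2+L))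
          , λ k (l , sf , is) → minimal k (proj₁ (Is-m_S⇒Solution i sf is)))

      -- A solution of any size yields a strong friendly family, over which `∃-LiesOver` finds a
      -- solution within the searched range.
      unattained : (∀ k → k < 2+ L → ¬ Solution p k) → IsΛ c ⊤⁺ × IsMin P ⊤⁺
      unattained none =
          (λ k sol → case Solution⇒StrongFriendly (Λ-Solution⇒Solution k irregularP sol) of λ where
            (l , sf , _) → case ∃-LiesOver sf of λ where
              (m , over , 2≤m , m≤1+L) → none m (s≤s m≤1+L) (LiesOver⇒Solution sf i over 2≤m))
        , (λ k (l , sf , is) → none k (proj₂ (Is-m_S⇒Solution i sf is)) (proj₁ (Is-m_S⇒Solution i sf is)))

open LambdaMinimum

theorem4p5 : ∀ (n : ℕ) → 2 ≤ n →
    (p : Vector ℕ n) → Injective _≡_ _≡_ p → (∀ ν → Irregular (p ν)) →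
    (∃ (Λ-Solution (∏ p)) → ∃[ l ] StrongFriendly p l)
    × (∀ l → StrongFriendly p l → ∃! _≡_ (Is-m_S p l))
    × (∃[ x ] (IsΛ (∏ p) x
    × IsMin (λ m → ∃[ l ] (StrongFriendly p l × Is-m_S p l (+ m))) x))
theorem4p5 (suc _) _ p injective irregular =
  Λ⇒StrongFriendly p injective irregular ,
  (λ l → ∃!-m_S p injective irregular) ,
  Λ-is-min p injective irregular zero
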